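{- Let $T$ be a tree with at least two vertices and with $n_1$ leaves. Then $F_t(T) \ge n_1$, with equality if and only if $T \in \mathcal{F}$.
   Context: All graphs are finite, simple and undirected. Forcing process: given a graph $G$ and an initial set $S \subseteq V(G)$ of colored vertices, at each step a colored vertex that has exactly one non-colored neighbor forces (colors) that neighbor. $S$ is a forcing set if iterating this eventually colors all of $V(G)$. A total forcing set (TF-set) is a forcing set $S$ such that $G[S]$ has no isolated vertex; $F_t(G)$ is the minimum cardinality of a TF-set of $G$. A leaf is a vertex of degree $1$; a strong support vertex is a vertex adjacent to at least two leaves. The family $\mathcal{F}$ is the smallest family of trees containing the path $P_2$ and closed under the following five operations, each producing a tree $T$ from a tree $T'$: (O1) if $uv$ is an edge of $T'$ with at least one of $u,v$ of degree at most $2$ in $T'$, subdivide $uv$ once; (O2) if $v$ is a strong support vertex of $T'$, add a new leaf adjacent to $v$; (O3) if $w$ is a strong support vertex of $T'$ and $v$ is a leaf neighbor of $w$, add two new leaves adjacent to $v$; (O4) if $v$ has degree at least $2$ in $T'$, add a new path $xyz$ and the edge $vy$; (O5) if $v$ has degree at least $2$ in $T'$, add new vertices $u_1,v_1,v_2,v_3,v_4,u_3$ with edges $u_1v_1, v_1v_2, v_2v_3, v_3v_4, v_3u_3$ (a star $K_{1,3}$ centered at $v_3$ with one edge subdivided twice) and the edge $vv_1$. -}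

module Defs where

open import Data.Nat using (ℕ; zero; suc; _+_; _≤_; _≡ᵇ_)
open import Data.Bool using (Bool; true; false; _∨_; _∧_; not)
open import Data.Fin using (Fin; zero; suc; splitAt; inject₁; fromℕ)
open import Data.Fin.Properties using (_≟_)
open import Data.Fin.Subset using (Subset; _∈_; _∉_; ⁅_⁆; _∪_; ⊤; ∣_∣)
open import Data.Vec using (tabulate)
open import Data.Sum using (_⊎_; inj₁; inj₂)
open import Data.Product using (Σ; _×_; _,_; ∃)
open import Data.Empty using (⊥)
open import Function.Definitions using (Injective)
open import Function.Bundles using (_↔_; Inverse)
open import Relation.Nullary using (¬_)
open import Relation.Nullary.Decidable using (⌊_⌋)
open import Relation.Binary.PropositionalEquality using (_≡_; _≢_)
open import Relation.Binary.Construct.Closure.ReflexiveTransitive using (Star)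

Graph : ℕ → Set
Graph n = Fin n → Fin n → Bool

_==_ : ∀ {n} → Fin n → Fin n → Bool
x == y = ⌊ x ≟ y ⌋

IsSimple : ∀ {n} → Graph n → Set
IsSimple {n} G = (∀ x y → G x y ≡ G y x) × (∀ x → G x x ≡ false)

N[_] : ∀ {n} → Graph n → Fin n → Subset n
N[ G ] v = tabulate (G v)

deg : ∀ {n} → Graph n → Fin n → ℕ
deg G v = ∣ N[ G ] v ∣

IsLeaf : ∀ {n} → Graph n → Fin n → Set
IsLeaf G v = deg G v ≡ 1

leaves : ∀ {n} → Graph n → ℕ
leaves G = ∣ tabulate (λ v → deg G v ≡ᵇ 1) ∣

StrongSupport : ∀ {n} → Graph n → Fin n → Set
StrongSupport G v = Σ _ λ a → Σ _ λ b →
  a ≢ b × G v a ≡ true × G v b ≡ true × IsLeaf G a × IsLeaf G b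

data Reach {n} (G : Graph n) (u : Fin n) : Fin n → Set where
  here : Reach G u u
  step : ∀ {w v} → Reach G u w → G w v ≡ true → Reach G u v

Connected : ∀ {n} → Graph n → Set
Connected G = ∀ u v → Reach G u v

record Cycle {n} (G : Graph n) : Set where
  field
    k      : ℕ
    c      : Fin (suc (suc (suc k))) → Fin n
    inj    : Injective _≡_ _≡_ c
    consec : ∀ (i : Fin (suc (suc k))) → G (c (inject₁ i)) (c (suc i)) ≡ true
    close  : G (c (fromℕ (suc (suc k)))) (c zero) ≡ true

Acyclic : ∀ {n} → Graph n → Set
Acyclic G = ¬ Cycle G

IsTree : ∀ {n} → Graph n → Set
IsTree G = IsSimple G × Connected G × Acyclic G

data ForceStep {n} (G : Graph n) : Subset n → Subset n → Set where
  force : ∀ {C u w} → u ∈ C → w ∉ C → G u w ≡ true →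
          (∀ x → G u x ≡ true → x ∉ C → x ≡ w) →
          ForceStep G C (C ∪ ⁅ w ⁆)

IsForcingSet : ∀ {n} → Graph n → Subset n → Set
IsForcingSet G S = Star (ForceStep G) S ⊤

NoIsolatedIn : ∀ {n} → Graph n → Subset n → Set
NoIsolatedIn G S = ∀ v → v ∈ S → Σ _ λ u → u ∈ S × G v u ≡ true

IsTFSet : ∀ {n} → Graph n → Subset n → Set
IsTFSet G S = IsForcingSet G S × NoIsolatedIn G S

IsFt : ∀ {n} → Graph n → ℕ → Set
IsFt G k = (Σ _ λ S → IsTFSet G S × ∣ S ∣ ≡ k)
         × (∀ S → IsTFSet G S → k ≤ ∣ S ∣)

Iso : ∀ {n m} → Graph n → Graph m → Set
Iso {n} {m} G H = Σ (Fin n ↔ Fin m) λ π →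
  ∀ a b → H (Inverse.to π a) (Inverse.to π b) ≡ G a b

extend : ∀ {n} k → Graph n → (Fin k → Fin n → Bool) → (Fin k → Fin k → Bool)
       → Graph (n + k)
extend {n} k O E N x y with splitAt n x | splitAt n y
... | inj₁ a | inj₁ b = O a b
... | inj₁ a | inj₂ j = E j a
... | inj₂ i | inj₁ b = E i b
... | inj₂ i | inj₂ j = N i j ∨ N j i

noNew : ∀ {k} → Fin k → Fin k → Bool
noNew _ _ = false

P₂ : Graph 2
P₂ x y = not (x == y)

-- (O1) subdivide edge uv: remove uv, add new vertex adjacent to u and v
O1 : ∀ {n} → Graph n → Fin n → Fin n → Graph (n + 1)
O1 G u v = extend 1
  (λ a b → G a b ∧ not ((a == u ∧ b == v) ∨ (a == v ∧ b == u)))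
  (λ _ a → a == u ∨ a == v) noNew

O2 : ∀ {n} → Graph n → Fin n → Graph (n + 1)
O2 G v = extend 1 G (λ _ a → a == v) noNew

O3 : ∀ {n} → Graph n → Fin n → Graph (n + 2)
O3 G v = extend 2 G (λ _ a → a == v) noNew

-- (O4) add a path x y z (new vertices 0,1,2) and the edge v y
O4 : ∀ {n} → Graph n → Fin n → Graph (n + 3)
O4 G v = extend 3 G (λ j a → j == suc zero ∧ a == v) N
  where
  N : Fin 3 → Fin 3 → Bool
  N zero (suc zero) = true
  N (suc zero) (suc (suc zero)) = true
  N _ _ = false

-- (O5) new vertices u₁ v₁ v₂ v₃ v₄ u₃ (= 0,…,5), edges u₁v₁, v₁v₂, v₂v₃,
-- v₃v₄, v₃u₃, and v v₁
O5 : ∀ {n} → Graph n → Fin n → Graph (n + 6)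
O5 G v = extend 6 G (λ j a → j == suc zero ∧ a == v) N
  where
  N : Fin 6 → Fin 6 → Bool
  N zero (suc zero) = true
  N (suc zero) (suc (suc zero)) = true
  N (suc (suc zero)) (suc (suc (suc zero))) = true
  N (suc (suc (suc zero))) (suc (suc (suc (suc zero)))) = true
  N (suc (suc (suc zero))) (suc (suc (suc (suc (suc zero))))) = true
  N _ _ = false

-- 𝓕: smallest family containing P₂, closed under O1–O5
-- (and, as a family of trees, under isomorphism).
data InF : ∀ {n} → Graph n → Set where
  base : InF P₂
  iso  : ∀ {n m} {G : Graph n} {H : Graph m} → InF G → Iso G H → InF H
  o1   : ∀ {n} {G : Graph n} {u v} → InF G → G u v ≡ true →
         (deg G u ≤ 2 ⊎ deg G v ≤ 2) → InF (O1 G u v)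
  o2   : ∀ {n} {G : Graph n} {v} → InF G → StrongSupport G v → InF (O2 G v)
  o3   : ∀ {n} {G : Graph n} {w v} → InF G → StrongSupport G w →
         G w v ≡ true → IsLeaf G v → InF (O3 G v)
  o4   : ∀ {n} {G : Graph n} {v} → InF G → 2 ≤ deg G v → InF (O4 G v)
  o5   : ∀ {n} {G : Graph n} {v} → InF G → 2 ≤ deg G v → InF (O5 G v)

{-# OPTIONS --safe #-}
-- A total forcing set splits the vertices into forcing chains. A leaf of the set has its only neighbor in
-- the set and never forces, and a leaf outside the set ends its chain, so each chain contains at most one
-- leaf; hence leaves ≤ ∣ S ∣, with equality iff every chain ends at a leaf, that is, iff every non-leaf
-- forces a neighbor. Equality is therefore encoded by a "chain cover": a relation u ⇝ w (u forces w) in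
-- which every non-leaf forces and every chain start is adjacent to another one.
-- Each of O1–O5 carries a chain cover along, together with a time function that makes it a valid forcing
-- process. Conversely, in a tree rooted at a leaf with a chain cover, a vertex far from the root is of one
-- of three irreducible shapes (a leaf, a vertex with exactly two leaf children, a vertex whose only child
-- is of the previous shape), unless one of O1–O5 can be undone keeping a rooted tree with a chain cover.
module Submission where

open import Defs
open import Data.Bool using (Bool; true; false; _∨_; _∧_; not) renaming (_≟_ to _≟ᵇ_)
open import Data.Bool.Properties using (T-≡; ∨-comm; ∧-comm; ∨-identityʳ; ∨-zeroʳ; ∧-identityʳ; ∧-zeroʳ; ¬-not; ⇔→≡)
open import Data.Empty using (⊥; ⊥-elim)
open import Data.Fin as Fin using (Fin; zero; suc; splitAt; join; toℕ; fromℕ<; punchIn; punchOut)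
open import Data.Fin.Properties using (_≟_; all?; suc-injective; splitAt-join; join-splitAt; pigeonhole; toℕ-injective; toℕ-inject₁; toℕ-fromℕ; toℕ-fromℕ<; toℕ≤pred[n]; punchIn-injective; punchIn-punchOut; punchInᵢ≢i) renaming (<⇒≢ to Fin-<⇒≢)
open import Data.Fin.Subset using (Subset; _∈_; _∉_; ⁅_⁆; _∪_; ⊤; ∣_∣; _-_; ∁; inside; outside; _⊆_)
open import Data.Fin.Subset.Properties using (_∈?_; ∈⊤; ∣⊤∣≡n; ∣p∣≤n; ∣∁p∣≡n∸∣p∣; p⊂q⇒∣p∣<∣q∣; p⊆p∪q; x∈p∪q⁺; x∈p∪q⁻; x∈⁅x⁆; x∈⁅y⁆⇒x≡y; x∈p∧x≢y⇒x∈p-y; x∈p⇒∣p-x∣<∣p∣; x∈∁p⇒x∉p; x∉p⇒x∈∁p; ⊆-antisym)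
open import Data.List using (List; []; _∷_; length; lookup)
open import Data.List.Membership.Propositional using () renaming (_∈_ to _∈ₗ_; _∉_ to _∉ₗ_)
open import Data.List.Membership.Propositional.Properties using (∈-lookup)
open import Data.List.Membership.DecPropositional using () renaming (_∈?_ to ∈ₗ?-with)
open import Data.List.Relation.Unary.All as All using (All; []; _∷_)
open import Data.List.Relation.Unary.AllPairs using ([]; _∷_)
open import Data.List.Relation.Unary.Any using (here; there; index)
open import Data.List.Relation.Unary.Any.Properties using (lookup-index)
open import Data.List.Relation.Unary.Unique.Propositional using (Unique)
open import Data.Maybe using (Maybe; just; nothing)
open import Data.Nat as ℕ using (ℕ; zero; suc; _+_; _≤_; _<_; z≤n; s≤s; _∸_; _≡ᵇ_)
import Data.Nat.Properties as ℕ
open import Data.Product using (_×_; _,_; ∃; proj₁; proj₂)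
open import Data.Sum using (_⊎_; inj₁; inj₂; swap)
open import Data.Unit using (tt) renaming (⊤ to Unit)
open import Data.Vec using (tabulate; []; _∷_; here; there)
open import Data.Vec.Properties using (lookup∘tabulate; lookup⇒[]=; []=⇒lookup)
open import Function using (_∘_; case_of_)
open import Function.Bundles using (_⇔_; mk⇔; mk↔ₛ′; Equivalence; Inverse)
open import Relation.Binary.Construct.Closure.ReflexiveTransitive using (Star; ε; _◅_)
open import Relation.Binary.Definitions using (tri<; tri≈; tri>)
open import Relation.Binary.PropositionalEquality
open import Relation.Nullary using (¬_; Dec; yes; no; contradiction; ¬?)
open import Relation.Nullary.Decidable using (from-yes; _→-dec_; True; toWitness)

-- Counting and degrees

-- Time is needed in one direction only. Membership in the family must yield a real forcing process,
-- hence `TimedCover`, whose `time` is adjusted in every operation. The converse argues locally: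
-- `ChainCover` keeps of the timing just `functional` and `asym`, so undoing an operation never has
-- to reconstruct a process. Treeness is likewise replaced in the converse by `Ranked`, a height
-- under which every vertex but the root has exactly one higher neighbor. It is built once and then
-- restricted, whereas connectedness and acyclicity would have to be reproved for each smaller
-- graph. A cover of `T` need not restrict to a smaller tree: a force that is still needed must not
-- be cut, and every start must keep a companion. These two obstacles decide which operation is
-- undone where. A cherry vertex forcing its parent is an accident of the chosen cover, removed by
-- `Redirect`; the remaining obstructions fix the local structure so far that another operation can
-- be undone.

Adj : ∀ {V : Set} → (V → V → Bool) → V → V → Set
Adj G x y = G x y ≡ true

-- The second alternative is an arbitrary `Q` and not the negation of `P`: the disjunction may come
-- from a recursion, with no decision procedure for `P` at hand.
search : ∀ {n} {P Q : Fin n → Set} → (∀ x → P x ⊎ Q x) → ∃ P ⊎ (∀ x → Q x)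
search {zero} f = inj₂ λ ()
search {suc n} {P} {Q} f with f zero | search {P = λ x → P (suc x)} {λ x → Q (suc x)} (λ x → f (suc x))
... | inj₁ p | _ = inj₁ (zero , p)
... | inj₂ _ | inj₁ (x , p) = inj₁ (suc x , p)
... | inj₂ q | inj₂ qs = inj₂ λ where
  zero → q
  (suc x) → qs x

search-min : ∀ {n} {P : Fin n → Set} (t : Fin n → ℕ) → (∀ x → Dec (P x)) →
  ∃ P → ∃ λ w → P w × (∀ x → P x → t w ≤ t x)
search-min {n} {P} t P? (w₀ , p₀) = go (suc (t w₀)) w₀ p₀ ℕ.≤-refl
  where
  go : ∀ b w → P w → t w < b → ∃ λ w → P w × (∀ x → P x → t w ≤ t x)
  go (suc b) w p (s≤s tw≤b)
    with search {P = λ x → P x × t x < t w} {λ x → P x → t w ≤ t x} smaller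
    where
    smaller : ∀ x → (P x × t x < t w) ⊎ (P x → t w ≤ t x)
    smaller x with P? x | t x ℕ.<? t w
    ... | yes px | yes lt = inj₁ (px , lt)
    ... | yes px | no ge = inj₂ λ _ → ℕ.≮⇒≥ ge
    ... | no ¬px | _ = inj₂ λ px → contradiction px ¬px
  ... | inj₁ (x , px , lt) = go b x px (ℕ.<-≤-trans lt tw≤b)
  ... | inj₂ least = w , p , least

-- The injection is a relation, so that the forcing relation itself can serve, in either direction.
-- The image of the first element is deleted from `q` before recursing.
∣∣-mono-injection : ∀ {m n} (p : Subset m) (q : Subset n) (R : Fin m → Fin n → Set) →
  (∀ {x} → x ∈ p → ∃ λ y → y ∈ q × R x y) →
  (∀ {x x′ y} → R x y → R x′ y → x ≡ x′) → ∣ p ∣ ≤ ∣ q ∣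
∣∣-mono-injection [] q R total inj = z≤n
∣∣-mono-injection (outside ∷ p) q R total inj =
  ∣∣-mono-injection p q (λ x → R (suc x)) (λ x∈p → total (there x∈p))
    (λ r r′ → suc-injective (inj r r′))
∣∣-mono-injection (inside ∷ p) q R total inj with total here
... | y₀ , y₀∈q , r₀ = ℕ.≤-trans
  (s≤s (∣∣-mono-injection p (q - y₀) (λ x → R (suc x)) total′
    (λ r r′ → suc-injective (inj r r′))))
  (x∈p⇒∣p-x∣<∣p∣ y₀∈q)
  where
  total′ : ∀ {x} → x ∈ p → ∃ λ y → y ∈ (q - y₀) × R (suc x) y
  total′ x∈p with total (there x∈p)
  ... | y , y∈q , r = y , x∈p∧x≢y⇒x∈p-y y∈q (λ { refl → contradiction (inj r₀ r) λ () }) , r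

-- If `y` were missed, `R` would inject `p` into the strictly smaller `q - y`.
∣∣-injection-surjective : ∀ {m n} (p : Subset m) (q : Subset n) (R : Fin m → Fin n → Set) →
  (∀ {x} → x ∈ p → ∃ λ y → y ∈ q × R x y) →
  (∀ {x x′ y} → R x y → R x′ y → x ≡ x′) → ∣ q ∣ ≤ ∣ p ∣ →
  ∀ {y} → y ∈ q → ∃ λ x → x ∈ p × R x y
∣∣-injection-surjective p q R total inj q≤p {y} y∈q
  with search {P = λ x → x ∈ p × R x y} {λ x → x ∈ p → ∃ λ z → z ∈ (q - y) × R x z} hits
  where
  hits : ∀ x → (x ∈ p × R x y) ⊎ (x ∈ p → ∃ λ z → z ∈ (q - y) × R x z)
  hits x with x ∈? p
  ... | no x∉p = inj₂ λ x∈p → contradiction x∈p x∉p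
  ... | yes x∈p with total x∈p
  ... | z , z∈q , r with z ≟ y
  ... | yes refl = inj₁ (x∈p , r)
  ... | no z≢y = inj₂ λ _ → z , x∈p∧x≢y⇒x∈p-y z∈q z≢y , r
... | inj₁ found = found
... | inj₂ avoid = contradiction
  (ℕ.≤-trans (ℕ.≤-<-trans (∣∣-mono-injection p (q - y) R (λ {x} → avoid x) inj) (x∈p⇒∣p-x∣<∣p∣ y∈q)) q≤p)
  (ℕ.<-irrefl refl)

length≤∣∣ : ∀ {n} {p : Subset n} {xs} → Unique xs → All (_∈ p) xs → length xs ≤ ∣ p ∣
length≤∣∣ [] [] = z≤n
length≤∣∣ {p = p} {x ∷ xs} (x∉xs ∷ u) (x∈p ∷ xs∈p) = ℕ.≤-trans
  (s≤s (length≤∣∣ u (All.zipWith (λ (x≢y , y∈p) → x∈p∧x≢y⇒x∈p-y y∈p (x≢y ∘ sym)) (x∉xs , xs∈p))))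
  (x∈p⇒∣p-x∣<∣p∣ x∈p)

∣∣≤length : ∀ {n} {p : Subset n} xs → (∀ {y} → y ∈ p → y ∈ₗ xs) → ∣ p ∣ ≤ length xs
∣∣≤length {p = p} xs p⊆xs = subst (∣ p ∣ ≤_) (∣⊤∣≡n (length xs))
  (∣∣-mono-injection p ⊤ (λ x i → lookup xs i ≡ x)
    (λ x∈p → index (p⊆xs x∈p) , ∈⊤ , sym (lookup-index (p⊆xs x∈p)))
    (λ r r′ → trans (sym r) r′))

∈-tabulate⁺ : ∀ {n} {f : Fin n → Bool} {x} → f x ≡ true → x ∈ tabulate f
∈-tabulate⁺ {f = f} {x} eq = lookup⇒[]= x (tabulate f) (trans (lookup∘tabulate f x) eq)

∈-tabulate⁻ : ∀ {n} {f : Fin n → Bool} {x} → x ∈ tabulate f → f x ≡ true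
∈-tabulate⁻ {f = f} {x} x∈ = trans (sym (lookup∘tabulate f x)) ([]=⇒lookup x∈)

length≤deg : ∀ {n} {G : Graph n} {v xs} → Unique xs → All (Adj G v) xs → length xs ≤ deg G v
length≤deg u adj = length≤∣∣ u (All.map ∈-tabulate⁺ adj)

deg≤length : ∀ {n} {G : Graph n} {v} xs → (∀ {y} → Adj G v y → y ∈ₗ xs) → deg G v ≤ length xs
deg≤length xs f = ∣∣≤length xs (f ∘ ∈-tabulate⁻)

AtMostOne : ∀ {V : Set} → (V → V → Bool) → V → Set
AtMostOne G v = ∀ {a b} → Adj G v a → Adj G v b → a ≡ b

leaf⇒atMostOne : ∀ {n} {G : Graph n} {v} → IsLeaf G v → AtMostOne G v
leaf⇒atMostOne {G = G} {v} leaf {a} {b} va vb with a ≟ b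
... | yes eq = eq
... | no a≢b = contradiction
  (subst (2 ≤_) leaf (length≤deg {G = G} {xs = a ∷ b ∷ []} ((a≢b ∷ []) ∷ [] ∷ []) (va ∷ vb ∷ []))) λ { (s≤s ()) }

atMostOne⇒leaf : ∀ {n} {G : Graph n} {v a} → Adj G v a → AtMostOne G v → IsLeaf G v
atMostOne⇒leaf {G = G} {v} {a} va one = ℕ.≤-antisym
  (deg≤length {G = G} (a ∷ []) (λ vy → here (one vy va)))
  (length≤deg {G = G} {xs = a ∷ []} ([] ∷ []) (va ∷ []))

two≤deg : ∀ {n} {G : Graph n} {v a b} → a ≢ b → Adj G v a → Adj G v b → 2 ≤ deg G v
two≤deg {G = G} {a = a} {b} a≢b va vb =
  length≤deg {G = G} {xs = a ∷ b ∷ []} ((a≢b ∷ []) ∷ [] ∷ []) (va ∷ vb ∷ [])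

deg≤2⇒no-three : ∀ {n} {G : Graph n} {v a b c} → deg G v ≤ 2 → a ≢ b → a ≢ c → b ≢ c →
  Adj G v a → Adj G v b → Adj G v c → ⊥
deg≤2⇒no-three {G = G} {a = a} {b} {c} d a≢b a≢c b≢c va vb vc = contradiction
  (ℕ.≤-trans (length≤deg {G = G} {xs = a ∷ b ∷ c ∷ []} ((a≢b ∷ a≢c ∷ []) ∷ (b≢c ∷ []) ∷ [] ∷ []) (va ∷ vb ∷ vc ∷ [])) d)
  λ { (s≤s (s≤s ())) }

another : ∀ {n} (G : Graph n) v a → (∃ λ b → a ≢ b × Adj G v b) ⊎ (∀ b → Adj G v b → a ≡ b)
another G v a = search other
  where
  other : ∀ b → (a ≢ b × Adj G v b) ⊎ (Adj G v b → a ≡ b)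
  other b with a ≟ b | G v b ≟ᵇ true
  ... | yes eq | _ = inj₂ λ _ → eq
  ... | no ne | yes vb = inj₁ (ne , vb)
  ... | no _ | no ¬vb = inj₂ λ vb → contradiction vb ¬vb

two≤deg⁻ : ∀ {n} {G : Graph n} {v} → 2 ≤ deg G v → ∃ λ a → ∃ λ b → a ≢ b × Adj G v a × Adj G v b
two≤deg⁻ {G = G} {v} 2≤d with search {P = Adj G v} {λ b → ¬ Adj G v b} nbr
  where
  nbr : ∀ b → Adj G v b ⊎ ¬ Adj G v b
  nbr b with G v b ≟ᵇ true
  ... | yes p = inj₁ p
  ... | no ¬p = inj₂ ¬p
... | inj₂ none = contradiction (ℕ.≤-trans 2≤d (deg≤length {G = G} [] (λ vy → contradiction vy (none _)))) λ ()
... | inj₁ (a , va) with another G v a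
... | inj₁ (b , a≢b , vb) = a , b , a≢b , va , vb
... | inj₂ only = contradiction
  (ℕ.≤-trans 2≤d (deg≤length {G = G} (a ∷ []) (λ vy → here (sym (only _ vy))))) λ { (s≤s ()) }

-- Forcing sets and chain covers

-- In a symmetric graph the fields imply that leaves force nothing: a leaf forcing its neighbor
-- would be a start by `asym`, and `accompanied` would make that neighbor a start as well.
record ChainCover {V : Set} (G : V → V → Bool) : Set₁ where
  infix 4 _⇝_
  field
    _⇝_ : V → V → Set
  Start : V → Set
  Start v = ∀ {u} → ¬ u ⇝ v
  field
    edge        : ∀ {u w} → u ⇝ w → Adj G u w
    functional  : ∀ {u w w′} → u ⇝ w → u ⇝ w′ → w ≡ w′
    injective   : ∀ {u u′ w} → u ⇝ w → u′ ⇝ w → u ≡ u′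
    asym        : ∀ {u w} → u ⇝ w → ¬ w ⇝ u
    forced?     : ∀ v → (∃ λ u → u ⇝ v) ⊎ Start v
    continue    : ∀ {u a b} → Adj G u a → Adj G u b → a ≢ b → ∃ λ w → u ⇝ w
    accompanied : ∀ {v} → Start v → ∃ λ u → Adj G v u × Start u

-- `early` is the forcing rule expressed by times: when `u` forces `w`, every other neighbor of `u`
-- is colored already. Two forces from one vertex would each have to precede the other. The vertex
-- type is arbitrary because extensions are first treated on a sum.
record TimedCover {V : Set} (G : V → V → Bool) : Set₁ where
  infix 4 _⇝_
  field
    _⇝_ : V → V → Set
  Start : V → Set
  Start v = ∀ {u} → ¬ u ⇝ v
  field
    edge        : ∀ {u w} → u ⇝ w → Adj G u w
    injective   : ∀ {u u′ w} → u ⇝ w → u′ ⇝ w → u ≡ u′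
    forced?     : ∀ v → (∃ λ u → u ⇝ v) ⊎ Start v
    continue    : ∀ {u a b} → Adj G u a → Adj G u b → a ≢ b → ∃ λ w → u ⇝ w
    accompanied : ∀ {v} → Start v → ∃ λ u → Adj G v u × Start u
    time        : V → ℕ
    later       : ∀ {u w} → u ⇝ w → time u < time w
    early       : ∀ {u w x} → u ⇝ w → Adj G u x → x ≢ w → time x < time w

  asym : ∀ {u w} → u ⇝ w → ¬ w ⇝ u
  asym uw wu = ℕ.<-asym (later uw) (later wu)

-- The record of a process that starts from `C`: by `uncolored` and `forced`, exactly the vertices
-- outside `C` are forced.
record Forcing {n} (G : Graph n) (C : Subset n) : Set₁ where
  infix 4 _⇝_
  field
    _⇝_        : Fin n → Fin n → Set
    edge       : ∀ {u w} → u ⇝ w → Adj G u w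
    injective  : ∀ {u u′ w} → u ⇝ w → u′ ⇝ w → u ≡ u′
    uncolored  : ∀ {u w} → u ⇝ w → w ∉ C
    forced     : ∀ {w} → w ∉ C → ∃ λ u → u ⇝ w
    time       : Fin n → ℕ
    later      : ∀ {u w} → u ⇝ w → time u < time w
    early      : ∀ {u w x} → u ⇝ w → Adj G u x → x ≢ w → time x < time w

  functional : ∀ {u w w′} → u ⇝ w → u ⇝ w′ → w ≡ w′
  functional {u} {w} {w′} uw uw′ with w ≟ w′
  ... | yes eq = eq
  ... | no ne = contradiction (early uw (edge uw′) (ne ∘ sym)) (ℕ.<-asym (early uw′ (edge uw) ne))

  asym : ∀ {u w} → u ⇝ w → ¬ w ⇝ u
  asym uw wu = ℕ.<-asym (later uw) (later wu)

-- The first force is added to the record of the remaining process. To make it come first, `C` gets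
-- time 0 and every time outside `C` goes up by one.
forcing : ∀ {n} {G : Graph n} {C} → Star (ForceStep G) C ⊤ → Forcing G C
forcing ε = record
  { _⇝_ = λ _ _ → ⊥ ; edge = λ () ; injective = λ () ; uncolored = λ ()
  ; forced = λ w∉⊤ → contradiction ∈⊤ w∉⊤ ; time = λ _ → 0 ; later = λ () ; early = λ () }
forcing {n} {G} {C} (force {u = u₀} {w = w₀} u₀∈C w₀∉C u₀w₀ only ◅ steps) = record
  { _⇝_ = _⇝′_ ; edge = edge′ ; injective = injective′ ; uncolored = uncolored′ ; forced = forced′
  ; time = time′ ; later = later′ ; early = early′ }
  where
  open Forcing (forcing steps)
  _⇝′_ : Fin n → Fin n → Set
  u ⇝′ w = u ⇝ w ⊎ (u ≡ u₀ × w ≡ w₀)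
  C⊆ : ∀ {x} → x ∈ C → x ∈ (C ∪ ⁅ w₀ ⁆)
  C⊆ x∈C = x∈p∪q⁺ (inj₁ x∈C)
  w₀∈ : w₀ ∈ (C ∪ ⁅ w₀ ⁆)
  w₀∈ = x∈p∪q⁺ {p = C} (inj₂ (x∈⁅x⁆ w₀))
  edge′ : ∀ {u w} → u ⇝′ w → Adj G u w
  edge′ (inj₁ uw) = edge uw
  edge′ (inj₂ (refl , refl)) = u₀w₀
  injective′ : ∀ {u u′ w} → u ⇝′ w → u′ ⇝′ w → u ≡ u′
  injective′ (inj₁ r) (inj₁ r′) = injective r r′
  injective′ (inj₁ r) (inj₂ (refl , refl)) = contradiction w₀∈ (uncolored r)
  injective′ (inj₂ (refl , refl)) (inj₁ r) = contradiction w₀∈ (uncolored r)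
  injective′ (inj₂ (refl , refl)) (inj₂ (refl , refl)) = refl
  uncolored′ : ∀ {u w} → u ⇝′ w → w ∉ C
  uncolored′ (inj₁ r) = uncolored r ∘ C⊆
  uncolored′ (inj₂ (refl , refl)) = w₀∉C
  forced′ : ∀ {w} → w ∉ C → ∃ λ u → u ⇝′ w
  forced′ {w} w∉C with w ≟ w₀
  ... | yes eq = u₀ , inj₂ (refl , eq)
  ... | no ne with forced w∉
    where
    w∉ : w ∉ (C ∪ ⁅ w₀ ⁆)
    w∉ w∈ with x∈p∪q⁻ C ⁅ w₀ ⁆ w∈
    ... | inj₁ w∈C = w∉C w∈C
    ... | inj₂ w∈ = ne (x∈⁅y⁆⇒x≡y w₀ w∈)
  ... | u , r = u , inj₁ r
  time′ : Fin n → ℕ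
  time′ x with x ∈? C
  ... | yes _ = 0
  ... | no _ = suc (time x)
  time′-C : ∀ {x} → x ∈ C → time′ x ≡ 0
  time′-C {x} x∈C with x ∈? C
  ... | yes _ = refl
  ... | no x∉C = contradiction x∈C x∉C
  time′-∉ : ∀ {x} → x ∉ C → time′ x ≡ suc (time x)
  time′-∉ {x} x∉C with x ∈? C
  ... | yes x∈C = contradiction x∈C x∉C
  ... | no _ = refl
  time′≤ : ∀ x → time′ x ≤ suc (time x)
  time′≤ x with x ∈? C
  ... | yes _ = z≤n
  ... | no _ = ℕ.≤-refl
  raise : ∀ {x w} → w ∉ C → time x < time w → time′ x < time′ w
  raise {x} {w} w∉C lt = subst (time′ x <_) (sym (time′-∉ w∉C)) (s≤s (ℕ.≤-trans (time′≤ x) lt))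
  C<w₀ : ∀ {x} → x ∈ C → time′ x < time′ w₀
  C<w₀ x∈C = subst₂ _<_ (sym (time′-C x∈C)) (sym (time′-∉ w₀∉C)) (s≤s z≤n)
  later′ : ∀ {u w} → u ⇝′ w → time′ u < time′ w
  later′ (inj₁ r) = raise (uncolored r ∘ C⊆) (later r)
  later′ (inj₂ (refl , refl)) = C<w₀ u₀∈C
  early′ : ∀ {u w x} → u ⇝′ w → Adj G u x → x ≢ w → time′ x < time′ w
  early′ (inj₁ r) ux x≢w = raise (uncolored r ∘ C⊆) (early r ux x≢w)
  early′ {x = x} (inj₂ (refl , refl)) ux x≢w with x ∈? C
  ... | yes x∈C = subst (_< time′ w₀) (time′-C x∈C) (C<w₀ x∈C)
  ... | no x∉C = contradiction (only x ux x∉C) x≢w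

leafSet : ∀ {n} → Graph n → Subset n
leafSet G = tabulate (λ v → deg G v ≡ᵇ 1)

∈-leafSet⁺ : ∀ {n} {G : Graph n} {v} → IsLeaf G v → v ∈ leafSet G
∈-leafSet⁺ {G = G} {v} leaf = ∈-tabulate⁺ (Equivalence.to T-≡ (ℕ.≡⇒≡ᵇ (deg G v) 1 leaf))

∈-leafSet⁻ : ∀ {n} {G : Graph n} {v} → v ∈ leafSet G → IsLeaf G v
∈-leafSet⁻ {G = G} {v} v∈ = ℕ.≡ᵇ⇒≡ (deg G v) 1 (Equivalence.from T-≡ (∈-tabulate⁻ v∈))

∁-cancel-≤ : ∀ {n} (p q : Subset n) → ∣ ∁ p ∣ ≤ ∣ ∁ q ∣ → ∣ q ∣ ≤ ∣ p ∣
∁-cancel-≤ p q le = ℕ.∸-cancelʳ-≤ (∣p∣≤n q) (subst₂ _≤_ (∣∁p∣≡n∸∣p∣ p) (∣∁p∣≡n∸∣p∣ q) le)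

module FromTFSet {n} {G : Graph n} (simple : IsSimple G) {S} (tf : IsTFSet G S) where
  open Forcing (forcing (proj₁ tf)) public

  -- A leaf in S has its only neighbor in S; a leaf outside S has been forced by its only neighbor.
  leaf-inert : ∀ {u w} → AtMostOne G u → ¬ u ⇝ w
  leaf-inert {u} {w} one r with u ∈? S
  ... | yes u∈S with proj₂ tf u u∈S
  ... | x , x∈S , ux = uncolored r (subst (_∈ S) (one ux (edge r)) x∈S)
  leaf-inert {u} {w} one r | no u∉S with forced u∉S
  ... | x , xu = asym r (subst (_⇝ u) (one (trans (proj₁ simple u x) (edge xu)) (edge r)) xu)

  total : ∀ {w} → w ∈ ∁ S → ∃ λ u → u ∈ ∁ (leafSet G) × u ⇝ w
  total w∈ with forced (x∈∁p⇒x∉p w∈)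
  ... | u , r = u , x∉p⇒x∈∁p (λ u∈L → leaf-inert (leaf⇒atMostOne {G = G} (∈-leafSet⁻ u∈L)) r) , r

  -- Each vertex outside `S` is forced by a non-leaf, and no vertex forces twice. So the complement
  -- of `S` injects into the set of non-leaves.
  leaves≤ : leaves G ≤ ∣ S ∣
  leaves≤ = ∁-cancel-≤ S (leafSet G)
    (∣∣-mono-injection (∁ S) (∁ (leafSet G)) (λ w u → u ⇝ w) total functional)

  -- When the counts agree, the injection behind `leaves≤` is onto the non-leaves, so every vertex
  -- with two neighbors forces.
  cover : ∣ S ∣ ≤ leaves G → ChainCover G
  cover S≤ = record
    { _⇝_ = _⇝_ ; edge = edge ; functional = functional ; injective = injective ; asym = asym
    ; forced? = forced?′ ; continue = continue ; accompanied = accompanied }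
    where
    Start : Fin n → Set
    Start v = ∀ {u} → ¬ u ⇝ v
    forced?′ : ∀ v → (∃ λ u → u ⇝ v) ⊎ Start v
    forced?′ v with v ∈? S
    ... | yes v∈S = inj₂ λ r → uncolored r v∈S
    ... | no v∉S = inj₁ (forced v∉S)
    continue : ∀ {u a b} → Adj G u a → Adj G u b → a ≢ b → ∃ λ w → u ⇝ w
    continue {u} ua ub a≢b with ∣∣-injection-surjective (∁ S) (∁ (leafSet G)) (λ w u → u ⇝ w) total functional
      (subst₂ _≤_ (sym (∣∁p∣≡n∸∣p∣ (leafSet G))) (sym (∣∁p∣≡n∸∣p∣ S)) (ℕ.∸-monoʳ-≤ n S≤))
      (x∉p⇒x∈∁p (λ u∈L → a≢b (leaf⇒atMostOne {G = G} (∈-leafSet⁻ u∈L) ua ub)))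
    ... | w , _ , r = w , r
    accompanied : ∀ {v} → Start v → ∃ λ u → Adj G v u × Start u
    accompanied {v} start with v ∈? S
    ... | no v∉S = contradiction (proj₂ (forced v∉S)) start
    ... | yes v∈S with proj₂ tf v v∈S
    ... | u , u∈S , vu = u , vu , λ r → uncolored r u∈S

module ToTFSet {n} {G : Graph n} (simple : IsSimple G) (cover : TimedCover G) where
  open TimedCover cover

  isStart : Fin n → Bool
  isStart v with forced? v
  ... | inj₁ _ = false
  ... | inj₂ _ = true

  S : Subset n
  S = tabulate isStart

  ∈S⇒start : ∀ {v} → v ∈ S → Start v
  ∈S⇒start {v} v∈S with forced? v | ∈-tabulate⁻ {f = isStart} v∈S
  ... | inj₂ start | _ = start

  start⇒∈S : ∀ {v} → Start v → v ∈ S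
  start⇒∈S {v} start = ∈-tabulate⁺ {f = isStart} eq
    where
    eq : isStart v ≡ true
    eq with forced? v
    ... | inj₁ (_ , r) = contradiction r start
    ... | inj₂ _ = refl

  ∉S⇒forced : ∀ {v} → v ∉ S → ∃ λ u → u ⇝ v
  ∉S⇒forced {v} v∉S with forced? v
  ... | inj₁ r = r
  ... | inj₂ start = contradiction (start⇒∈S start) v∉S

  -- Take an uncolored vertex of least time: its forcer and all other neighbors of that forcer are
  -- earlier, hence colored, so the force is legal now. `b` bounds the number of uncolored vertices.
  forces-all : ∀ b C → n ∸ ∣ C ∣ < b → S ⊆ C → Star (ForceStep G) C ⊤
  forces-all (suc b) C (s≤s bound) S⊆C with search {P = _∉ C} {_∈ C} decide
    where
    decide : ∀ x → x ∉ C ⊎ x ∈ C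
    decide x with x ∈? C
    ... | yes p = inj₂ p
    ... | no p = inj₁ p
  ... | inj₂ all = subst (λ D → Star (ForceStep G) D ⊤) (⊆-antisym (λ {x} _ → all x) (λ _ → ∈⊤)) ε
  ... | inj₁ some with search-min time (λ x → ¬? (x ∈? C)) some
  ... | w , w∉C , least with ∉S⇒forced (w∉C ∘ S⊆C)
  ... | u , r = force u∈C w∉C (edge r) only ◅ forces-all b (C ∪ ⁅ w ⁆) bound′ (x∈p∪q⁺ ∘ inj₁ ∘ S⊆C)
    where
    colored : ∀ {x} → time x < time w → x ∈ C
    colored {x} lt with x ∈? C
    ... | yes p = p
    ... | no p = contradiction lt (ℕ.≤⇒≯ (least x p))
    u∈C = colored (later r)
    only : ∀ x → G u x ≡ true → x ∉ C → x ≡ w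
    only x ux x∉C with x ≟ w
    ... | yes eq = eq
    ... | no ne = contradiction (colored (early r ux ne)) x∉C
    bound′ : n ∸ ∣ C ∪ ⁅ w ⁆ ∣ < b
    bound′ = ℕ.≤-trans (ℕ.∸-monoʳ-< (p⊂q⇒∣p∣<∣q∣ (p⊆p∪q ⁅ w ⁆ , w , x∈p∪q⁺ {p = C} (inj₂ (x∈⁅x⁆ w)) , w∉C))
      (∣p∣≤n (C ∪ ⁅ w ⁆))) bound

  tf : IsTFSet G S
  tf = forces-all _ S ℕ.≤-refl (λ x → x) , alone
    where
    alone : NoIsolatedIn G S
    alone v v∈S with accompanied (∈S⇒start v∈S)
    ... | u , vu , start = u , start⇒∈S start , vu

  -- Excludes isolated vertices, so that a non-leaf has two neighbors and `continue` applies to it.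
  neighbor : ∀ v → ∃ λ a → Adj G v a
  neighbor v with forced? v
  ... | inj₁ (u , r) = u , trans (proj₁ simple v u) (edge r)
  ... | inj₂ start with accompanied start
  ... | u , vu , _ = u , vu

  -- The injection of `leaves≤` read backwards: each non-leaf is sent to the vertex it forces, which
  -- is not a start.
  ∣S∣≤leaves : ∣ S ∣ ≤ leaves G
  ∣S∣≤leaves = ∁-cancel-≤ (leafSet G) S
    (∣∣-mono-injection (∁ (leafSet G)) (∁ S) _⇝_ total injective)
    where
    total : ∀ {u} → u ∈ ∁ (leafSet G) → ∃ λ w → w ∈ ∁ S × u ⇝ w
    total {u} u∈ with neighbor u
    ... | a , ua with another G u a
    ... | inj₂ only = contradiction
      (∈-leafSet⁺ (atMostOne⇒leaf {G = G} ua (λ ux uy → trans (sym (only _ ux)) (only _ uy)))) (x∈∁p⇒x∉p u∈)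
    ... | inj₁ (b , a≢b , ub) with continue ua ub a≢b
    ... | w , r = w , x∉p⇒x∈∁p (λ w∈S → ∈S⇒start w∈S r) , r

-- Chain covers along the operations O1–O5

-- `extend` with old and new vertices kept apart as a sum, so that adjacency reduces by matching on
-- the constructors.
sumGraph : ∀ {A B : Set} → (A → A → Bool) → (B → A → Bool) → (B → B → Bool) → A ⊎ B → A ⊎ B → Bool
sumGraph O E N (inj₁ a) (inj₁ b) = O a b
sumGraph O E N (inj₁ a) (inj₂ j) = E j a
sumGraph O E N (inj₂ i) (inj₁ b) = E i b
sumGraph O E N (inj₂ i) (inj₂ j) = N i j ∨ N j i

extend≡sumGraph : ∀ {n} k {O : Graph n} {E N} x y →
  extend k O E N x y ≡ sumGraph O E N (splitAt n x) (splitAt n y)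
extend≡sumGraph {n} k x y with splitAt n x | splitAt n y
... | inj₁ a | inj₁ b = refl
... | inj₁ a | inj₂ j = refl
... | inj₂ i | inj₁ b = refl
... | inj₂ i | inj₂ j = refl

extend-simple : ∀ {n k} {O : Graph n} {E N} → IsSimple O → (∀ i → N i i ≡ false) →
  IsSimple (extend k O E N)
extend-simple {n} {k} {O} {E} {N} (O-sym , O-irrefl) N-irrefl = sym′ , irrefl′
  where
  sum-sym : ∀ s t → sumGraph O E N s t ≡ sumGraph O E N t s
  sum-sym (inj₁ a) (inj₁ b) = O-sym a b
  sum-sym (inj₁ a) (inj₂ j) = refl
  sum-sym (inj₂ i) (inj₁ b) = refl
  sum-sym (inj₂ i) (inj₂ j) = ∨-comm (N i j) (N j i)
  sum-irrefl : ∀ s → sumGraph O E N s s ≡ false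
  sum-irrefl (inj₁ a) = O-irrefl a
  sum-irrefl (inj₂ i) rewrite N-irrefl i = refl
  sym′ : ∀ x y → extend k O E N x y ≡ extend k O E N y x
  sym′ x y = trans (extend≡sumGraph {n} k x y)
    (trans (sum-sym (splitAt n x) (splitAt n y)) (sym (extend≡sumGraph {n} k y x)))
  irrefl′ : ∀ x → extend k O E N x x ≡ false
  irrefl′ x = trans (extend≡sumGraph {n} k x x) (sum-irrefl (splitAt n x))

transport-cover : ∀ {V W : Set} {G : V → V → Bool} {H : W → W → Bool}
  (from : W → V) (to : V → W) → (∀ v → from (to v) ≡ v) → (∀ w → to (from w) ≡ w) →
  (∀ x y → H x y ≡ G (from x) (from y)) → TimedCover G → TimedCover H
transport-cover {V} {W} {G} {H} from to from-to to-from H≡G cover = record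
  { _⇝_ = λ x y → from x ⇝ from y
  ; edge = λ {x} {y} r → trans (H≡G x y) (edge r)
  ; injective = λ r r′ → from-injective (injective r r′)
  ; forced? = forced?′
  ; continue = continue′
  ; accompanied = accompanied′
  ; time = λ x → time (from x)
  ; later = later
  ; early = λ {u} {w} {x} r ux x≢w → early r (adj ux) (x≢w ∘ from-injective)
  }
  where
  open TimedCover cover
  from-injective : ∀ {x y} → from x ≡ from y → x ≡ y
  from-injective {x} {y} eq = trans (sym (to-from x)) (trans (cong to eq) (to-from y))
  adj : ∀ {x y} → Adj H x y → Adj G (from x) (from y)
  adj {x} {y} xy = trans (sym (H≡G x y)) xy
  adj⁻ : ∀ {x v} → Adj G (from x) v → Adj H x (to v)
  adj⁻ {x} {v} xv = trans (H≡G x (to v)) (trans (cong (G (from x)) (from-to v)) xv)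
  forced?′ : ∀ y → (∃ λ x → from x ⇝ from y) ⊎ (∀ {x} → ¬ from x ⇝ from y)
  forced?′ y with forced? (from y)
  ... | inj₁ (u , r) = inj₁ (to u , subst (_⇝ from y) (sym (from-to u)) r)
  ... | inj₂ start = inj₂ start
  continue′ : ∀ {u a b} → Adj H u a → Adj H u b → a ≢ b → ∃ λ w → from u ⇝ from w
  continue′ {u} ua ub a≢b with continue (adj ua) (adj ub) (a≢b ∘ from-injective)
  ... | w , r = to w , subst (from u ⇝_) (sym (from-to w)) r
  accompanied′ : ∀ {v} → (∀ {x} → ¬ from x ⇝ from v) → ∃ λ u → Adj H v u × (∀ {x} → ¬ from x ⇝ from u)
  accompanied′ {v} start with accompanied {from v} (λ {u} r → start (subst (_⇝ from v) (sym (from-to u)) r))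
  ... | u , vu , startᵤ = to u , adj⁻ vu , λ {x} r → startᵤ (subst (from x ⇝_) (from-to u) r)

extend-cover : ∀ {n k} {O : Graph n} {E N} → TimedCover (sumGraph O E N) → TimedCover (extend k O E N)
extend-cover {n} {k} = transport-cover (splitAt n) (join n k) (splitAt-join n k) (join-splitAt n k) (extend≡sumGraph k)

-- Both ends of the new edge force within their own side, so nothing has to run along that edge. It
-- only demands that each end be colored before the other one forces.
glue : ∀ {A B : Set} {G₁ : A → A → Bool} {G₂ : B → B → Bool} {E N v j₀} →
  (cover₁ : TimedCover G₁) (cover₂ : TimedCover G₂) →
  ∃ (TimedCover._⇝_ cover₁ v) → ∃ (TimedCover._⇝_ cover₂ j₀) →
  (∀ i j → N i j ∨ N j i ≡ G₂ i j) → (∀ {j a} → E j a ≡ true → j ≡ j₀ × a ≡ v) →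
  TimedCover (sumGraph G₁ E N)
glue {A} {B} {G₁} {G₂} {E} {N} {v} {j₀} cover₁ cover₂ (v⁺ , v⇝v⁺) (j₀⁺ , j₀⇝j₀⁺) N≡G₂ only = record
  { _⇝_ = _⇝_
  ; edge = λ {u} {w} → edge {u} {w}
  ; injective = λ {u} {u′} {w} → injective {u} {u′} {w}
  ; forced? = forced?
  ; continue = λ {u} {a} {b} → continue {u} {a} {b}
  ; accompanied = λ {v} → accompanied {v}
  ; time = time
  ; later = λ {u} {w} → later {u} {w}
  ; early = λ {u} {w} {x} → early {u} {w} {x}
  }
  where
  module C₁ = TimedCover cover₁
  module C₂ = TimedCover cover₂
  H = sumGraph G₁ E N
  _⇝_ : A ⊎ B → A ⊎ B → Set
  inj₁ a ⇝ inj₁ b = a C₁.⇝ b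
  inj₂ i ⇝ inj₂ j = i C₂.⇝ j
  _ ⇝ _ = ⊥
  -- The two time functions are shifted so that they agree on the ends of the new edge.
  time : A ⊎ B → ℕ
  time (inj₁ a) = C₁.time a + C₂.time j₀
  time (inj₂ j) = C₂.time j + C₁.time v
  same : time (inj₁ v) ≡ time (inj₂ j₀)
  same = ℕ.+-comm (C₁.time v) _
  edge : ∀ {u w} → u ⇝ w → Adj H u w
  edge {inj₁ a} {inj₁ b} = C₁.edge
  edge {inj₂ i} {inj₂ j} r = trans (N≡G₂ _ _) (C₂.edge r)
  injective : ∀ {u u′ w} → u ⇝ w → u′ ⇝ w → u ≡ u′
  injective {inj₁ _} {inj₁ _} {inj₁ _} r r′ = cong inj₁ (C₁.injective r r′)
  injective {inj₂ _} {inj₂ _} {inj₂ _} r r′ = cong inj₂ (C₂.injective r r′)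
  start₁ : ∀ {a} → C₁.Start a → ∀ {u} → ¬ u ⇝ inj₁ a
  start₁ s {inj₁ _} r = s r
  start₂ : ∀ {j} → C₂.Start j → ∀ {u} → ¬ u ⇝ inj₂ j
  start₂ s {inj₂ _} r = s r
  forced? : ∀ w → (∃ λ u → u ⇝ w) ⊎ (∀ {u} → ¬ u ⇝ w)
  forced? (inj₁ a) with C₁.forced? a
  ... | inj₁ (u , r) = inj₁ (inj₁ u , r)
  ... | inj₂ s = inj₂ λ {u} → start₁ s {u}
  forced? (inj₂ j) with C₂.forced? j
  ... | inj₁ (u , r) = inj₁ (inj₂ u , r)
  ... | inj₂ s = inj₂ λ {u} → start₂ s {u}
  continue : ∀ {u a b} → Adj H u a → Adj H u b → a ≢ b → ∃ λ w → u ⇝ w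
  continue {inj₁ u} {inj₁ a} {inj₁ b} ua ub a≢b with C₁.continue ua ub (a≢b ∘ cong inj₁)
  ... | w , r = inj₁ w , r
  continue {inj₁ u} {inj₂ j} ua ub a≢b with only ua
  ... | refl , refl = inj₁ v⁺ , v⇝v⁺
  continue {inj₁ u} {inj₁ _} {inj₂ j} ua ub a≢b with only ub
  ... | refl , refl = inj₁ v⁺ , v⇝v⁺
  continue {inj₂ u} {inj₂ a} {inj₂ b} ua ub a≢b
    with C₂.continue (trans (sym (N≡G₂ _ _)) ua) (trans (sym (N≡G₂ _ _)) ub) (a≢b ∘ cong inj₂)
  ... | w , r = inj₂ w , r
  continue {inj₂ u} {inj₁ j} ua ub a≢b with only ua
  ... | refl , refl = inj₂ j₀⁺ , j₀⇝j₀⁺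
  continue {inj₂ u} {inj₂ _} {inj₁ j} ua ub a≢b with only ub
  ... | refl , refl = inj₂ j₀⁺ , j₀⇝j₀⁺
  accompanied : ∀ {w} → (∀ {u} → ¬ u ⇝ w) → ∃ λ u → Adj H w u × (∀ {x} → ¬ x ⇝ u)
  accompanied {inj₁ a} s with C₁.accompanied {a} (λ {u} → s {inj₁ u})
  ... | u , au , s′ = inj₁ u , au , λ {x} → start₁ s′ {x}
  accompanied {inj₂ a} s with C₂.accompanied {a} (λ {u} → s {inj₂ u})
  ... | u , au , s′ = inj₂ u , trans (N≡G₂ _ _) au , λ {x} → start₂ s′ {x}
  later : ∀ {u w} → u ⇝ w → time u < time w
  later {inj₁ _} {inj₁ _} r = ℕ.+-monoˡ-< _ (C₁.later r)
  later {inj₂ _} {inj₂ _} r = ℕ.+-monoˡ-< _ (C₂.later r)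
  early : ∀ {u w x} → u ⇝ w → Adj H u x → x ≢ w → time x < time w
  early {inj₁ _} {inj₁ _} {inj₁ _} r ux x≢w = ℕ.+-monoˡ-< _ (C₁.early r ux (x≢w ∘ cong inj₁))
  early {inj₁ u} {inj₁ w} {inj₂ _} r ux x≢w with only ux
  ... | refl , refl = subst (_< time (inj₁ w)) same (ℕ.+-monoˡ-< _ (C₁.later r))
  early {inj₂ _} {inj₂ _} {inj₂ _} r ux x≢w =
    ℕ.+-monoˡ-< _ (C₂.early r (trans (sym (N≡G₂ _ _)) ux) (x≢w ∘ cong inj₂))
  early {inj₂ u} {inj₂ w} {inj₁ _} r ux x≢w with only ux
  ... | refl , refl = subst (_< time (inj₂ w)) (sym same) (ℕ.+-monoˡ-< _ (C₂.later r))

-- The new leaves become starts accompanied by the start `v`. As `v` already forces an old vertex,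
-- its new neighbors demand no further force.
add-start-leaves : ∀ {A B : Set} {G : A → A → Bool} {E : B → A → Bool} {N : B → B → Bool} {v} →
  (cover : TimedCover G) → TimedCover.Start cover v → ∃ (TimedCover._⇝_ cover v) →
  (∀ {i j} → N i j ∨ N j i ≡ false) → (∀ {j a} → E j a ≡ true → a ≡ v) → (∀ j → E j v ≡ true) →
  TimedCover (sumGraph G E N)
add-start-leaves {A} {B} {G} {E} {N} {v} cover start-v (v⁺ , v⇝v⁺) no-new only new = record
  { _⇝_ = _⇝′_
  ; edge = λ {u} {w} → edge′ {u} {w}
  ; injective = λ {u} {u′} {w} → injective′ {u} {u′} {w}
  ; forced? = forced?′
  ; continue = λ {u} {a} {b} → continue′ {u} {a} {b}
  ; accompanied = λ {v} → accompanied′ {v}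
  ; time = time′
  ; later = λ {u} {w} → later′ {u} {w}
  ; early = λ {u} {w} {x} → early′ {u} {w} {x}
  }
  where
  open TimedCover cover
  H = sumGraph G E N
  _⇝′_ : A ⊎ B → A ⊎ B → Set
  inj₁ a ⇝′ inj₁ b = a ⇝ b
  _ ⇝′ _ = ⊥
  time′ : A ⊎ B → ℕ
  time′ (inj₁ a) = time a
  -- Anything `v` forces is later than `v`, hence later than the new leaves.
  time′ (inj₂ _) = time v
  edge′ : ∀ {u w} → u ⇝′ w → Adj H u w
  edge′ {inj₁ a} {inj₁ b} = edge
  injective′ : ∀ {u u′ w} → u ⇝′ w → u′ ⇝′ w → u ≡ u′
  injective′ {inj₁ _} {inj₁ _} {inj₁ _} r r′ = cong inj₁ (injective r r′)
  start′ : ∀ {a} → Start a → ∀ {u} → ¬ u ⇝′ inj₁ a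
  start′ s {inj₁ _} r = s r
  start-new : ∀ {j u} → ¬ u ⇝′ inj₂ j
  start-new {u = inj₁ _} ()
  start-new {u = inj₂ _} ()
  forced?′ : ∀ w → (∃ λ u → u ⇝′ w) ⊎ (∀ {u} → ¬ u ⇝′ w)
  forced?′ (inj₁ a) with forced? a
  ... | inj₁ (u , r) = inj₁ (inj₁ u , r)
  ... | inj₂ s = inj₂ λ {u} → start′ s {u}
  forced?′ (inj₂ j) = inj₂ λ {u} → start-new {j} {u}
  continue′ : ∀ {u a b} → Adj H u a → Adj H u b → a ≢ b → ∃ λ w → u ⇝′ w
  continue′ {inj₁ u} {inj₁ a} {inj₁ b} ua ub a≢b with continue ua ub (a≢b ∘ cong inj₁)
  ... | w , r = inj₁ w , r
  continue′ {inj₁ u} {inj₂ j} ua ub a≢b with only ua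
  ... | refl = inj₁ v⁺ , v⇝v⁺
  continue′ {inj₁ u} {inj₁ _} {inj₂ j} ua ub a≢b with only ub
  ... | refl = inj₁ v⁺ , v⇝v⁺
  continue′ {inj₂ u} {inj₁ a} {inj₁ b} ua ub a≢b = contradiction (cong inj₁ (trans (only ua) (sym (only ub)))) a≢b
  continue′ {inj₂ u} {inj₂ a} ua ub a≢b = contradiction (trans (sym no-new) ua) λ ()
  continue′ {inj₂ u} {inj₁ _} {inj₂ b} ua ub a≢b = contradiction (trans (sym no-new) ub) λ ()
  accompanied′ : ∀ {w} → (∀ {u} → ¬ u ⇝′ w) → ∃ λ u → Adj H w u × (∀ {x} → ¬ x ⇝′ u)
  accompanied′ {inj₁ a} s with accompanied {a} (λ {u} → s {inj₁ u})
  ... | u , au , s′ = inj₁ u , au , λ {x} → start′ s′ {x}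
  accompanied′ {inj₂ j} s = inj₁ v , new j , λ {x} → start′ start-v {x}
  later′ : ∀ {u w} → u ⇝′ w → time′ u < time′ w
  later′ {inj₁ _} {inj₁ _} r = later r
  early′ : ∀ {u w x} → u ⇝′ w → Adj H u x → x ≢ w → time′ x < time′ w
  early′ {inj₁ _} {inj₁ _} {inj₁ _} r ux x≢w = early r ux (x≢w ∘ cong inj₁)
  early′ {inj₁ u} {inj₁ w} {inj₂ _} r ux x≢w with only ux
  ... | refl = later r

-- Covers around a strong support vertex (O2 and O3)

module StrongSupportCover {n} {G : Graph n} (simple : IsSimple G) (cover : TimedCover G) {w a b}
  (a≢b : a ≢ b) (wa : Adj G w a) (wb : Adj G w b) (one-a : AtMostOne G a) (one-b : AtMostOne G b) where
  open TimedCover cover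

  flip : ∀ {x y} → Adj G x y → Adj G y x
  flip {x} {y} xy = trans (proj₁ simple y x) xy

  forces-once : ∀ {u x y} → u ⇝ x → u ⇝ y → x ≢ y → ⊥
  forces-once ux uy x≢y = ℕ.<-asym (early ux (edge uy) (x≢y ∘ sym)) (early uy (edge ux) x≢y)

  forced-by-w : ∀ {l x} → AtMostOne G l → Adj G w l → x ⇝ l → x ≡ w
  forced-by-w one wl r = one (flip (edge r)) (flip wl)

  start-from : ∀ {l} → AtMostOne G l → Adj G w l → Start l → Start w
  start-from one wl s with accompanied s
  ... | x , lx , sx = λ r → sx (subst (_ ⇝_) (one (flip wl) lx) r)

  unforced-twin : ∀ {l x} → AtMostOne G l → Adj G w l → w ⇝ x → x ≢ l → Start l
  unforced-twin one wl wx x≢l r with forced-by-w one wl r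
  ... | refl = forces-once wx r x≢l

  -- `w` forces at most one of its two leaves. The other is a start, and its companion can only be
  -- `w`.
  start : Start w
  start with forced? a
  ... | inj₂ s = start-from one-a wa s
  ... | inj₁ (x , r) with forced-by-w one-a wa r
  ... | refl = start-from one-b wb (unforced-twin one-b wb r a≢b)

-- If the leaf a is forced by w, then the leaf b can be forced instead.
module Swap {n} {G : Graph n} (simple : IsSimple G) (cover : TimedCover G) {w a b}
  (a≢b : a ≢ b) (wa : Adj G w a) (wb : Adj G w b) (one-a : AtMostOne G a) (one-b : AtMostOne G b)
  (w⇝a : TimedCover._⇝_ cover w a) where
  open TimedCover cover
  open StrongSupportCover simple cover a≢b wa wb one-a one-b

  w≢b : w ≢ b
  w≢b refl = contradiction (trans (sym (proj₂ simple w)) wb) λ ()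

  start-b : Start b
  start-b = unforced-twin one-b wb w⇝a a≢b

  _⇝′_ : Fin n → Fin n → Set
  x ⇝′ y = (x ⇝ y × y ≢ a) ⊎ (x ≡ w × y ≡ b)

  time′ : Fin n → ℕ
  time′ x with x ≟ b
  ... | yes _ = suc (time a)
  ... | no _ = time x

  time′-b : time′ b ≡ suc (time a)
  time′-b with b ≟ b
  ... | yes _ = refl
  ... | no b≢b = contradiction refl b≢b

  time′-≢ : ∀ {x} → x ≢ b → time′ x ≡ time x
  time′-≢ {x} x≢b with x ≟ b
  ... | yes x≡b = contradiction x≡b x≢b
  ... | no _ = refl

  before : ∀ {x y} → x ≢ b → y ≢ b → time x < time y → time′ x < time′ y
  before x≢b y≢b = subst₂ _<_ (sym (time′-≢ x≢b)) (sym (time′-≢ y≢b))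

  start-a : ∀ {x} → ¬ x ⇝′ a
  start-a (inj₁ (_ , a≢a)) = a≢a refl
  start-a (inj₂ (_ , a≡b)) = a≢b a≡b

  start′ : ∀ {x} → x ≢ b → Start x → ∀ {u} → ¬ u ⇝′ x
  start′ x≢b s (inj₁ (r , _)) = s r
  start′ x≢b s (inj₂ (_ , x≡b)) = x≢b x≡b

  swapped : TimedCover G
  swapped = record
    { _⇝_ = _⇝′_
    ; edge = λ where
        (inj₁ (r , _)) → edge r
        (inj₂ (refl , refl)) → wb
    ; injective = λ where
        (inj₁ (r , _)) (inj₁ (r′ , _)) → injective r r′
        (inj₁ (r , _)) (inj₂ (_ , refl)) → contradiction r start-b
        (inj₂ (_ , refl)) (inj₁ (r , _)) → contradiction r start-b
        (inj₂ (refl , _)) (inj₂ (refl , _)) → refl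
    ; forced? = forced?′
    ; continue = continue′
    ; accompanied = accompanied′
    ; time = time′
    ; later = later′
    ; early = early′
    }
    where
    forced?′ : ∀ x → (∃ λ u → u ⇝′ x) ⊎ (∀ {u} → ¬ u ⇝′ x)
    forced?′ x with x ≟ a | x ≟ b | forced? x
    ... | yes refl | _ | _ = inj₂ start-a
    ... | no _ | yes x≡b | _ = inj₁ (w , inj₂ (refl , x≡b))
    ... | no x≢a | no _ | inj₁ (u , r) = inj₁ (u , inj₁ (r , x≢a))
    ... | no _ | no x≢b | inj₂ s = inj₂ (start′ x≢b s)
    continue′ : ∀ {u x y} → Adj G u x → Adj G u y → x ≢ y → ∃ λ z → u ⇝′ z
    continue′ ux uy x≢y with continue ux uy x≢y
    ... | z , r with z ≟ a
    ... | no z≢a = z , inj₁ (r , z≢a)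
    ... | yes refl = b , inj₂ (injective r w⇝a , refl)
    accompanied′ : ∀ {x} → (∀ {u} → ¬ u ⇝′ x) → ∃ λ u → Adj G x u × (∀ {z} → ¬ z ⇝′ u)
    accompanied′ {x} s with x ≟ a | x ≟ w
    ... | yes refl | _ = w , flip wa , start′ w≢b start
    ... | no _ | yes refl = a , wa , start-a
    ... | no x≢a | no x≢w with accompanied {x} (λ r → s (inj₁ (r , x≢a)))
    ... | u , xu , su = u , xu , start′ (λ { refl → x≢w (one-b (flip xu) (flip wb)) }) su
    later′ : ∀ {u x} → u ⇝′ x → time′ u < time′ x
    later′ {u} {x} (inj₁ (r , x≢a)) = before u≢b (λ { refl → start-b r }) (later r)
      where
      u≢b : u ≢ b
      u≢b refl with one-b (edge r) (flip wb)
      ... | refl = start r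
    later′ (inj₂ (refl , refl)) = subst₂ _<_ (sym (time′-≢ w≢b)) (sym time′-b) (ℕ.m<n⇒m<1+n (later w⇝a))
    early′ : ∀ {u x y} → u ⇝′ x → Adj G u y → y ≢ x → time′ y < time′ x
    early′ {u} {x} {y} (inj₁ (r , x≢a)) uy y≢x = before y≢b (λ { refl → start-b r }) (early r uy y≢x)
      where
      y≢b : y ≢ b
      y≢b refl with one-b (flip uy) (flip wb)
      ... | refl = forces-once w⇝a r (x≢a ∘ sym)
    early′ {y = y} (inj₂ (refl , refl)) wy y≢b = subst₂ _<_ (sym (time′-≢ y≢b)) (sym time′-b) y<a
      where
      y<a : time y < suc (time a)
      y<a with y ≟ a
      ... | yes refl = ℕ.≤-refl
      ... | no y≢a = ℕ.m<n⇒m<1+n (early w⇝a wy y≢a)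

==⇒≡ : ∀ {n} {x y : Fin n} → (x == y) ≡ true → x ≡ y
==⇒≡ {x = x} {y} eq with x ≟ y
... | yes p = p

≡⇒== : ∀ {n} (x : Fin n) → (x == x) ≡ true
≡⇒== x with x ≟ x
... | yes _ = refl
... | no x≢x = contradiction refl x≢x

-- The leaf `v` forced nothing, since its only neighbor `w` is a start. It now forces the first new
-- leaf; the second is a start accompanied by `v`.
extend-at-leaf : ∀ {n} {G : Graph n} {v w} → AtMostOne G v → Adj G v w → Adj G w v →
  (cover : TimedCover G) → TimedCover.Start cover v → TimedCover.Start cover w →
  TimedCover (sumGraph {B = Fin 2} G (λ _ a → a == v) noNew)
extend-at-leaf {n} {G} {v} {w} one vw wv cover start-v start-w = record
  { _⇝_ = _⇝′_
  ; edge = λ {u} {w} → edge′ {u} {w}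
  ; injective = λ {u} {u′} {w} → injective′ {u} {u′} {w}
  ; forced? = forced?′
  ; continue = λ {u} {a} {b} → continue′ {u} {a} {b}
  ; accompanied = λ {v} → accompanied′ {v}
  ; time = time′
  ; later = λ {u} {w} → later′ {u} {w}
  ; early = λ {u} {w} {x} → early′ {u} {w} {x}
  }
  where
  open TimedCover cover
  H : Fin n ⊎ Fin 2 → Fin n ⊎ Fin 2 → Bool
  H = sumGraph {B = Fin 2} G (λ _ a → a == v) noNew
  _⇝′_ : Fin n ⊎ Fin 2 → Fin n ⊎ Fin 2 → Set
  inj₁ a ⇝′ inj₁ b = a ⇝ b
  inj₁ a ⇝′ inj₂ zero = a ≡ v
  _ ⇝′ _ = ⊥
  inert : ∀ {x} → ¬ v ⇝ x
  inert r with one (edge r) vw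
  ... | refl = start-w r
  time′ : Fin n ⊎ Fin 2 → ℕ
  time′ (inj₁ a) = time a
  -- Must exceed the times of both old vertices involved, `v` and its neighbor `w`; the sum does so
  -- without a comparison.
  time′ (inj₂ zero) = suc (time v + time w)
  time′ (inj₂ (suc _)) = 0
  edge′ : ∀ {u w} → u ⇝′ w → Adj H u w
  edge′ {inj₁ a} {inj₁ b} r = edge r
  edge′ {inj₁ a} {inj₂ zero} refl = ≡⇒== v
  injective′ : ∀ {u u′ w} → u ⇝′ w → u′ ⇝′ w → u ≡ u′
  injective′ {inj₁ _} {inj₁ _} {inj₁ _} r r′ = cong inj₁ (injective r r′)
  injective′ {inj₁ _} {inj₁ _} {inj₂ zero} refl refl = refl
  start′ : ∀ {a} → Start a → ∀ {u} → ¬ u ⇝′ inj₁ a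
  start′ s {inj₁ _} r = s r
  start-new : ∀ {u} → ¬ u ⇝′ inj₂ (suc zero)
  start-new {inj₁ _} ()
  start-new {inj₂ _} ()
  forced?′ : ∀ w → (∃ λ u → u ⇝′ w) ⊎ (∀ {u} → ¬ u ⇝′ w)
  forced?′ (inj₁ a) with forced? a
  ... | inj₁ (u , r) = inj₁ (inj₁ u , r)
  ... | inj₂ s = inj₂ λ {u} → start′ s {u}
  forced?′ (inj₂ zero) = inj₁ (inj₁ v , refl)
  forced?′ (inj₂ (suc zero)) = inj₂ λ {u} → start-new {u}
  continue′ : ∀ {u a b} → Adj H u a → Adj H u b → a ≢ b → ∃ λ w → u ⇝′ w
  continue′ {inj₁ u} {inj₁ a} {inj₁ b} ua ub a≢b with continue ua ub (a≢b ∘ cong inj₁)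
  ... | w , r = inj₁ w , r
  continue′ {inj₁ u} {inj₂ j} ua ub a≢b = inj₂ zero , ==⇒≡ ua
  continue′ {inj₁ u} {inj₁ _} {inj₂ j} ua ub a≢b = inj₂ zero , ==⇒≡ ub
  continue′ {inj₂ u} {inj₁ a} {inj₁ b} ua ub a≢b =
    contradiction (cong inj₁ (trans (==⇒≡ ua) (sym (==⇒≡ ub)))) a≢b
  accompanied′ : ∀ {w} → (∀ {u} → ¬ u ⇝′ w) → ∃ λ u → Adj H w u × (∀ {x} → ¬ x ⇝′ u)
  accompanied′ {inj₁ a} s with accompanied {a} (λ {u} → s {inj₁ u})
  ... | u , au , s′ = inj₁ u , au , λ {x} → start′ s′ {x}
  accompanied′ {inj₂ zero} s = contradiction refl (s {inj₁ v})
  accompanied′ {inj₂ (suc zero)} s = inj₁ v , ≡⇒== v , λ {x} → start′ start-v {x}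
  later′ : ∀ {u w} → u ⇝′ w → time′ u < time′ w
  later′ {inj₁ _} {inj₁ _} r = later r
  later′ {inj₁ _} {inj₂ zero} refl = s≤s (ℕ.m≤m+n (time v) (time w))
  early′ : ∀ {u w x} → u ⇝′ w → Adj H u x → x ≢ w → time′ x < time′ w
  early′ {inj₁ _} {inj₁ _} {inj₁ _} r ux x≢w = early r ux (x≢w ∘ cong inj₁)
  early′ {inj₁ u} {inj₁ x} {inj₂ _} r ux x≢w = contradiction (subst (_⇝ x) (==⇒≡ ux) r) inert
  early′ {inj₁ _} {inj₂ zero} {inj₁ x} refl ux x≢w with one ux vw
  ... | refl = s≤s (ℕ.m≤n+m (time w) (time v))
  early′ {inj₁ _} {inj₂ zero} {inj₂ zero} r ux x≢w = contradiction refl x≢w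
  early′ {inj₁ _} {inj₂ zero} {inj₂ (suc zero)} r ux x≢w = s≤s z≤n

-- The graphs attached by O4 and O5

path₃ : Graph 3
path₃ = λ i j → half i j ∨ half j i
  where
  half : Fin 3 → Fin 3 → Bool
  half zero (suc zero) = true
  half (suc zero) (suc (suc zero)) = true
  half _ _ = false

-- The middle vertex, where O4 attaches the path, has to force something for `glue`; it forces one
-- end and is a start together with the other.
path₃-cover : TimedCover path₃
path₃-cover = record
  { _⇝_ = λ u w → u ≡ suc zero × w ≡ zero
  ; edge = λ { (refl , refl) → refl }
  ; injective = λ { (refl , _) (refl , _) → refl }
  ; forced? = λ where
      zero → inj₁ (_ , refl , refl)
      (suc _) → inj₂ λ ()
  ; continue = λ
      { {zero} ua ub a≢b → contradiction (ends zero (λ ()) _ _ ua ub) a≢b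
      ; {suc zero} _ _ _ → _ , refl , refl
      ; {suc (suc zero)} ua ub a≢b → contradiction (ends (suc (suc zero)) (λ ()) _ _ ua ub) a≢b }
  ; accompanied = λ
      { {zero} s → contradiction (refl , refl) s
      ; {suc zero} s → suc (suc zero) , refl , λ ()
      ; {suc (suc zero)} s → suc zero , refl , λ () }
  ; time = time
  ; later = λ { (refl , refl) → s≤s z≤n }
  ; early = λ
      { {x = zero} (refl , refl) ux x≢w → contradiction refl x≢w
      ; {x = suc _} (refl , refl) ux x≢w → s≤s z≤n }
  }
  where
  time : Fin 3 → ℕ
  time zero = 1
  time (suc _) = 0
  ends : ∀ u → u ≢ suc zero → ∀ a b → Adj path₃ u a → Adj path₃ u b → a ≡ b
  ends = from-yes (all? λ u → ¬? (u ≟ suc zero) →-dec (all? λ a → all? λ b →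
    (path₃ u a ≟ᵇ true) →-dec (path₃ u b ≟ᵇ true) →-dec (a ≟ b)))

longStar : Graph 6
longStar = λ i j → half i j ∨ half j i
  where
  half : Fin 6 → Fin 6 → Bool
  half zero (suc zero) = true
  half (suc zero) (suc (suc zero)) = true
  half (suc (suc zero)) (suc (suc (suc zero))) = true
  half (suc (suc (suc zero))) (suc (suc (suc (suc zero)))) = true
  half (suc (suc (suc zero))) (suc (suc (suc (suc (suc zero))))) = true
  half _ _ = false

pattern u₁ = zero
pattern v₁ = suc zero
pattern v₂ = suc (suc zero)
pattern v₃ = suc (suc (suc zero))
pattern v₄ = suc (suc (suc (suc zero)))
pattern u₃ = suc (suc (suc (suc (suc zero))))

-- The chains are `v₂`, `v₁`, `u₁`, then `v₃`, `v₄`, and `u₃` alone. The attachment vertex `v₁`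
-- forces, as `glue` requires.
longStar-cover : TimedCover longStar
longStar-cover = record
  { _⇝_ = λ u w → next u ≡ just w
  ; edge = λ
      { {v₁} refl → refl
      ; {v₂} refl → refl
      ; {v₃} refl → refl }
  ; injective = λ
      { {v₁} {v₁} refl refl → refl
      ; {v₁} {v₃} refl ()
      ; {v₁} {suc (suc (suc (suc _)))} refl ()
      ; {v₂} {v₂} refl refl → refl
      ; {v₂} {v₃} refl ()
      ; {v₂} {suc (suc (suc (suc _)))} refl ()
      ; {v₃} {v₃} refl refl → refl }
  ; forced? = λ where
      u₁ → inj₁ (v₁ , refl)
      v₁ → inj₁ (v₂ , refl)
      v₂ → inj₂ start-v₂
      v₃ → inj₂ start-v₃
      v₄ → inj₁ (v₃ , refl)
      u₃ → inj₂ start-u₃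
  ; continue = λ
      { {u₁} ua ub a≢b → contradiction (ends u₁ refl _ _ ua ub) a≢b
      ; {v₁} _ _ _ → _ , refl
      ; {v₂} _ _ _ → _ , refl
      ; {v₃} _ _ _ → _ , refl
      ; {v₄} ua ub a≢b → contradiction (ends v₄ refl _ _ ua ub) a≢b
      ; {u₃} ua ub a≢b → contradiction (ends u₃ refl _ _ ua ub) a≢b }
  ; accompanied = λ
      { {u₁} s → contradiction refl (s {v₁})
      ; {v₁} s → contradiction refl (s {v₂})
      ; {v₂} s → v₃ , refl , start-v₃
      ; {v₃} s → v₂ , refl , start-v₂
      ; {v₄} s → contradiction refl (s {v₃})
      ; {u₃} s → v₃ , refl , start-v₃ }
  ; time = time
  ; later = λ
      { {v₁} refl → s≤s (s≤s z≤n)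
      ; {v₂} refl → s≤s z≤n
      ; {v₃} refl → s≤s z≤n }
  ; early = λ {u} {w} {x} → early u w x
  }
  where
  next : Fin 6 → Maybe (Fin 6)
  next v₁ = just u₁
  next v₂ = just v₁
  next v₃ = just v₄
  next _ = nothing
  time : Fin 6 → ℕ
  time u₁ = 2
  time v₁ = 1
  time v₄ = 1
  time _ = 0
  start-v₂ : ∀ {u} → next u ≢ just v₂
  start-v₂ {v₁} ()
  start-v₂ {v₂} ()
  start-v₂ {v₃} ()
  start-v₂ {suc (suc (suc (suc _)))} ()
  start-v₃ : ∀ {u} → next u ≢ just v₃
  start-v₃ {v₁} ()
  start-v₃ {v₂} ()
  start-v₃ {v₃} ()
  start-v₃ {suc (suc (suc (suc _)))} ()
  start-u₃ : ∀ {u} → next u ≢ just u₃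
  start-u₃ {v₁} ()
  start-u₃ {v₂} ()
  start-u₃ {v₃} ()
  start-u₃ {suc (suc (suc (suc _)))} ()
  ends : ∀ u → next u ≡ nothing → ∀ a b → Adj longStar u a → Adj longStar u b → a ≡ b
  ends u₁ _ = from-yes (all? λ a → all? λ b →
    (longStar u₁ a ≟ᵇ true) →-dec (longStar u₁ b ≟ᵇ true) →-dec (a ≟ b))
  ends v₄ _ = from-yes (all? λ a → all? λ b →
    (longStar v₄ a ≟ᵇ true) →-dec (longStar v₄ b ≟ᵇ true) →-dec (a ≟ b))
  ends u₃ _ = from-yes (all? λ a → all? λ b →
    (longStar u₃ a ≟ᵇ true) →-dec (longStar u₃ b ≟ᵇ true) →-dec (a ≟ b))
  early : ∀ u w x → next u ≡ just w → Adj longStar u x → x ≢ w → time x < time w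
  early v₁ _ x refl = from-yes (all? λ x →
    (longStar v₁ x ≟ᵇ true) →-dec ¬? (x ≟ u₁) →-dec (time x ℕ.<? 2)) x
  early v₂ _ x refl = from-yes (all? λ x →
    (longStar v₂ x ≟ᵇ true) →-dec ¬? (x ≟ v₁) →-dec (time x ℕ.<? 1)) x
  early v₃ _ x refl = from-yes (all? λ x →
    (longStar v₃ x ≟ᵇ true) →-dec ¬? (x ≟ v₄) →-dec (time x ℕ.<? 1)) x

-- Subdividing an edge (O1)

record Subdivision {n} (G : Graph n) (u v : Fin n) (H : Fin n ⊎ Fin 1 → Fin n ⊎ Fin 1 → Bool) : Set where
  field
    old⁻ : ∀ {a b} → Adj H (inj₁ a) (inj₁ b) → Adj G a b × ¬ (a ≡ u × b ≡ v) × ¬ (a ≡ v × b ≡ u)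
    old⁺ : ∀ {a b} → Adj G a b → ¬ (a ≡ u × b ≡ v) → ¬ (a ≡ v × b ≡ u) → Adj H (inj₁ a) (inj₁ b)
    oz⁻  : ∀ {a} → Adj H (inj₁ a) (inj₂ zero) → a ≡ u ⊎ a ≡ v
    zo⁻  : ∀ {a} → Adj H (inj₂ zero) (inj₁ a) → a ≡ u ⊎ a ≡ v
    uz   : Adj H (inj₁ u) (inj₂ zero)
    vz   : Adj H (inj₁ v) (inj₂ zero)
    zu   : Adj H (inj₂ zero) (inj₁ u)
    zv   : Adj H (inj₂ zero) (inj₁ v)
    zz   : ¬ Adj H (inj₂ zero) (inj₂ zero)

-- The reason for describing the subdivided graph by properties: they are symmetric in the ends of
-- the edge, so a case for `u` also settles the case for `v`.
subdivision-sym : ∀ {n} {G : Graph n} {u v H} → Subdivision G u v H → Subdivision G v u H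
subdivision-sym s = record
  { old⁻ = λ ab → let (e , p , q) = old⁻ ab in e , q , p
  ; old⁺ = λ e p q → old⁺ e q p
  ; oz⁻ = swap ∘ oz⁻ ; zo⁻ = swap ∘ zo⁻ ; uz = vz ; vz = uz ; zu = zv ; zv = zu ; zz = zz }
  where open Subdivision s

double-< : ∀ {a b} → a < b → suc (a + a) < b + b
double-< {a} {b} a<b = subst (_≤ b + b) (cong suc (ℕ.+-suc a a)) (ℕ.+-mono-≤ a<b a<b)

module SubdivideCover {n} {G : Graph n} {u v} {H} (simple : IsSimple G) (cover : TimedCover G)
  (uv : Adj G u v) (sub : Subdivision G u v H) where
  open TimedCover cover
  open Subdivision sub

  vu : Adj G v u
  vu = trans (proj₁ simple v u) uv

  u≢v : u ≢ v
  u≢v refl = contradiction (trans (sym (proj₂ simple u)) uv) λ ()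

  forces-once : ∀ {a x y} → a ⇝ x → a ⇝ y → x ≢ y → ⊥
  forces-once ux uy x≢y = ℕ.<-asym (early ux (edge uy) (x≢y ∘ sym)) (early uy (edge ux) x≢y)

  neighbor-u : ∀ {b} → Adj H (inj₁ u) (inj₁ b) → v ≢ b
  neighbor-u ub refl = proj₁ (proj₂ (old⁻ ub)) (refl , refl)

  neighbor-v : ∀ {b} → Adj H (inj₁ v) (inj₁ b) → u ≢ b
  neighbor-v vb refl = proj₂ (proj₂ (old⁻ vb)) (refl , refl)

  continue-mixed : ∀ {a b} → Adj H (inj₁ a) (inj₁ b) → Adj H (inj₁ a) (inj₂ zero) → ∃ λ w → a ⇝ w
  continue-mixed ab az with oz⁻ az
  ... | inj₁ refl = continue uv (proj₁ (old⁻ ab)) (neighbor-u ab)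
  ... | inj₂ refl = continue vu (proj₁ (old⁻ ab)) (neighbor-v ab)

  continue-old : ∀ {a y y′} → Adj H (inj₁ a) y → Adj H (inj₁ a) y′ → y ≢ y′ → ∃ λ w → a ⇝ w
  continue-old {y = inj₁ b} {inj₁ b′} ab ab′ b≢b′ = continue (proj₁ (old⁻ ab)) (proj₁ (old⁻ ab′)) (b≢b′ ∘ cong inj₁)
  continue-old {y = inj₁ b} {inj₂ zero} ab az _ = continue-mixed ab az
  continue-old {y = inj₂ zero} {inj₁ b} az ab _ = continue-mixed ab az
  continue-old {y = inj₂ zero} {inj₂ zero} _ _ z≢z = contradiction refl z≢z

  -- The force from `u` to `v` is replaced by one from `u` to the new vertex and one from there to
  -- `v`.
  module Along (u⇝v : u ⇝ v) where
    infix 4 _⇝′_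
    _⇝′_ : Fin n ⊎ Fin 1 → Fin n ⊎ Fin 1 → Set
    inj₁ a ⇝′ inj₁ b = a ⇝ b × b ≢ v
    inj₁ a ⇝′ inj₂ _ = a ≡ u
    inj₂ _ ⇝′ inj₁ b = b ≡ v
    inj₂ _ ⇝′ inj₂ _ = ⊥

    -- Doubled to make room for the new vertex.
    time′ : Fin n ⊎ Fin 1 → ℕ
    time′ (inj₁ a) = suc (time a + time a)
    time′ (inj₂ _) = time v + time v

    mono : ∀ {a b} → time a < time b → time′ (inj₁ a) < time′ (inj₁ b)
    mono lt = ℕ.m<n⇒m<1+n (double-< lt)

    start⁻ : ∀ {x} → (∀ {y} → ¬ y ⇝′ inj₁ x) → x ≢ v × Start x
    start⁻ {x} s = x≢v , λ r → s {inj₁ _} (r , x≢v)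
      where
      x≢v : x ≢ v
      x≢v x≡v = s {inj₂ zero} x≡v

    start⁺ : ∀ {x} → Start x → ∀ {y} → ¬ y ⇝′ inj₁ x
    start⁺ s {inj₁ _} (r , _) = s r
    start⁺ s {inj₂ _} refl = s u⇝v

    result : TimedCover H
    result = record
      { _⇝_ = _⇝′_
      ; edge = λ {a} {b} → edge′ {a} {b}
      ; injective = λ {a} {b} {c} → injective′ {a} {b} {c}
      ; forced? = forced?′
      ; continue = λ {a} {b} {c} → continue′ {a} {b} {c}
      ; accompanied = λ {a} → accompanied′ {a}
      ; time = time′
      ; later = λ {a} {b} → later′ {a} {b}
      ; early = λ {a} {b} {c} → early′ {a} {b} {c}
      }
      where
      edge′ : ∀ {a b} → a ⇝′ b → Adj H a b
      edge′ {inj₁ a} {inj₁ b} (r , b≢v) =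
        old⁺ (edge r) (b≢v ∘ proj₂) (λ { (refl , refl) → asym u⇝v r })
      edge′ {inj₁ a} {inj₂ zero} refl = uz
      edge′ {inj₂ zero} {inj₁ b} refl = zv
      injective′ : ∀ {a b c} → a ⇝′ c → b ⇝′ c → a ≡ b
      injective′ {inj₁ _} {inj₁ _} {inj₁ _} (r , _) (r′ , _) = cong inj₁ (injective r r′)
      injective′ {inj₁ _} {inj₂ _} {inj₁ _} (_ , c≢v) c≡v = contradiction c≡v c≢v
      injective′ {inj₂ _} {inj₁ _} {inj₁ _} c≡v (_ , c≢v) = contradiction c≡v c≢v
      injective′ {inj₂ zero} {inj₂ zero} {inj₁ _} _ _ = refl
      injective′ {inj₁ _} {inj₁ _} {inj₂ _} refl refl = refl
      forced?′ : ∀ x → (∃ λ y → y ⇝′ x) ⊎ (∀ {y} → ¬ y ⇝′ x)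
      forced?′ (inj₂ zero) = inj₁ (inj₁ u , refl)
      forced?′ (inj₁ x) with x ≟ v | forced? x
      ... | yes x≡v | _ = inj₁ (inj₂ zero , x≡v)
      ... | no x≢v | inj₁ (y , r) = inj₁ (inj₁ y , r , x≢v)
      ... | no x≢v | inj₂ s = inj₂ λ {y} → start⁺ s {y}
      continue′ : ∀ {a b c} → Adj H a b → Adj H a c → b ≢ c → ∃ λ w → a ⇝′ w
      continue′ {inj₂ zero} _ _ _ = inj₁ v , refl
      continue′ {inj₁ a} ab ac b≢c with continue-old ab ac b≢c
      ... | w , r with w ≟ v
      ... | yes refl = inj₂ zero , injective r u⇝v
      ... | no w≢v = inj₁ w , r , w≢v
      accompanied′ : ∀ {a} → (∀ {y} → ¬ y ⇝′ a) → ∃ λ b → Adj H a b × (∀ {y} → ¬ y ⇝′ b)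
      accompanied′ {inj₂ zero} s = contradiction refl (s {inj₁ u})
      accompanied′ {inj₁ a} s with start⁻ {a} (λ {y} → s {y})
      ... | a≢v , s₀ with accompanied s₀
      ... | b , ab , sb = inj₁ b
        , old⁺ ab (λ { (_ , refl) → sb u⇝v }) (a≢v ∘ proj₁) , λ {y} → start⁺ sb {y}
      later′ : ∀ {a b} → a ⇝′ b → time′ a < time′ b
      later′ {inj₁ _} {inj₁ _} (r , _) = mono (later r)
      later′ {inj₁ _} {inj₂ _} refl = double-< (later u⇝v)
      later′ {inj₂ _} {inj₁ _} refl = ℕ.≤-refl
      early′ : ∀ {a b c} → a ⇝′ b → Adj H a c → c ≢ b → time′ c < time′ b
      early′ {inj₁ _} {inj₁ _} {inj₁ _} (r , _) ac c≢b = mono (early r (proj₁ (old⁻ ac)) (c≢b ∘ cong inj₁))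
      early′ {inj₁ _} {inj₁ _} {inj₂ zero} (r , b≢v) ac c≢b with oz⁻ ac
      ... | inj₁ refl = contradiction (b≢v ∘ sym) (forces-once u⇝v r)
      ... | inj₂ refl = ℕ.m<n⇒m<1+n (ℕ.<-trans ℕ.≤-refl (double-< (later r)))
      early′ {inj₁ _} {inj₂ _} {inj₁ c} refl ac c≢b =
        double-< (early u⇝v (proj₁ (old⁻ ac)) (neighbor-u ac ∘ sym))
      early′ {inj₁ _} {inj₂ zero} {inj₂ zero} refl ac c≢b = contradiction refl c≢b
      early′ {inj₂ zero} {inj₁ _} {inj₁ c} refl ac c≢b with zo⁻ ac
      ... | inj₁ refl = mono (later u⇝v)
      ... | inj₂ refl = contradiction refl c≢b
      early′ {inj₂ zero} {inj₁ _} {inj₂ zero} refl ac c≢b = ℕ.≤-refl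

  -- If the edge carries no force and `u` has degree at most 2, then `u` and `v` are both starts.
  -- The new vertex becomes a start in place of `u`, accompanied by `v`, and forces `u`: the chain
  -- of `u` grows at its front.
  module Across (¬u⇝v : ¬ u ⇝ v) (¬v⇝u : ¬ v ⇝ u) (d : deg G u ≤ 2) where
    infix 4 _⇝′_
    _⇝′_ : Fin n ⊎ Fin 1 → Fin n ⊎ Fin 1 → Set
    inj₁ a ⇝′ inj₁ b = a ⇝ b
    inj₂ _ ⇝′ inj₁ b = b ≡ u
    _ ⇝′ inj₂ _ = ⊥

    flip : ∀ {x y} → Adj G x y → Adj G y x
    flip {x} {y} xy = trans (proj₁ simple y x) xy

    -- By the degree bound, a further neighbor of u is the vertex forced by u.
    u-forces-other : ∀ {x} → Adj G u x → v ≢ x → u ⇝ x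
    u-forces-other {x} ux v≢x with continue uv ux v≢x
    ... | w , r with w ≟ x
    ... | yes refl = r
    ... | no w≢x = contradiction (edge r)
      (deg≤2⇒no-three {G = G} d v≢x (λ { refl → ¬u⇝v r }) (w≢x ∘ sym) uv ux)

    start-u : Start u
    start-u {x} r with v ≟ x
    ... | yes refl = ¬v⇝u r
    ... | no v≢x = asym r (u-forces-other (flip (edge r)) v≢x)

    only-start-v : ∀ {x} → Adj G u x → Start x → x ≡ v
    only-start-v {x} ux s with v ≟ x
    ... | yes refl = refl
    ... | no v≢x = contradiction (u-forces-other ux v≢x) s

    start-v : Start v
    start-v with accompanied start-u
    ... | x , ux , s with only-start-v ux s
    ... | refl = s

    time′ : Fin n ⊎ Fin 1 → ℕ
    time′ (inj₁ a) with a ≟ u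
    -- The new vertex forces `u` once `v` is colored. On the doubled scale it comes just before `v`,
    -- and `u` just after `v`.
    ... | yes _ = 2 + (time v + time v)
    ... | no _ = suc (time a + time a)
    time′ (inj₂ _) = time v + time v

    time′-u : time′ (inj₁ u) ≡ 2 + (time v + time v)
    time′-u with u ≟ u
    ... | yes _ = refl
    ... | no u≢u = contradiction refl u≢u

    time′-≢ : ∀ {a} → a ≢ u → time′ (inj₁ a) ≡ suc (time a + time a)
    time′-≢ {a} a≢u with a ≟ u
    ... | yes a≡u = contradiction a≡u a≢u
    ... | no _ = refl

    mono : ∀ {a b} → a ≢ u → b ≢ u → time a < time b → time′ (inj₁ a) < time′ (inj₁ b)
    mono a≢u b≢u lt = subst₂ _<_ (sym (time′-≢ a≢u)) (sym (time′-≢ b≢u)) (ℕ.m<n⇒m<1+n (double-< lt))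

    z<u : time′ (inj₂ zero) < time′ (inj₁ u)
    z<u = subst (time v + time v <_) (sym time′-u) (ℕ.m≤n⇒m≤1+n ℕ.≤-refl)

    u<next : ∀ {b} → u ⇝ b → time′ (inj₁ u) < time′ (inj₁ b)
    u<next r = subst₂ _<_ (sym time′-u) (sym (time′-≢ λ { refl → start-u r }))
      (s≤s (double-< (early r uv λ { refl → ¬u⇝v r })))

    start⁺ : ∀ {x} → x ≢ u → Start x → ∀ {y} → ¬ y ⇝′ inj₁ x
    start⁺ x≢u s {inj₁ _} r = s r
    start⁺ x≢u s {inj₂ _} x≡u = x≢u x≡u

    start-z : ∀ {y} → ¬ y ⇝′ inj₂ zero
    start-z {inj₁ _} ()
    start-z {inj₂ _} ()

    result : TimedCover H
    result = record
      { _⇝_ = _⇝′_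
      ; edge = λ {a} {b} → edge′ {a} {b}
      ; injective = λ {a} {b} {c} → injective′ {a} {b} {c}
      ; forced? = forced?′
      ; continue = λ {a} {b} {c} → continue′ {a} {b} {c}
      ; accompanied = λ {a} → accompanied′ {a}
      ; time = time′
      ; later = λ {a} {b} → later′ {a} {b}
      ; early = λ {a} {b} {c} → early′ {a} {b} {c}
      }
      where
      edge′ : ∀ {a b} → a ⇝′ b → Adj H a b
      edge′ {inj₁ a} {inj₁ b} r = old⁺ (edge r) (λ { (refl , refl) → ¬u⇝v r }) (λ { (refl , refl) → ¬v⇝u r })
      edge′ {inj₂ zero} {inj₁ b} refl = zu
      injective′ : ∀ {a b c} → a ⇝′ c → b ⇝′ c → a ≡ b
      injective′ {inj₁ _} {inj₁ _} {inj₁ _} r r′ = cong inj₁ (injective r r′)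
      injective′ {inj₁ _} {inj₂ _} {inj₁ _} r refl = contradiction r start-u
      injective′ {inj₂ _} {inj₁ _} {inj₁ _} refl r = contradiction r start-u
      injective′ {inj₂ zero} {inj₂ zero} {inj₁ _} _ _ = refl
      forced?′ : ∀ x → (∃ λ y → y ⇝′ x) ⊎ (∀ {y} → ¬ y ⇝′ x)
      forced?′ (inj₂ zero) = inj₂ λ {y} → start-z {y}
      forced?′ (inj₁ x) with x ≟ u | forced? x
      ... | yes x≡u | _ = inj₁ (inj₂ zero , x≡u)
      ... | no x≢u | inj₁ (y , r) = inj₁ (inj₁ y , r)
      ... | no x≢u | inj₂ s = inj₂ λ {y} → start⁺ x≢u s {y}
      continue′ : ∀ {a b c} → Adj H a b → Adj H a c → b ≢ c → ∃ λ w → a ⇝′ w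
      continue′ {inj₂ zero} _ _ _ = inj₁ u , refl
      continue′ {inj₁ a} ab ac b≢c with continue-old ab ac b≢c
      ... | w , r = inj₁ w , r
      accompanied′ : ∀ {a} → (∀ {y} → ¬ y ⇝′ a) → ∃ λ b → Adj H a b × (∀ {y} → ¬ y ⇝′ b)
      accompanied′ {inj₂ zero} s = inj₁ v , zv , λ {y} → start⁺ (u≢v ∘ sym) start-v {y}
      accompanied′ {inj₁ a} s with accompanied {a} (λ {y} → s {inj₁ y})
      ... | b , ab , sb with a ≟ u | b ≟ u
      ... | yes refl | _ = contradiction refl (s {inj₂ zero})
      ... | no a≢u | no b≢u = inj₁ b , old⁺ ab (a≢u ∘ proj₁) (b≢u ∘ proj₂) , λ {y} → start⁺ b≢u sb {y}
      ... | no a≢u | yes refl with only-start-v (flip ab) (λ {y} → s {inj₁ y})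
      ... | refl = inj₂ zero , vz , λ {y} → start-z {y}
      later′ : ∀ {a b} → a ⇝′ b → time′ a < time′ b
      later′ {inj₁ a} {inj₁ b} r with a ≟ u
      ... | no a≢u = subst (_< time′ (inj₁ b)) (time′-≢ a≢u) (mono a≢u (λ { refl → start-u r }) (later r))
      ... | yes refl = subst (_< time′ (inj₁ b)) time′-u (u<next r)
      later′ {inj₂ zero} {inj₁ _} refl = z<u
      early′ : ∀ {a b c} → a ⇝′ b → Adj H a c → c ≢ b → time′ c < time′ b
      early′ {inj₁ a} {inj₁ b} {inj₁ c} r ac c≢b with c ≟ u
      ... | no c≢u = subst (_< time′ (inj₁ b)) (time′-≢ c≢u)
        (mono c≢u (λ { refl → start-u r }) (early r (proj₁ (old⁻ ac)) (c≢b ∘ cong inj₁)))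
      -- Delaying `u` does no harm to the forces of its neighbor `a`: since `a` is not `v`, it is
      -- itself forced by `u`, so `u` still precedes all that `a` forces.
      ... | yes refl = subst (_< time′ (inj₁ b)) time′-u
        (ℕ.<-trans (u<next u⇝a) (mono (λ { refl → start-u u⇝a }) (λ { refl → start-u r }) (later r)))
        where
        u⇝a : u ⇝ a
        u⇝a = u-forces-other (flip (proj₁ (old⁻ ac))) (λ { refl → proj₂ (proj₂ (old⁻ ac)) (refl , refl) })
      early′ {inj₁ _} {inj₁ b} {inj₂ zero} r ac c≢b with oz⁻ ac
      ... | inj₁ refl = ℕ.<-trans z<u (u<next r)
      ... | inj₂ refl = subst (time v + time v <_) (sym (time′-≢ λ { refl → start-u r }))
        (ℕ.m<n⇒m<1+n (ℕ.<-trans ℕ.≤-refl (double-< (later r))))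
      early′ {inj₂ zero} {inj₁ _} {inj₁ c} refl ac c≢b with zo⁻ ac
      ... | inj₁ refl = contradiction refl c≢b
      ... | inj₂ refl = subst₂ _<_ (sym (time′-≢ (u≢v ∘ sym))) (sym time′-u) ℕ.≤-refl
      early′ {inj₂ zero} {inj₁ _} {inj₂ zero} refl ac c≢b = contradiction ac zz

-- Whether the edge carries a force is decidable, because `forced?` names the unique forcer. The
-- degree bound is used only when there is no force in either direction.
subdivide-cover : ∀ {n} {G : Graph n} {u v H} → IsSimple G → Adj G u v → deg G u ≤ 2 ⊎ deg G v ≤ 2 →
  Subdivision G u v H → TimedCover G → TimedCover H
subdivide-cover {G = G} {u} {v} simple uv small sub cover = by-cases (forces? u v) (forces? v u) small
  where
  open TimedCover cover
  forces? : ∀ a b → a ⇝ b ⊎ ¬ a ⇝ b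
  forces? a b with forced? b
  ... | inj₂ s = inj₂ s
  ... | inj₁ (c , r) with a ≟ c
  ... | yes refl = inj₁ r
  ... | no a≢c = inj₂ λ r′ → a≢c (injective r′ r)
  vu : Adj G v u
  vu = trans (proj₁ simple v u) uv
  by-cases : u ⇝ v ⊎ ¬ u ⇝ v → v ⇝ u ⊎ ¬ v ⇝ u → deg G u ≤ 2 ⊎ deg G v ≤ 2 → TimedCover _
  by-cases (inj₁ r) _ _ = SubdivideCover.Along.result simple cover uv sub r
  by-cases (inj₂ _) (inj₁ r) _ = SubdivideCover.Along.result simple cover vu (subdivision-sym sub) r
  by-cases (inj₂ p) (inj₂ q) (inj₁ d) = SubdivideCover.Across.result simple cover uv sub p q d
  by-cases (inj₂ p) (inj₂ q) (inj₂ d) = SubdivideCover.Across.result simple cover vu (subdivision-sym sub) q p d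

∨⁻ : ∀ {a b} → a ∨ b ≡ true → a ≡ true ⊎ b ≡ true
∨⁻ {true} _ = inj₁ refl
∨⁻ {false} b = inj₂ b

∧⁻ : ∀ {a b} → a ∧ b ≡ true → a ≡ true × b ≡ true
∧⁻ {true} {true} _ = refl , refl

sameEdge : ∀ {n} → Fin n → Fin n → Fin n → Fin n → Bool
sameEdge u v a b = (a == u ∧ b == v) ∨ (a == v ∧ b == u)

sameEdge⁻ : ∀ {n} {u v a b : Fin n} → sameEdge u v a b ≡ true → (a ≡ u × b ≡ v) ⊎ (a ≡ v × b ≡ u)
sameEdge⁻ e with ∨⁻ e
... | inj₁ p = let (q , r) = ∧⁻ p in inj₁ (==⇒≡ q , ==⇒≡ r)
... | inj₂ p = let (q , r) = ∧⁻ p in inj₂ (==⇒≡ q , ==⇒≡ r)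

sameEdge⁺ : ∀ {n} {u v a b : Fin n} → (a ≡ u × b ≡ v) ⊎ (a ≡ v × b ≡ u) → sameEdge u v a b ≡ true
sameEdge⁺ {u = u} {v} (inj₁ (refl , refl)) rewrite ≡⇒== u | ≡⇒== v = refl
sameEdge⁺ {u = u} {v} (inj₂ (refl , refl)) rewrite ≡⇒== u | ≡⇒== v = ∨-zeroʳ _

deleteEdge-simple : ∀ {n} {G : Graph n} u v → IsSimple G → IsSimple (λ a b → G a b ∧ not (sameEdge u v a b))
deleteEdge-simple {G = G} u v (G-sym , G-irrefl) = sym′ , λ x → cong (_∧ not (sameEdge u v x x)) (G-irrefl x)
  where
  sym′ : ∀ x y → G x y ∧ not (sameEdge u v x y) ≡ G y x ∧ not (sameEdge u v y x)
  sym′ x y = cong₂ (λ p q → p ∧ not q) (G-sym x y)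
    (trans (∨-comm (x == u ∧ y == v) _) (cong₂ _∨_ (∧-comm (x == v) _) (∧-comm (x == u) _)))

O1-subdivision : ∀ {n} {G : Graph n} {u v} →
  Subdivision G u v (sumGraph (λ a b → G a b ∧ not (sameEdge u v a b)) (λ _ a → a == u ∨ a == v) noNew)
O1-subdivision {G = G} {u} {v} = record
  { old⁻ = λ ab → let (p , q) = ∧⁻ ab in
      p , (λ e → different q (sameEdge⁺ (inj₁ e))) , (λ e → different q (sameEdge⁺ (inj₂ e)))
  ; old⁺ = λ {a} {b} ab p q → trans (cong (_∧ not (sameEdge u v a b)) ab) (negate a b p q)
  ; oz⁻ = ends⁻ ; zo⁻ = ends⁻
  ; uz = end-u ; vz = end-v ; zu = end-u ; zv = end-v
  ; zz = λ () }
  where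
  different : ∀ {b} → not b ≡ true → b ≢ true
  different {false} _ ()
  negate : ∀ a b → ¬ (a ≡ u × b ≡ v) → ¬ (a ≡ v × b ≡ u) → not (sameEdge u v a b) ≡ true
  negate a b p q with sameEdge u v a b in eq
  ... | false = refl
  ... | true with sameEdge⁻ {u = u} {v} {a} {b} eq
  ... | inj₁ e = contradiction e p
  ... | inj₂ e = contradiction e q
  ends⁻ : ∀ {a} → (a == u ∨ a == v) ≡ true → a ≡ u ⊎ a ≡ v
  ends⁻ e with ∨⁻ e
  ... | inj₁ p = inj₁ (==⇒≡ p)
  ... | inj₂ p = inj₂ (==⇒≡ p)
  end-u : (u == u ∨ u == v) ≡ true
  end-u rewrite ≡⇒== u = refl
  end-v : (v == u ∨ v == v) ≡ true
  end-v rewrite ≡⇒== v = ∨-zeroʳ _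

-- Members of the family have timed covers

iso-simple : ∀ {n m} {G : Graph n} {H : Graph m} → Iso G H → IsSimple G → IsSimple H
iso-simple {G = G} {H} (π , H≡G) (G-sym , G-irrefl) = sym′ , λ x → trans (H≡G′ x x) (G-irrefl _)
  where
  open Inverse π
  H≡G′ : ∀ x y → H x y ≡ G (from x) (from y)
  H≡G′ x y = trans (cong₂ H (sym (strictlyInverseˡ x)) (sym (strictlyInverseˡ y))) (H≡G (from x) (from y))
  sym′ : ∀ x y → H x y ≡ H y x
  sym′ x y = trans (H≡G′ x y) (trans (G-sym _ _) (sym (H≡G′ y x)))

iso-cover : ∀ {n m} {G : Graph n} {H : Graph m} → Iso G H → TimedCover G → TimedCover H
iso-cover {G = G} {H} (π , H≡G) = transport-cover from to strictlyInverseʳ strictlyInverseˡ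
  (λ x y → trans (cong₂ H (sym (strictlyInverseˡ x)) (sym (strictlyInverseˡ y))) (H≡G (from x) (from y)))
  where open Inverse π

P₂-cover : TimedCover P₂
P₂-cover = record
  { _⇝_ = λ _ _ → ⊥ ; edge = λ () ; injective = λ () ; forced? = λ _ → inj₂ λ ()
  ; continue = λ {u} {a} {b} ua ub a≢b → contradiction (one u a b ua ub) a≢b
  ; accompanied = λ
      { {zero} _ → suc zero , refl , λ ()
      ; {suc zero} _ → zero , refl , λ () }
  ; time = λ _ → 0 ; later = λ () ; early = λ () }
  where
  one : ∀ u a b → Adj P₂ u a → Adj P₂ u b → a ≡ b
  one = from-yes (all? λ u → all? λ a → all? λ b →
    (P₂ u a ≟ᵇ true) →-dec (P₂ u b ≟ᵇ true) →-dec (a ≟ b))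

P₂-simple : IsSimple P₂
P₂-simple = from-yes (all? λ x → all? λ y → P₂ x y ≟ᵇ P₂ y x) , from-yes (all? λ x → P₂ x x ≟ᵇ false)

InF⇒simple : ∀ {n} {G : Graph n} → InF G → IsSimple G
InF⇒simple base = P₂-simple
InF⇒simple (iso f e) = iso-simple e (InF⇒simple f)
InF⇒simple (o1 {u = u} {v} f _ _) = extend-simple (deleteEdge-simple u v (InF⇒simple f)) λ _ → refl
InF⇒simple (o2 f _) = extend-simple (InF⇒simple f) λ _ → refl
InF⇒simple (o3 f _ _ _) = extend-simple (InF⇒simple f) λ _ → refl
InF⇒simple (o4 f _) = extend-simple (InF⇒simple f) λ where
  zero → refl
  (suc zero) → refl
  (suc (suc zero)) → refl
InF⇒simple (o5 f _) = extend-simple (InF⇒simple f) λ where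
  u₁ → refl
  v₁ → refl
  v₂ → refl
  v₃ → refl
  v₄ → refl
  u₃ → refl

forces : ∀ {n} {G : Graph n} {v} → 2 ≤ deg G v → (cover : TimedCover G) → ∃ (TimedCover._⇝_ cover v)
forces {G = G} {v} d cover with two≤deg⁻ {G = G} {v} d
... | a , b , a≢b , va , vb = TimedCover.continue cover va vb a≢b

==∧==⇒≡ : ∀ {k n} {i j : Fin k} {a b : Fin n} → (i == j ∧ a == b) ≡ true → i ≡ j × a ≡ b
==∧==⇒≡ e = let (p , q) = ∧⁻ e in ==⇒≡ p , ==⇒≡ q

by-table : ∀ {k} {N M : Fin k → Fin k → Bool} {_ : True (all? λ i → all? λ j → N i j ≟ᵇ M i j)} →
  ∀ i j → N i j ≡ M i j
by-table {_} {_} {_} {t} = toWitness t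

InF⇒cover : ∀ {n} {G : Graph n} → InF G → TimedCover G
InF⇒cover base = P₂-cover
InF⇒cover (iso f e) = iso-cover e (InF⇒cover f)
InF⇒cover (o1 f uv small) =
  extend-cover (subdivide-cover (InF⇒simple f) uv small O1-subdivision (InF⇒cover f))
InF⇒cover (o2 {G = G} {v} f (a , b , a≢b , va , vb , leaf-a , leaf-b)) =
  extend-cover (add-start-leaves (InF⇒cover f) start (continue va vb a≢b) refl ==⇒≡ λ _ → ≡⇒== v)
  where
  open TimedCover (InF⇒cover f)
  open StrongSupportCover (InF⇒simple f) (InF⇒cover f) a≢b va vb
    (leaf⇒atMostOne {G = G} leaf-a) (leaf⇒atMostOne {G = G} leaf-b)
InF⇒cover (o3 {G = G} {w} {v} f (a , b , a≢b , wa , wb , leaf-a , leaf-b) wv leaf-v) = result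
  where
  simple = InF⇒simple f
  cover = InF⇒cover f
  open TimedCover cover
  one-v = leaf⇒atMostOne {G = G} leaf-v
  vw : Adj G v w
  vw = trans (proj₁ simple v w) wv
  -- `v` may or may not be one of the two leaves witnessing the strong support; in either case `w`
  -- has a leaf other than `v`.
  twin : ∃ λ c → v ≢ c × Adj G w c × AtMostOne G c
  twin with v ≟ a
  ... | yes refl = b , a≢b , wb , leaf⇒atMostOne {G = G} leaf-b
  ... | no v≢a = a , v≢a , wa , leaf⇒atMostOne {G = G} leaf-a
  result : TimedCover (O3 G v)
  result with twin | forced? v
  ... | c , v≢c , wc , one-c | inj₂ s = extend-cover (extend-at-leaf one-v vw wv cover s start)
    where open StrongSupportCover simple cover v≢c wv wc one-v one-c
  ... | c , v≢c , wc , one-c | inj₁ (x , r) with one-v (trans (proj₁ simple v x) (edge r)) vw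
  -- Here `w` forces `v`, which must be a start for the extension, so the force is first moved to
  -- the twin leaf.
  ... | refl = extend-cover (extend-at-leaf one-v vw wv swapped start-a (start′ w≢b start))
    where
    open StrongSupportCover simple cover v≢c wv wc one-v one-c
    open Swap simple cover v≢c wv wc one-v one-c r
InF⇒cover (o4 f d) = extend-cover
  (glue cover path₃-cover (forces d cover) (zero , refl , refl) by-table ==∧==⇒≡)
  where cover = InF⇒cover f
InF⇒cover (o5 f d) = extend-cover
  (glue cover longStar-cover (forces d cover) (u₁ , refl) by-table ==∧==⇒≡)
  where cover = InF⇒cover f

-- Rooting a tree at a leaf

module FarLeaf {n} {T : Graph n} (simple : IsSimple T) (acyclic : Acyclic T) (r : Fin n) where

  -- A path from r, read backwards: c 0 is its current end and c (suc k) is r.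
  record Trail : Set where
    field
      k        : ℕ
      c        : ℕ → Fin n
      last     : c (suc k) ≡ r
      distinct : ∀ {i j} → i ≤ suc k → j ≤ suc k → c i ≡ c j → i ≡ j
      linked   : ∀ {i} → i ≤ k → Adj T (c i) (c (suc i))

  Goal : Set
  Goal = ∃ λ ℓ → ℓ ≢ r × ∃ λ p → Adj T ℓ p × (∀ y → Adj T ℓ y → p ≡ y)

  short : (t : Trail) → Trail.k t < n
  short t with Trail.k t ℕ.<? n
  ... | yes lt = lt
  ... | no ge with pigeonhole {n} (s≤s (ℕ.≮⇒≥ ge)) (λ i → Trail.c t (toℕ i))
  ... | i , j , i<j , eq = contradiction
    (toℕ-injective (Trail.distinct t (ℕ.m≤n⇒m≤1+n (toℕ≤pred[n] i)) (ℕ.m≤n⇒m≤1+n (toℕ≤pred[n] j)) eq)) (Fin-<⇒≢ i<j)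

  -- The trail is prolonged at its free end until that end is a leaf. A further neighbor already on
  -- the trail would close a cycle; `b` counts the prolongations that `short` still admits.
  grow : ∀ b (t : Trail) → n ≤ Trail.k t + b → Goal
  grow zero t n≤k = contradiction (short t) (ℕ.≤⇒≯ (subst (n ≤_) (ℕ.+-identityʳ _) n≤k))
  grow (suc b) t n≤ with another T (Trail.c t 0) (Trail.c t 1)
  ... | inj₂ only = Trail.c t 0
    , (λ eq → contradiction (distinct z≤n ℕ.≤-refl (trans eq (sym last))) λ ())
    , Trail.c t 1 , linked z≤n , only
    where open Trail t
  ... | inj₁ (w , c₁≢w , c₀w) with search {P = λ (i : Fin (suc (suc (Trail.k t)))) → Trail.c t (toℕ i) ≡ w}
    {λ i → Trail.c t (toℕ i) ≢ w} (λ i → decide (Trail.c t (toℕ i) ≟ w))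
    where
    decide : ∀ {P : Set} → Dec P → P ⊎ ¬ P
    decide (yes p) = inj₁ p
    decide (no ¬p) = inj₂ ¬p
  ... | inj₂ fresh = grow b t′ (subst (n ≤_) (ℕ.+-suc k b) n≤)
    where
    open Trail t
    c′ : ℕ → Fin n
    c′ zero = w
    c′ (suc i) = c i
    new : ∀ {i} → i ≤ suc k → c i ≢ w
    new i≤ eq = fresh (fromℕ< (s≤s i≤)) (trans (cong c (toℕ-fromℕ< (s≤s i≤))) eq)
    distinct′ : ∀ {i j} → i ≤ suc (suc k) → j ≤ suc (suc k) → c′ i ≡ c′ j → i ≡ j
    distinct′ {zero} {zero} _ _ _ = refl
    distinct′ {zero} {suc j} _ (s≤s j≤) eq = contradiction (sym eq) (new j≤)
    distinct′ {suc i} {zero} (s≤s i≤) _ eq = contradiction eq (new i≤)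
    distinct′ {suc i} {suc j} (s≤s i≤) (s≤s j≤) eq = cong suc (distinct i≤ j≤ eq)
    t′ : Trail
    t′ = record { k = suc k ; c = c′ ; last = last ; distinct = distinct′
      ; linked = λ { {zero} _ → trans (proj₁ simple w (c 0)) c₀w ; {suc i} (s≤s i≤) → linked i≤ } }
  ... | inj₁ (zero , c₀≡w) = contradiction
    (trans (sym (proj₂ simple w)) (subst (λ x → Adj T x w) c₀≡w c₀w)) λ ()
  ... | inj₁ (suc zero , c₁≡w) = contradiction c₁≡w c₁≢w
  -- The repeated vertex is at least two steps back, so the closed part of the trail has at least
  -- three vertices.
  ... | inj₁ (suc (suc j) , cⱼ≡w) = contradiction cycle acyclic
    where
    open Trail t
    bound : ∀ (i : Fin (suc (suc (suc (toℕ j))))) → toℕ i ≤ suc k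
    bound i = ℕ.≤-trans (toℕ≤pred[n] i) (toℕ≤pred[n] (Fin.suc (Fin.suc j)))
    cycle : Cycle T
    cycle = record
      { k = toℕ j
      ; c = λ i → c (toℕ i)
      ; inj = λ {i} {i′} eq → toℕ-injective (distinct (bound i) (bound i′) eq)
      ; consec = λ i → subst (λ m → Adj T (c m) (c (suc (toℕ i)))) (sym (toℕ-inject₁ i))
          (linked (ℕ.≤-pred (bound (suc i))))
      ; close = subst (λ m → Adj T (c m) (c 0)) (sym (toℕ-fromℕ (suc (suc (toℕ j)))))
          (subst (λ x → Adj T x (c 0)) (sym cⱼ≡w) (trans (proj₁ simple w (c 0)) c₀w))
      }

  far-leaf : ∀ {p} → Adj T r p → Goal
  far-leaf {p} rp = grow n t (ℕ.m≤n+m n 0)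
    where
    c : ℕ → Fin n
    c zero = p
    c (suc _) = r
    p≢r : p ≢ r
    p≢r refl = contradiction (trans (sym (proj₂ simple p)) rp) λ ()
    t : Trail
    t = record { k = 0 ; c = c ; last = refl
      ; distinct = λ
          { {zero} {zero} _ _ _ → refl
          ; {zero} {suc zero} _ _ eq → contradiction eq p≢r
          ; {suc zero} {zero} _ _ eq → contradiction (sym eq) p≢r
          ; {suc zero} {suc zero} _ _ _ → refl
          ; {suc (suc _)} (s≤s ())
          ; {_} {suc (suc _)} _ (s≤s ()) }
      ; linked = λ { {zero} _ → trans (proj₁ simple p r) rp } }

-- A tree oriented towards its root: `rank` increases along the unique edge from a vertex to its
-- parent. It need not be a distance, so it can be restricted to part of the tree unchanged.
record Ranked {n} (T : Graph n) (root : Fin n) : Set where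
  field
    rank          : Fin n → ℕ
    levels        : ∀ {x y} → Adj T x y → rank x ≢ rank y
    parent-unique : ∀ {x y z} → Adj T x y → rank x < rank y → Adj T x z → rank x < rank z → y ≡ z
    parent        : ∀ {x} → x ≢ root → ∃ λ y → Adj T x y × rank x < rank y
    rank≤root     : ∀ x → rank x ≤ rank root

module RemoveLeaf {n} {T : Graph (suc n)} (tree : IsTree T) {ℓ p}
  (ℓp : Adj T ℓ p) (only : ∀ y → Adj T ℓ y → p ≡ y) where

  T-sym = proj₁ (proj₁ tree)
  T-irrefl = proj₂ (proj₁ tree)

  T′ : Graph n
  T′ x y = T (punchIn ℓ x) (punchIn ℓ y)

  view : ∀ x → x ≡ ℓ ⊎ ∃ λ x′ → punchIn ℓ x′ ≡ x
  view x with ℓ ≟ x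
  ... | yes eq = inj₁ (sym eq)
  ... | no ne = inj₂ (punchOut ne , punchIn-punchOut ne)

  ℓ≢p : ℓ ≢ p
  ℓ≢p refl = contradiction (trans (sym (T-irrefl ℓ)) ℓp) λ ()

  -- A walk can visit `ℓ` only by stepping there from `p` and back. The second component remembers,
  -- while the walk is at `ℓ`, that `p` has been reached.
  reach : ∀ {u v} → Reach T (punchIn ℓ u) v →
    (∀ {v′} → punchIn ℓ v′ ≡ v → Reach T′ u v′) × (∀ {p′} → v ≡ ℓ → punchIn ℓ p′ ≡ p → Reach T′ u p′)
  reach {u} here = (λ eq → subst (Reach T′ u) (sym (punchIn-injective ℓ _ _ eq)) here)
    , λ eq _ → contradiction eq (punchInᵢ≢i ℓ u)
  reach {u} (step {w} {v} r wv) with reach r | view w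
  ... | _ , to-p | inj₁ refl = (λ eq → to-p refl (trans eq (sym (only v wv))))
    , λ { refl _ → contradiction (trans (sym (T-irrefl ℓ)) wv) λ () }
  ... | to-w , _ | inj₂ (w′ , refl) = (λ { refl → step (to-w refl) wv })
    , λ { refl eq → to-w (trans eq (only _ (trans (T-sym ℓ _) wv))) }

  tree′ : IsTree T′
  tree′ = ((λ x y → T-sym _ _) , λ x → T-irrefl _)
    , (λ u v → proj₁ (reach (proj₁ (proj₂ tree) (punchIn ℓ u) (punchIn ℓ v))) refl)
    , λ cyc → let open Cycle cyc in proj₂ (proj₂ tree) (record
        { k = k ; c = punchIn ℓ ∘ c ; inj = inj ∘ punchIn-injective ℓ _ _ ; consec = consec ; close = close })

  -- `ℓ` goes to the bottom with rank 0 and everything else moves up by one, so `p` becomes its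
  -- parent.
  extend-rank : ∀ {r} → Ranked T′ r → Ranked T (punchIn ℓ r)
  extend-rank {r} ranked = record
    { rank = rank′ ; levels = levels′ ; parent-unique = parent-unique′ ; parent = parent′ ; rank≤root = rank≤root′ }
    where
    open Ranked ranked
    rank′ : Fin (suc n) → ℕ
    rank′ x with view x
    ... | inj₁ _ = 0
    ... | inj₂ (x′ , _) = suc (rank x′)
    rank-in : ∀ x → rank′ (punchIn ℓ x) ≡ suc (rank x)
    rank-in x with view (punchIn ℓ x)
    ... | inj₁ eq = contradiction eq (punchInᵢ≢i ℓ x)
    ... | inj₂ (x′ , eq) = cong (suc ∘ rank) (punchIn-injective ℓ _ _ eq)
    levels′ : ∀ {x y} → Adj T x y → rank′ x ≢ rank′ y
    levels′ {x} {y} xy with view x | view y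
    ... | inj₁ refl | inj₁ refl = contradiction (trans (sym (T-irrefl _)) xy) λ ()
    ... | inj₁ refl | inj₂ (_ , refl) = λ ()
    ... | inj₂ _ | inj₁ refl = λ ()
    ... | inj₂ (_ , refl) | inj₂ (_ , refl) = levels xy ∘ ℕ.suc-injective
    parent-unique′ : ∀ {x y z} → Adj T x y → rank′ x < rank′ y → Adj T x z → rank′ x < rank′ z → y ≡ z
    parent-unique′ {x} {y} {z} xy x<y xz x<z with view x
    ... | inj₁ refl = trans (sym (only y xy)) (only z xz)
    ... | inj₂ (x′ , refl) with view y | view z
    ... | inj₁ refl | _ = contradiction x<y λ ()
    ... | inj₂ _ | inj₁ refl = contradiction x<z λ ()
    ... | inj₂ (y′ , refl) | inj₂ (z′ , refl) = cong (punchIn ℓ)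
      (parent-unique xy (ℕ.≤-pred x<y) xz (ℕ.≤-pred x<z))
    parent′ : ∀ {x} → x ≢ punchIn ℓ r → ∃ λ y → Adj T x y × rank′ x < rank′ y
    parent′ {x} x≢r with view x
    ... | inj₁ refl = p , ℓp , positive
      where
      positive : 0 < rank′ p
      positive with view p
      ... | inj₁ eq = contradiction (sym eq) ℓ≢p
      ... | inj₂ _ = s≤s z≤n
    ... | inj₂ (x′ , refl) with parent {x′} (λ { refl → x≢r refl })
    ... | y , xy , lt = punchIn ℓ y , xy , subst (suc (rank x′) <_) (sym (rank-in y)) (s≤s lt)
    rank≤root′ : ∀ x → rank′ x ≤ rank′ (punchIn ℓ r)
    rank≤root′ x with view x
    ... | inj₁ _ = z≤n
    ... | inj₂ (x′ , refl) = subst (suc (rank x′) ≤_) (sym (rank-in r)) (s≤s (rank≤root x′))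

neighbor : ∀ {n} {T : Graph n} → IsTree T → ∀ {v r} → v ≢ r → ∃ λ p → Adj T r p
neighbor tree {v} {r} v≢r with proj₁ (proj₂ tree) v r
... | here = contradiction refl v≢r
... | step {w} _ wr = w , trans (proj₁ (proj₁ tree) r w) wr

other-vertex : ∀ {n} (r : Fin (suc (suc n))) → ∃ λ v → v ≢ r
other-vertex zero = suc zero , λ ()
other-vertex (suc _) = zero , λ ()

-- Leaves other than `r` are peeled off until `r` alone remains; `far-leaf` supplies one at every
-- stage.
ranked : ∀ n (T : Graph (suc n)) → IsTree T → ∀ r → Ranked T r
ranked zero T tree zero = record
  { rank = λ _ → 0
  ; levels = λ { {zero} {zero} e → contradiction (trans (sym (proj₂ (proj₁ tree) zero)) e) λ () }
  ; parent-unique = λ _ ()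
  ; parent = λ { {zero} x≢x → contradiction refl x≢x }
  ; rank≤root = λ _ → z≤n }
ranked (suc n) T tree r
  with FarLeaf.far-leaf (proj₁ tree) (proj₂ (proj₂ tree)) r (proj₂ (neighbor tree (proj₂ (other-vertex r))))
... | ℓ , ℓ≢r , p , ℓp , only = subst (Ranked T) (punchIn-punchOut ℓ≢r) (extend-rank (ranked n T′ tree′ (punchOut ℓ≢r)))
  where open RemoveLeaf tree ℓp only

-- All that the converse knows about the tree. `top` is the only neighbor of the leaf `root`.
record Rooted {n} (T : Graph n) : Set where
  field
    symmetric : ∀ {x y} → Adj T x y → Adj T y x
    root top  : Fin n
    root-top  : Adj T root top
    top-only  : ∀ {y} → Adj T root y → y ≡ top
    isRanked  : Ranked T root
  open Ranked isRanked public

rooted : ∀ {n} {T : Graph n} → IsTree T → 2 ≤ n → Rooted T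
rooted {suc (suc n)} {T} tree _
  with FarLeaf.far-leaf (proj₁ tree) (proj₂ (proj₂ tree)) zero (proj₂ (neighbor tree {suc zero} λ ()))
... | ℓ , _ , p , ℓp , only = record
  { symmetric = λ {x} {y} xy → trans (proj₁ (proj₁ tree) y x) xy
  ; root = ℓ ; top = p ; root-top = ℓp ; top-only = λ {y} ℓy → sym (only y ℓy)
  ; isRanked = ranked (suc n) T tree ℓ }
rooted {suc zero} _ (s≤s ())

-- Removing vertices

_∈ₗ?_ : ∀ {n} (x : Fin n) xs → Dec (x ∈ₗ xs)
_∈ₗ?_ = ∈ₗ?-with _≟_

lookup-injective : ∀ {A : Set} {xs : List A} → Unique xs → ∀ {i j} → lookup xs i ≡ lookup xs j → i ≡ j
lookup-injective (_ ∷ _) {zero} {zero} _ = refl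
lookup-injective (x∉ ∷ _) {zero} {suc j} eq = contradiction eq (All.lookup x∉ (∈-lookup j))
lookup-injective (x∉ ∷ _) {suc i} {zero} eq = contradiction (sym eq) (All.lookup x∉ (∈-lookup i))
lookup-injective (_ ∷ u) {suc i} {suc j} eq = cong suc (lookup-injective u eq)

-- An enumeration of the vertices outside `xs`, turning the part that remains after a removal into a
-- graph on some `Fin m`.
record Complement {n} (xs : List (Fin n)) : Set where
  field
    m           : ℕ
    ι           : Fin m → Fin n
    ι-injective : ∀ {a b} → ι a ≡ ι b → a ≡ b
    ι∉          : ∀ a → ι a ∉ₗ xs
    locate      : ∀ {x} → x ∉ₗ xs → ∃ λ a → ι a ≡ x
    size        : m + length xs ≡ n

abstract
  complement : ∀ {n} {xs : List (Fin n)} → Unique xs → Complement xs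
  complement {n} [] = record
    { m = n ; ι = λ x → x ; ι-injective = λ eq → eq ; ι∉ = λ _ () ; locate = λ {x} _ → x , refl ; size = ℕ.+-identityʳ n }
  complement {n} {x ∷ xs} (x∉ ∷ u) with complement u
  ... | record { m = m ; ι = ι ; ι-injective = ι-injective ; ι∉ = ι∉ ; locate = locate ; size = size }
    with locate (λ x∈ → All.lookup x∉ x∈ refl)
  complement {n} {x ∷ xs} (x∉ ∷ u) | record { m = suc m ; ι = ι ; ι-injective = ι-injective ; ι∉ = ι∉ ; locate = locate ; size = size }
    | a₀ , refl = record
    { m = m
    ; ι = ι ∘ punchIn a₀
    ; ι-injective = punchIn-injective a₀ _ _ ∘ ι-injective
    ; ι∉ = λ where
        a (here eq) → punchInᵢ≢i a₀ a (ι-injective eq)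
        a (there y∈) → ι∉ _ y∈
    ; locate = locate′
    ; size = trans (ℕ.+-suc m _) size }
    where
    locate′ : ∀ {y} → y ∉ₗ (ι a₀ ∷ xs) → ∃ λ a → ι (punchIn a₀ a) ≡ y
    locate′ y∉ with locate (y∉ ∘ there)
    ... | a , refl = punchOut a₀≢a , cong ι (punchIn-punchOut a₀≢a)
      where
      a₀≢a : a₀ ≢ a
      a₀≢a refl = y∉ (here refl)

module ExtendIso {n} {T : Graph n} (symmetric : ∀ {x y} → Adj T x y → Adj T y x)
  {xs : List (Fin n)} (u : Unique xs) (C : Complement xs) where
  open Complement C

  side : Fin m ⊎ Fin (length xs) → Fin n
  side (inj₁ a) = ι a
  side (inj₂ j) = lookup xs j

  place : Fin n → Fin m ⊎ Fin (length xs)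
  place x with x ∈ₗ? xs
  ... | yes x∈ = inj₂ (index x∈)
  ... | no x∉ = inj₁ (proj₁ (locate x∉))

  side-place : ∀ x → side (place x) ≡ x
  side-place x with x ∈ₗ? xs
  ... | yes x∈ = sym (lookup-index x∈)
  ... | no x∉ = proj₂ (locate x∉)

  place-side : ∀ s → place (side s) ≡ s
  place-side (inj₁ a) with ι a ∈ₗ? xs
  ... | yes a∈ = contradiction a∈ (ι∉ a)
  ... | no a∉ = cong inj₁ (ι-injective (proj₂ (locate a∉)))
  place-side (inj₂ j) with lookup xs j ∈ₗ? xs
  ... | yes j∈ = cong inj₂ (lookup-injective u (sym (lookup-index j∈)))
  ... | no j∉ = contradiction (∈-lookup j) j∉

  -- The list fixes the identification: its entry at position `j` plays the new vertex `j` of the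
  -- operation. `N` may list each new edge in one direction only.
  extend-iso : ∀ {O E N} → (∀ a b → T (ι a) (ι b) ≡ O a b) →
    (∀ j a → E j a ≡ true → Adj T (lookup xs j) (ι a)) →
    (∀ j a → Adj T (lookup xs j) (ι a) → E j a ≡ true) →
    (∀ i j → N i j ≡ true → Adj T (lookup xs i) (lookup xs j)) →
    (∀ i j → Adj T (lookup xs i) (lookup xs j) → N i j ∨ N j i ≡ true) →
    Iso (extend (length xs) O E N) T
  extend-iso {O} {E} {N} old E⁺ E⁻ N⁺ N⁻ =
    mk↔ₛ′ (side ∘ splitAt m) (join m _ ∘ place)
      (λ x → trans (cong side (splitAt-join m _ (place x))) (side-place x))
      (λ x → trans (cong (join m _) (place-side (splitAt m x))) (join-splitAt m _ x))
    , λ x y → trans (sides (splitAt m x) (splitAt m y)) (sym (extend≡sumGraph {m} (length xs) x y))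
    where
    N⁺′ : ∀ i j → N i j ∨ N j i ≡ true → Adj T (lookup xs i) (lookup xs j)
    N⁺′ i j eq with N i j in Nij
    ... | true = N⁺ i j Nij
    ... | false = symmetric (N⁺ j i eq)
    sides : ∀ s t → T (side s) (side t) ≡ sumGraph O E N s t
    sides (inj₁ a) (inj₁ b) = old a b
    sides (inj₁ a) (inj₂ j) = ⇔→≡ (mk⇔ (E⁻ j a ∘ symmetric) (symmetric ∘ E⁺ j a))
    sides (inj₂ i) (inj₁ b) = ⇔→≡ (mk⇔ (E⁻ i b) (E⁺ i b))
    sides (inj₂ i) (inj₂ j) = ⇔→≡ (mk⇔ (N⁻ i j) (N⁺′ i j))

induced : ∀ {n m} → Graph n → (Fin m → Fin n) → Graph m
induced T ι a b = T (ι a) (ι b)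

module _ {n} {T : Graph n} {xs : List (Fin n)} (C : Complement xs) where
  open Complement C

  -- Only the existence of parents can fail under restriction, hence the condition that parents of
  -- kept vertices are kept.
  rooted-induced : (R : Rooted T) (let open Rooted R) → root ∉ₗ xs → top ∉ₗ xs →
    (∀ {x y} → x ∉ₗ xs → Adj T x y → rank x < rank y → y ∉ₗ xs) → Rooted (induced T ι)
  rooted-induced R root∉ top∉ closed with locate (root∉) | locate (top∉)
    where open Rooted R
  ... | r , refl | t , refl = record
    { symmetric = symmetric ; root = r ; top = t ; root-top = root-top
    ; top-only = ι-injective ∘ top-only
    ; isRanked = record
      { rank = rank ∘ ι ; levels = levels
      ; parent-unique = λ xy lt xz lt′ → ι-injective (parent-unique xy lt xz lt′)
      ; parent = parent′ ; rank≤root = rank≤root ∘ ι } }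
    where
    open Rooted R
    parent′ : ∀ {x} → x ≢ r → ∃ λ y → Adj T (ι x) (ι y) × rank (ι x) < rank (ι y)
    parent′ {x} x≢r with parent (x≢r ∘ ι-injective)
    ... | y , xy , lt with locate (closed (ι∉ x) xy lt)
    ... | y′ , refl = y′ , xy , lt

  -- The second condition concerns only vertices that keep two neighbors: a vertex turned into a
  -- leaf may lose the force it made. The other two say that no kept vertex loses its forcer and
  -- that every kept start has a kept companion.
  cover-induced : (cover : ChainCover T) (let open ChainCover cover) →
    (∀ {u w} → u ⇝ w → w ∉ₗ xs → u ∉ₗ xs) →
    (∀ {u a b w} → u ∉ₗ xs → a ∉ₗ xs → b ∉ₗ xs → Adj T u a → Adj T u b → a ≢ b → u ⇝ w → w ∉ₗ xs) →
    (∀ {v} → v ∉ₗ xs → Start v → ∃ λ u → u ∉ₗ xs × Adj T v u × Start u) →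
    ChainCover (induced T ι)
  cover-induced cover back ahead company = record
    { _⇝_ = λ a b → ι a ⇝ ι b
    ; edge = edge
    ; functional = λ r r′ → ι-injective (functional r r′)
    ; injective = λ r r′ → ι-injective (injective r r′)
    ; asym = asym
    ; forced? = forced?′
    ; continue = continue′
    ; accompanied = accompanied′ }
    where
    open ChainCover cover
    forced?′ : ∀ b → (∃ λ a → ι a ⇝ ι b) ⊎ (∀ {a} → ¬ ι a ⇝ ι b)
    forced?′ b with forced? (ι b)
    ... | inj₂ s = inj₂ s
    ... | inj₁ (u , r) with locate (back r (ι∉ b))
    ... | a , refl = inj₁ (a , r)
    continue′ : ∀ {u a b} → Adj T (ι u) (ι a) → Adj T (ι u) (ι b) → a ≢ b → ∃ λ w → ι u ⇝ ι w
    continue′ {u} {a} {b} ua ub a≢b with continue ua ub (a≢b ∘ ι-injective)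
    ... | w , r with locate (ahead (ι∉ u) (ι∉ a) (ι∉ b) ua ub (a≢b ∘ ι-injective) r)
    ... | w′ , refl = w′ , r
    accompanied′ : ∀ {v} → (∀ {a} → ¬ ι a ⇝ ι v) → ∃ λ u → Adj T (ι v) (ι u) × (∀ {a} → ¬ ι a ⇝ ι u)
    accompanied′ {v} s with company (ι∉ v) start
      where
      start : Start (ι v)
      start r with locate (back r (ι∉ v))
      ... | a , refl = s r
    ... | u , u∉ , vu , s′ with locate u∉
    ... | u′ , refl = u′ , vu , s′

-- Undoing O1 to O5 in a rooted tree

Smaller : ℕ → Set₁
Smaller n = ∀ {m} {T : Graph m} → m < n → Rooted T → ChainCover T → InF T

complement-< : ∀ {n x} {xs : List (Fin n)} (C : Complement (x ∷ xs)) → Complement.m C < n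
complement-< {xs = xs} C = subst (_≤_ (suc m)) (trans (sym (ℕ.+-suc m (length xs))) size) (s≤s (ℕ.m≤m+n m _))
  where open Complement C

Only : ∀ {n} → Graph n → Fin n → Fin n → Set
Only T x y = Adj T x y × (∀ {z} → Adj T x z → z ≡ y)

only⇒leaf : ∀ {n} {T : Graph n} {x y} → Only T x y → IsLeaf T x
only⇒leaf {T = T} (xy , only) = atMostOne⇒leaf {G = T} xy (λ xa xb → trans (only xa) (sym (only xb)))

∉-[] : ∀ {A : Set} {x a : A} → x ≢ a → x ∉ₗ (a ∷ [])
∉-[] x≢a (here eq) = x≢a eq

Below : ∀ {n} {T : Graph n} → Rooted T → Fin n → Fin n → Set
Below R x y = Rooted.rank R x < Rooted.rank R y

module RootedFacts {n} {T : Graph n} (R : Rooted T) where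
  open Rooted R

  irrefl : ∀ {x} → ¬ Adj T x x
  irrefl xx = levels xx refl

  <⇒≢ : ∀ {x y} → rank x < rank y → x ≢ y
  <⇒≢ lt refl = ℕ.<-irrefl refl lt

  <⇒≢root : ∀ {x y} → rank x < rank y → x ≢ root
  <⇒≢root {y = y} lt refl = ℕ.<⇒≱ lt (rank≤root y)

  <⇒≢top : ∀ {x y} → Adj T x y → rank x < rank y → y ≢ root → x ≢ top
  <⇒≢top xy lt y≢root refl = y≢root (parent-unique xy lt (symmetric root-top)
    (ℕ.≤∧≢⇒< (rank≤root top) (levels (symmetric root-top))))

  child-< : ∀ {x y c} → Adj T x y → rank x < rank y → Adj T x c → c ≢ y → rank c < rank x
  child-< {x} {y} {c} xy lt xc c≢y with ℕ.<-cmp (rank x) (rank c)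
  ... | tri< x<c _ _ = contradiction (parent-unique xc x<c xy lt) c≢y
  ... | tri≈ _ eq _ = contradiction eq (levels xc)
  ... | tri> _ _ c<x = c<x

module CoverFacts {n} {T : Graph n} (R : Rooted T) (cover : ChainCover T) where
  open Rooted R
  open ChainCover cover

  forced-by-only : ∀ {a p x} → Only T a p → x ⇝ a → x ≡ p
  forced-by-only (_ , only) r = only (symmetric (edge r))

  only-start : ∀ {a p} → Only T a p → Start a → Start p
  only-start (_ , only) s r with accompanied s
  ... | x , ax , sx with only ax
  ... | refl = sx r

  -- `p` forces at most one of its two leaves, and nothing else can force them.
  spare : ∀ {a b p} → a ≢ b → Only T a p → Only T b p → Start a ⊎ Start b
  spare {a} {b} a≢b oa ob with forced? a
  ... | inj₂ s = inj₁ s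
  ... | inj₁ (u , r) with forced-by-only oa r
  ... | refl = inj₂ λ r′ → a≢b (functional r (subst (_⇝ b) (forced-by-only ob r′) r′))

  support-start : ∀ {a b p} → a ≢ b → Only T a p → Only T b p → Start p
  support-start a≢b oa ob with spare a≢b oa ob
  ... | inj₁ s = only-start oa s
  ... | inj₂ s = only-start ob s

module Reduce {n} {T : Graph n} (R : Rooted T) (cover : ChainCover T) (smaller : Smaller n) where
  open Rooted R
  open RootedFacts R
  open ChainCover cover
  open CoverFacts R cover

  -- `a` and `b` keep `p` a strong support. If the deleted start `ℓ` accompanied `p`, one of `a` and
  -- `b` is a start and replaces it.
  undo-O2 : ∀ {p ℓ a b} → Only T ℓ p → rank ℓ < rank p → p ≢ root → Only T a p → Only T b p →
    a ≢ b → a ≢ ℓ → b ≢ ℓ → Start ℓ → InF T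
  undo-O2 {p} {ℓ} {a} {b} oℓ ℓ<p p≢root oa ob a≢b a≢ℓ b≢ℓ s
    with locate (∉-[] a≢ℓ) | locate (∉-[] b≢ℓ) | locate (∉-[] {x = p} (<⇒≢ ℓ<p ∘ sym))
    where open Complement (complement {xs = ℓ ∷ []} ([] ∷ []))
  ... | a′ , refl | b′ , refl | p′ , refl = iso
    (o2 (smaller (complement-< C) rooted′ cover′)
      (a′ , b′ , a≢b ∘ cong ι , symmetric (proj₁ oa) , symmetric (proj₁ ob) , leaf a′ oa , leaf b′ ob))
    (ExtendIso.extend-iso symmetric ([] ∷ []) C (λ _ _ → refl)
      (λ { zero v e → subst (λ v → Adj T ℓ (ι v)) (sym (==⇒≡ e)) (proj₁ oℓ) })
      (λ { zero v e → subst (λ v → (v == p′) ≡ true) (sym (ι-injective (proj₂ oℓ e))) (≡⇒== p′) })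
      (λ { zero zero () })
      (λ { zero zero e → contradiction e irrefl }))
    where
    C = complement {xs = ℓ ∷ []} ([] ∷ [])
    open Complement C
    leaf : ∀ x → Only T (ι x) (ι p′) → IsLeaf (induced T ι) x
    leaf x o = only⇒leaf {T = induced T ι} (proj₁ o , ι-injective ∘ proj₂ o)
    rooted′ : Rooted (induced T ι)
    rooted′ = rooted-induced C R (∉-[] (<⇒≢root ℓ<p ∘ sym)) (∉-[] (<⇒≢top (proj₁ oℓ) ℓ<p p≢root ∘ sym))
      λ { _ xy lt (here refl) → ℕ.<-asym ℓ<p (subst (λ x → rank x < rank ℓ) (proj₂ oℓ (symmetric xy)) lt) }
    start-p : Start (ι p′)
    start-p = support-start a≢b oa ob
    cover′ : ChainCover (induced T ι)
    cover′ = cover-induced C cover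
      (λ { r _ (here refl) → start-p (subst (ℓ ⇝_) (proj₂ oℓ (edge r)) r) })
      (λ { _ _ _ _ _ _ r (here refl) → s r })
      company
      where
      company : ∀ {v} → v ∉ₗ (ℓ ∷ []) → Start v → ∃ λ u → u ∉ₗ (ℓ ∷ []) × Adj T v u × Start u
      company {v} v∉ sv with accompanied sv
      ... | u , vu , su with u ≟ ℓ
      ... | no u≢ℓ = u , ∉-[] u≢ℓ , vu , su
      ... | yes refl with proj₂ oℓ (symmetric vu) | spare a≢b oa ob
      ... | refl | inj₁ sa = ι a′ , ι∉ a′ , symmetric (proj₁ oa) , sa
      ... | refl | inj₂ sb = ι b′ , ι∉ b′ , symmetric (proj₁ ob) , sb

  -- Without `a` and `b`, `p` is a leaf, so its force into one of them is no longer demanded;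
  -- together with `c` it makes `x` a strong support. The start `x` replaces a deleted companion of
  -- `p`.
  undo-O3 : ∀ {x p a b c} → Adj T p x → rank p < rank x → a ≢ b → Only T a p → Only T b p →
    rank a < rank p → rank b < rank p → (∀ {z} → Adj T p z → z ∈ₗ (x ∷ a ∷ b ∷ [])) →
    Start x → Only T c x → c ≢ p → InF T
  undo-O3 {x} {p} {a} {b} {c} px p<x a≢b oa ob a<p b<p p-nbrs sx oc c≢p
    with locate x∉ | locate p∉ | locate c∉
    where
    open Complement (complement {xs = a ∷ b ∷ []} ((a≢b ∷ []) ∷ [] ∷ []))
    x∉ : x ∉ₗ (a ∷ b ∷ [])
    x∉ (here refl) = ℕ.<-asym a<p p<x
    x∉ (there (here refl)) = ℕ.<-asym b<p p<x
    p∉ : p ∉ₗ (a ∷ b ∷ [])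
    p∉ (here refl) = ℕ.<-irrefl refl a<p
    p∉ (there (here refl)) = ℕ.<-irrefl refl b<p
    c∉ : c ∉ₗ (a ∷ b ∷ [])
    c∉ (here refl) = <⇒≢ p<x (proj₂ oc (proj₁ oa))
    c∉ (there (here refl)) = <⇒≢ p<x (proj₂ oc (proj₁ ob))
  ... | x′ , refl | p′ , refl | c′ , refl = iso
    (o3 (smaller (complement-< C) rooted′ cover′)
      (p′ , c′ , (λ eq → c≢p (cong ι (sym eq))) , symmetric px , symmetric (proj₁ oc) , leaf-p
        , only⇒leaf {T = induced T ι} (proj₁ oc , ι-injective ∘ proj₂ oc))
      (symmetric px) leaf-p)
    (ExtendIso.extend-iso symmetric unique C (λ _ _ → refl)
      (λ where
        zero v e → subst (λ v → Adj T a (ι v)) (sym (==⇒≡ e)) (proj₁ oa)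
        (suc zero) v e → subst (λ v → Adj T b (ι v)) (sym (==⇒≡ e)) (proj₁ ob))
      (λ where
        zero v e → subst (λ v → (v == p′) ≡ true) (sym (ι-injective (proj₂ oa e))) (≡⇒== p′)
        (suc zero) v e → subst (λ v → (v == p′) ≡ true) (sym (ι-injective (proj₂ ob e))) (≡⇒== p′))
      (λ _ _ ())
      (λ where
        zero zero e → contradiction e irrefl
        zero (suc zero) e → contradiction (sym (proj₂ oa e)) (<⇒≢ b<p ∘ sym)
        (suc zero) zero e → contradiction (sym (proj₂ ob e)) (<⇒≢ a<p ∘ sym)
        (suc zero) (suc zero) e → contradiction e irrefl))
    where
    unique : Unique (a ∷ b ∷ [])
    unique = (a≢b ∷ []) ∷ [] ∷ []
    C = complement unique
    open Complement C
    p-only : ∀ {z} → z ∉ₗ (a ∷ b ∷ []) → Adj T (ι p′) z → z ≡ ι x′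
    p-only z∉ pz with p-nbrs pz
    ... | here eq = eq
    ... | there z∈ = contradiction z∈ z∉
    leaf-p : IsLeaf (induced T ι) p′
    leaf-p = only⇒leaf {T = induced T ι} {p′} {x′} (px , λ {z} pz → ι-injective (p-only (ι∉ z) pz))
    p≢root = <⇒≢root p<x
    rooted′ : Rooted (induced T ι)
    rooted′ = rooted-induced C R
      (λ { (here eq) → <⇒≢root a<p (sym eq) ; (there (here eq)) → <⇒≢root b<p (sym eq) })
      (λ { (here eq) → <⇒≢top (proj₁ oa) a<p p≢root (sym eq)
         ; (there (here eq)) → <⇒≢top (proj₁ ob) b<p p≢root (sym eq) })
      λ where
        _ xy lt (here refl) → ℕ.<-asym a<p (subst (λ x → rank x < rank a) (proj₂ oa (symmetric xy)) lt)
        _ xy lt (there (here refl)) → ℕ.<-asym b<p (subst (λ x → rank x < rank b) (proj₂ ob (symmetric xy)) lt)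
    start-p : Start (ι p′)
    start-p = support-start a≢b oa ob
    cover′ : ChainCover (induced T ι)
    cover′ = cover-induced C cover
      (λ where
        r _ (here refl) → start-p (subst (a ⇝_) (proj₂ oa (edge r)) r)
        r _ (there (here refl)) → start-p (subst (b ⇝_) (proj₂ ob (edge r)) r))
      ahead company
      where
      ahead : ∀ {u v v₁ w} → u ∉ₗ (a ∷ b ∷ []) → v ∉ₗ (a ∷ b ∷ []) → v₁ ∉ₗ (a ∷ b ∷ []) →
        Adj T u v → Adj T u v₁ → v ≢ v₁ → u ⇝ w → w ∉ₗ (a ∷ b ∷ [])
      ahead _ v∉ v₁∉ uv uv₁ v≢v₁ r (here refl) with forced-by-only oa r
      ... | refl = v≢v₁ (trans (p-only v∉ uv) (sym (p-only v₁∉ uv₁)))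
      ahead _ v∉ v₁∉ uv uv₁ v≢v₁ r (there (here refl)) with forced-by-only ob r
      ... | refl = v≢v₁ (trans (p-only v∉ uv) (sym (p-only v₁∉ uv₁)))
      company : ∀ {v} → v ∉ₗ (a ∷ b ∷ []) → Start v → ∃ λ u → u ∉ₗ (a ∷ b ∷ []) × Adj T v u × Start u
      company {v} v∉ sv with accompanied sv
      ... | u , vu , su with u ∈ₗ? (a ∷ b ∷ [])
      ... | no u∉ = u , u∉ , vu , su
      ... | yes (here refl) with proj₂ oa (symmetric vu)
      ... | refl = ι x′ , ι∉ x′ , px , sx
      company v∉ sv | u , vu , su | yes (there (here refl)) with proj₂ ob (symmetric vu)
      ... | refl = ι x′ , ι∉ x′ , px , sx

  -- `p` is a start by its two leaves, so with `¬ p ⇝ x` no force crosses the removed edge. `p` may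
  -- have accompanied `x`, which therefore needs another start; `d` and `e` keep the degree of `x`
  -- at least 2.
  undo-O4 : ∀ {x p a b d e} → x ≢ root → Adj T p x → rank p < rank x → a ≢ b → Only T a p → Only T b p →
    rank a < rank p → rank b < rank p → (∀ {z} → Adj T p z → z ∈ₗ (x ∷ a ∷ b ∷ [])) →
    ¬ p ⇝ x → (Start x → ∃ λ s → s ≢ p × Adj T x s × Start s) →
    Adj T x d → Adj T x e → d ≢ e → d ≢ p → e ≢ p → InF T
  undo-O4 {x} {p} {a} {b} {d} {e} x≢root px p<x a≢b oa ob a<p b<p p-nbrs ¬p⇝x company-x xd xe d≢e d≢p e≢p
    with locate x∉ | locate (x-kept xd d≢p) | locate (x-kept xe e≢p)
    where
    open Complement (complement {xs = a ∷ p ∷ b ∷ []} ((<⇒≢ a<p ∷ a≢b ∷ []) ∷ (<⇒≢ b<p ∘ sym ∷ []) ∷ [] ∷ []))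
    x∉ : x ∉ₗ (a ∷ p ∷ b ∷ [])
    x∉ (here refl) = ℕ.<-asym a<p p<x
    x∉ (there (here refl)) = ℕ.<-irrefl refl p<x
    x∉ (there (there (here refl))) = ℕ.<-asym b<p p<x
    x-kept : ∀ {s} → Adj T x s → s ≢ p → s ∉ₗ (a ∷ p ∷ b ∷ [])
    x-kept xs s≢p (here refl) = <⇒≢ p<x (sym (proj₂ oa (symmetric xs)))
    x-kept xs s≢p (there (here refl)) = s≢p refl
    x-kept xs s≢p (there (there (here refl))) = <⇒≢ p<x (sym (proj₂ ob (symmetric xs)))
  ... | x′ , refl | d′ , refl | e′ , refl = iso
    (o4 (smaller (complement-< C) rooted′ cover′) (two≤deg {G = induced T ι} (d≢e ∘ cong ι) xd xe))
    (ExtendIso.extend-iso symmetric unique C (λ _ _ → refl)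
      (λ where
        zero v ()
        (suc zero) v eq → subst (λ v → Adj T p (ι v)) (sym (==⇒≡ eq)) px
        (suc (suc zero)) v ())
      E⁻
      (λ where
        zero (suc zero) _ → proj₁ oa
        (suc zero) (suc (suc zero)) _ → symmetric (proj₁ ob)
        zero zero ()
        zero (suc (suc zero)) ()
        (suc zero) zero ()
        (suc zero) (suc zero) ()
        (suc (suc zero)) zero ()
        (suc (suc zero)) (suc zero) ()
        (suc (suc zero)) (suc (suc zero)) ())
      (λ where
        zero zero ij → contradiction ij irrefl
        zero (suc zero) ij → refl
        zero (suc (suc zero)) ij → contradiction (proj₂ oa ij) (<⇒≢ b<p)
        (suc zero) zero ij → refl
        (suc zero) (suc zero) ij → contradiction ij irrefl
        (suc zero) (suc (suc zero)) ij → refl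
        (suc (suc zero)) zero ij → contradiction (proj₂ ob ij) (<⇒≢ a<p)
        (suc (suc zero)) (suc zero) ij → refl
        (suc (suc zero)) (suc (suc zero)) ij → contradiction ij irrefl))
    where
    removed = a ∷ p ∷ b ∷ []
    unique : Unique removed
    unique = (<⇒≢ a<p ∷ a≢b ∷ []) ∷ (<⇒≢ b<p ∘ sym ∷ []) ∷ [] ∷ []
    C = complement unique
    open Complement C
    p≢root = <⇒≢root p<x
    a∈ : a ∈ₗ removed
    a∈ = here refl
    p∈ : p ∈ₗ removed
    p∈ = there (here refl)
    b∈ : b ∈ₗ removed
    b∈ = there (there (here refl))
    p-outer : ∀ {z} → z ∉ₗ removed → Adj T p z → z ≡ ι x′
    p-outer z∉ pz with p-nbrs pz
    ... | here eq = eq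
    ... | there (here refl) = contradiction a∈ z∉
    ... | there (there (here refl)) = contradiction b∈ z∉
    x-kept : ∀ {s} → Adj T (ι x′) s → s ≢ p → s ∉ₗ removed
    x-kept xs s≢p (here refl) = <⇒≢ p<x (sym (proj₂ oa (symmetric xs)))
    x-kept xs s≢p (there (here refl)) = s≢p refl
    x-kept xs s≢p (there (there (here refl))) = <⇒≢ p<x (sym (proj₂ ob (symmetric xs)))
    E⁻ : ∀ (j : Fin 3) v → Adj T (lookup removed j) (ι v) → (j == suc zero ∧ v == x′) ≡ true
    E⁻ zero v av = contradiction (subst (_∈ₗ removed) (sym (proj₂ oa av)) p∈) (ι∉ v)
    E⁻ (suc zero) v pv = subst (λ v → (v == x′) ≡ true) (sym (ι-injective (p-outer (ι∉ v) pv))) (≡⇒== x′)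
    E⁻ (suc (suc zero)) v bv = contradiction (subst (_∈ₗ removed) (sym (proj₂ ob bv)) p∈) (ι∉ v)
    rooted′ : Rooted (induced T ι)
    rooted′ = rooted-induced C R
      (λ { (here eq) → <⇒≢root a<p (sym eq) ; (there (here eq)) → p≢root (sym eq)
         ; (there (there (here eq))) → <⇒≢root b<p (sym eq) })
      (λ { (here eq) → <⇒≢top (proj₁ oa) a<p p≢root (sym eq)
         ; (there (here eq)) → <⇒≢top px p<x x≢root (sym eq)
         ; (there (there (here eq))) → <⇒≢top (proj₁ ob) b<p p≢root (sym eq) })
      λ where
        _ xy lt (here refl) → ℕ.<-asym a<p (subst (λ x → rank x < rank a) (proj₂ oa (symmetric xy)) lt)
        x∉ xy lt (there (here refl)) → ℕ.<-asym p<x (subst (λ x → rank x < rank p) (p-outer x∉ (symmetric xy)) lt)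
        _ xy lt (there (there (here refl))) → ℕ.<-asym b<p (subst (λ x → rank x < rank b) (proj₂ ob (symmetric xy)) lt)
    start-p : Start p
    start-p = support-start a≢b oa ob
    cover′ : ChainCover (induced T ι)
    cover′ = cover-induced C cover
      (λ where
        r _ (here refl) → start-p (subst (a ⇝_) (proj₂ oa (edge r)) r)
        r w∉ (there (here refl)) → ¬p⇝x (subst (p ⇝_) (p-outer w∉ (edge r)) r)
        r _ (there (there (here refl))) → start-p (subst (b ⇝_) (proj₂ ob (edge r)) r))
      (λ where
        u∉ _ _ _ _ _ r (here refl) → u∉ (subst (_∈ₗ removed) (sym (forced-by-only oa r)) p∈)
        _ _ _ _ _ _ r (there (here refl)) → start-p r
        u∉ _ _ _ _ _ r (there (there (here refl))) → u∉ (subst (_∈ₗ removed) (sym (forced-by-only ob r)) p∈))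
      company
      where
      company : ∀ {v} → v ∉ₗ removed → Start v → ∃ λ u → u ∉ₗ removed × Adj T v u × Start u
      company {v} v∉ sv with accompanied sv
      ... | u , vu , su with u ∈ₗ? removed
      ... | no u∉ = u , u∉ , vu , su
      ... | yes (here refl) = contradiction (subst (_∈ₗ removed) (sym (proj₂ oa (symmetric vu))) p∈) v∉
      ... | yes (there (there (here refl))) = contradiction (subst (_∈ₗ removed) (sym (proj₂ ob (symmetric vu))) p∈) v∉
      ... | yes (there (here refl)) with p-outer v∉ (symmetric vu)
      ... | refl with company-x sv
      ... | s , s≢p , xs , ss = s , x-kept xs s≢p , xs , ss

-- The cover is rigid here. `p` is a start, so `g` must force `x`; then `x` is no start, so its leaf
-- `c` is not one either and `x` forces `c`. Hence the edge from `x` to `y` carries no force, and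
-- `x` accompanies no start.
module UndoO5 {n} {T : Graph n} (R : Rooted T) (cover : ChainCover T) (smaller : Smaller n)
  {y x c g p a b : Fin n}
  (xy : Adj T x y) (x<y : Below R x y) (oc : Only T c x) (c<x : Below R c x) (c≢g : c ≢ g)
  (gx : Adj T g x) (g<x : Below R g x) (pg : Adj T p g) (p<g : Below R p g)
  (a≢b : a ≢ b) (oa : Only T a p) (ob : Only T b p) (a<p : Below R a p) (b<p : Below R b p)
  (x-nbrs : ∀ {z} → Adj T x z → z ∈ₗ (y ∷ c ∷ g ∷ []))
  (g-nbrs : ∀ {z} → Adj T g z → z ∈ₗ (x ∷ p ∷ []))
  (p-nbrs : ∀ {z} → Adj T p z → z ∈ₗ (g ∷ a ∷ b ∷ [])) where
  open Rooted R
  open RootedFacts R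
  open ChainCover cover
  open CoverFacts R cover

  start-p : Start p
  start-p = support-start a≢b oa ob

  g⇝x : g ⇝ x
  g⇝x with continue gx (symmetric pg) (<⇒≢ (ℕ.<-trans p<g g<x) ∘ sym)
  ... | w , r with g-nbrs (edge r)
  ... | here refl = r
  ... | there (here refl) = contradiction r start-p

  x⇝c : x ⇝ c
  x⇝c with forced? c
  ... | inj₁ (u , r) = subst (_⇝ c) (forced-by-only oc r) r
  ... | inj₂ s = contradiction g⇝x (only-start oc s)

  ¬x⇝y : ¬ x ⇝ y
  ¬x⇝y r = <⇒≢ (ℕ.<-trans c<x x<y) (functional x⇝c r)

  ¬y⇝x : ¬ y ⇝ x
  ¬y⇝x r = <⇒≢ (ℕ.<-trans g<x x<y) (injective g⇝x r)

  -- Since x is forced by g and forces c, the vertex y needs, apart from xy, an outgoing edge and either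
  -- an incoming edge or an adjacent start.
  others : ∃ λ d → ∃ λ e → d ≢ e × x ≢ d × x ≢ e × Adj T y d × Adj T y e
  others with another T y x
  ... | inj₂ only = ⊥-elim (no-start (accompanied start-y))
    where
    start-y : Start y
    start-y r = ¬x⇝y (subst (_⇝ y) (sym (only _ (symmetric (edge r)))) r)
    no-start : ¬ ∃ λ u → Adj T y u × Start u
    no-start (u , yu , su) = su (subst (g ⇝_) (only u yu) g⇝x)
  ... | inj₁ (d , x≢d , yd) with search {P = λ e → d ≢ e × x ≢ e × Adj T y e}
    {λ e → Adj T y e → d ≡ e ⊎ x ≡ e} third
    where
    third : ∀ e → (d ≢ e × x ≢ e × Adj T y e) ⊎ (Adj T y e → d ≡ e ⊎ x ≡ e)
    third e with d ≟ e | x ≟ e | T y e in eq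
    ... | yes p | _ | _ = inj₂ λ _ → inj₁ p
    ... | no _ | yes p | _ = inj₂ λ _ → inj₂ p
    ... | no d≢e | no x≢e | true = inj₁ (d≢e , x≢e , refl)
    ... | no _ | no _ | false = inj₂ λ ()
  ... | inj₁ (e , d≢e , x≢e , ye) = d , e , d≢e , x≢d , x≢e , yd , ye
  ... | inj₂ none = ⊥-elim (no-start (accompanied start-y))
    where
    y⇝d : y ⇝ d
    y⇝d with continue (symmetric xy) yd x≢d
    ... | w , r with none w (edge r)
    ... | inj₁ refl = r
    ... | inj₂ refl = contradiction r ¬y⇝x
    start-y : Start y
    start-y {u} r with none u (symmetric (edge r))
    ... | inj₁ refl = asym y⇝d r
    ... | inj₂ refl = ¬x⇝y r
    no-start : ¬ ∃ λ u → Adj T y u × Start u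
    no-start (u , yu , su) with none u yu
    ... | inj₁ refl = su y⇝d
    ... | inj₂ refl = su g⇝x

  y≢root : y ≢ root
  y≢root refl with others
  ... | d , e , d≢e , _ , _ , yd , ye = d≢e (trans (top-only yd) (sym (top-only ye)))

  -- In the order of the new vertices of O5: `u₁`, `v₁`, `v₂`, `v₃`, `v₄`, `u₃`.
  removed : List (Fin n)
  removed = c ∷ x ∷ g ∷ p ∷ a ∷ b ∷ []

  p<x = ℕ.<-trans p<g g<x
  a<g = ℕ.<-trans a<p p<g
  b<g = ℕ.<-trans b<p p<g

  unique : Unique removed
  unique = (<⇒≢ c<x ∷ c≢g ∷ (λ { refl → <⇒≢ g<x (proj₂ oc pg) })
      ∷ (λ { refl → <⇒≢ p<x (proj₂ oc (proj₁ oa)) }) ∷ (λ { refl → <⇒≢ p<x (proj₂ oc (proj₁ ob)) }) ∷ [])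
    ∷ (<⇒≢ g<x ∘ sym ∷ <⇒≢ p<x ∘ sym ∷ <⇒≢ (ℕ.<-trans a<g g<x) ∘ sym ∷ <⇒≢ (ℕ.<-trans b<g g<x) ∘ sym ∷ [])
    ∷ (<⇒≢ p<g ∘ sym ∷ <⇒≢ a<g ∘ sym ∷ <⇒≢ b<g ∘ sym ∷ [])
    ∷ (<⇒≢ a<p ∘ sym ∷ <⇒≢ b<p ∘ sym ∷ [])
    ∷ (a≢b ∷ []) ∷ [] ∷ []

  C : Complement removed
  C = complement unique
  open Complement C

  pattern at₀ eq = here eq
  pattern at₁ eq = there (here eq)
  pattern at₂ eq = there (there (here eq))
  pattern at₃ eq = there (there (there (here eq)))
  pattern at₄ eq = there (there (there (there (here eq))))
  pattern at₅ eq = there (there (there (there (there (here eq)))))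

  removed-< : ∀ {u} → u ∈ₗ removed → rank u < rank y
  removed-< (at₀ refl) = ℕ.<-trans c<x x<y
  removed-< (at₁ refl) = x<y
  removed-< (at₂ refl) = ℕ.<-trans g<x x<y
  removed-< (at₃ refl) = ℕ.<-trans p<x x<y
  removed-< (at₄ refl) = ℕ.<-trans (ℕ.<-trans a<g g<x) x<y
  removed-< (at₅ refl) = ℕ.<-trans (ℕ.<-trans b<g g<x) x<y

  boundary : ∀ {u v} → u ∈ₗ removed → v ∉ₗ removed → Adj T u v → u ≡ x × v ≡ y
  boundary (at₀ refl) v∉ uv = contradiction (at₁ (proj₂ oc uv)) v∉
  boundary (at₁ refl) v∉ uv with x-nbrs uv
  ... | at₀ refl = refl , refl
  ... | at₁ refl = contradiction (at₀ refl) v∉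
  ... | at₂ refl = contradiction (at₂ refl) v∉
  boundary (at₂ refl) v∉ uv with g-nbrs uv
  ... | at₀ refl = contradiction (at₁ refl) v∉
  ... | at₁ refl = contradiction (at₃ refl) v∉
  boundary (at₃ refl) v∉ uv with p-nbrs uv
  ... | at₀ refl = contradiction (at₂ refl) v∉
  ... | at₁ refl = contradiction (at₄ refl) v∉
  ... | at₂ refl = contradiction (at₅ refl) v∉
  boundary (at₄ refl) v∉ uv = contradiction (at₃ (proj₂ oa uv)) v∉
  boundary (at₅ refl) v∉ uv = contradiction (at₃ (proj₂ ob uv)) v∉

  y∉ : y ∉ₗ removed
  y∉ y∈ = ℕ.<-irrefl refl (removed-< y∈)

  not-x : ∀ {s} → Adj T y s → x ≢ s → s ∉ₗ removed
  not-x ys x≢s s∈ = x≢s (sym (proj₁ (boundary s∈ y∉ (symmetric ys))))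

  rooted′ : Rooted (induced T ι)
  rooted′ = rooted-induced C R (λ r∈ → <⇒≢root (removed-< r∈) refl) top∉ closed
    where
    top∉ : top ∉ₗ removed
    top∉ t∈ with root ∈ₗ? removed
    ... | yes r∈ = <⇒≢root (removed-< r∈) refl
    ... | no r∉ = y≢root (sym (proj₂ (boundary t∈ r∉ (symmetric root-top))))
    closed : ∀ {u v} → u ∉ₗ removed → Adj T u v → rank u < rank v → v ∉ₗ removed
    closed u∉ uv lt v∈ with boundary v∈ u∉ (symmetric uv)
    ... | refl , refl = ℕ.<-asym lt x<y

  cover′ : ChainCover (induced T ι)
  cover′ = cover-induced C cover back ahead company
    where
    back : ∀ {u w} → u ⇝ w → w ∉ₗ removed → u ∉ₗ removed
    back r w∉ u∈ with boundary u∈ w∉ (edge r)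
    ... | refl , refl = ¬x⇝y r
    ahead : ∀ {u v v₁ w} → u ∉ₗ removed → v ∉ₗ removed → v₁ ∉ₗ removed →
      Adj T u v → Adj T u v₁ → v ≢ v₁ → u ⇝ w → w ∉ₗ removed
    ahead u∉ _ _ _ _ _ r w∈ with boundary w∈ u∉ (symmetric (edge r))
    ... | refl , refl = ¬y⇝x r
    company : ∀ {v} → v ∉ₗ removed → Start v → ∃ λ u → u ∉ₗ removed × Adj T v u × Start u
    company {v} v∉ sv with accompanied sv
    ... | u , vu , su with u ∈ₗ? removed
    ... | no u∉ = u , u∉ , vu , su
    ... | yes u∈ with boundary u∈ v∉ (symmetric vu)
    ... | refl , refl = contradiction g⇝x su

  undo-O5 : InF T
  undo-O5 with others
  ... | d , e , d≢e , x≢d , x≢e , yd , ye with locate y∉ | locate (not-x yd x≢d) | locate (not-x ye x≢e)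
  ... | y′ , ιy | d′ , ιd | e′ , ιe = iso
    (o5 {v = y′} (smaller (complement-< C) rooted′ cover′) (two≤deg {G = induced T ι} {y′} {d′} {e′}
      (λ eq → d≢e (trans (sym ιd) (trans (cong ι eq) ιe)))
      (subst₂ (Adj T) (sym ιy) (sym ιd) yd) (subst₂ (Adj T) (sym ιy) (sym ιe) ye)))
    (ExtendIso.extend-iso symmetric unique C (λ _ _ → refl)
      (λ where
        u₁ v ()
        v₁ v eq → subst (Adj T x) (sym (trans (cong ι (==⇒≡ eq)) ιy)) xy
        (suc (suc _)) v ())
      (λ j v jv → E⁻ j v y′ ιy (boundary (∈-lookup j) (ι∉ v) jv))
      (λ where
        u₁ v₁ _ → proj₁ oc
        v₁ v₂ _ → symmetric gx
        v₂ v₃ _ → symmetric pg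
        v₃ v₄ _ → symmetric (proj₁ oa)
        v₃ u₃ _ → symmetric (proj₁ ob)
        u₁ u₁ ()
        u₁ (suc (suc _)) ()
        v₁ u₁ ()
        v₁ v₁ ()
        v₁ (suc (suc (suc _))) ()
        v₂ u₁ ()
        v₂ v₁ ()
        v₂ v₂ ()
        v₂ (suc (suc (suc (suc _)))) ()
        v₃ u₁ ()
        v₃ v₁ ()
        v₃ v₂ ()
        v₃ v₃ ()
        (suc (suc (suc (suc _)))) _ ())
      (λ where
        u₁ j ij → case same {j} {v₁} (proj₂ oc ij) of λ { refl → refl }
        v₁ j ij → case x-nbrs ij of λ where
          (at₀ eq) → contradiction (subst (_∈ₗ removed) eq (∈-lookup j)) y∉
          (at₁ eq) → case same {j} {u₁} eq of λ { refl → refl }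
          (at₂ eq) → case same {j} {v₂} eq of λ { refl → refl }
        v₂ j ij → case g-nbrs ij of λ where
          (at₀ eq) → case same {j} {v₁} eq of λ { refl → refl }
          (at₁ eq) → case same {j} {v₃} eq of λ { refl → refl }
        v₃ j ij → case p-nbrs ij of λ where
          (at₀ eq) → case same {j} {v₂} eq of λ { refl → refl }
          (at₁ eq) → case same {j} {v₄} eq of λ { refl → refl }
          (at₂ eq) → case same {j} {u₃} eq of λ { refl → refl }
        v₄ j ij → case same {j} {v₃} (proj₂ oa ij) of λ { refl → refl }
        u₃ j ij → case same {j} {v₃} (proj₂ ob ij) of λ { refl → refl }))
    where
    same : ∀ {i j} → lookup removed i ≡ lookup removed j → i ≡ j
    same = lookup-injective unique
    E⁻ : ∀ (j : Fin 6) v y′ → ι y′ ≡ y → lookup removed j ≡ x × ι v ≡ y → (j == v₁ ∧ v == y′) ≡ true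
    E⁻ j v y′ ιy (jx , vy) with same {j} {v₁} jx | ι-injective (trans vy (sym ιy))
    ... | refl | refl = ≡⇒== v

-- The vertex `z`, with parent `y` and only child `v`, is suppressed and `y` joined to `v`. Ranks
-- stay: `y` is higher than `v` and becomes its parent.
module UndoO1 {n} {T : Graph n} (R : Rooted T) (cover : ChainCover T) (smaller : Smaller n)
  {z : Fin n} (C : Complement (z ∷ [])) {y v : Fin (Complement.m C)}
  (zy : Adj T z (Complement.ι C y)) (z<y : Below R z (Complement.ι C y)) (zv : Adj T z (Complement.ι C v)) (v<z : Below R (Complement.ι C v) z)
  (z-nbrs : ∀ {q} → Adj T z q → q ∈ₗ (Complement.ι C y ∷ Complement.ι C v ∷ [])) where
  open Rooted R
  open Complement
  open RootedFacts R
  open ChainCover cover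
  open CoverFacts R cover

  ι′ : Fin (m C) → Fin n
  ι′ = ι C

  z∉ : ∀ {a} → ι′ a ≢ z
  z∉ {a} eq = ι∉ C a (here eq)

  find : ∀ {x} → x ≢ z → ∃ λ a → ι′ a ≡ x
  find x≢z = locate C (∉-[] x≢z)

  y≢v : y ≢ v
  y≢v = <⇒≢ (ℕ.<-trans v<z z<y) ∘ cong ι′ ∘ sym

  v<y : rank (ι′ v) < rank (ι′ y)
  v<y = ℕ.<-trans v<z z<y

  apart : ¬ Adj T (ι′ y) (ι′ v)
  apart yv = z∉ (parent-unique (symmetric yv) v<y (symmetric zv) v<z)

  T′ : Graph (m C)
  T′ a b = T (ι′ a) (ι′ b) ∨ sameEdge y v a b

  data Edge : Fin (m C) → Fin (m C) → Set where
    old : ∀ {a b} → Adj T (ι′ a) (ι′ b) → Edge a b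
    yv  : Edge y v
    vy  : Edge v y

  edge⁻ : ∀ {a b} → Adj T′ a b → Edge a b
  edge⁻ {a} {b} ab with ∨⁻ ab
  ... | inj₁ e = old e
  ... | inj₂ e with sameEdge⁻ {u = y} {v} {a} {b} e
  ... | inj₁ (refl , refl) = yv
  ... | inj₂ (refl , refl) = vy

  edge⁺ : ∀ {a b} → Edge a b → Adj T′ a b
  edge⁺ {a} {b} (old e) = cong (_∨ sameEdge y v a b) e
  edge⁺ yv = trans (cong (T (ι′ y) (ι′ v) ∨_) (sameEdge⁺ {u = y} {v} (inj₁ (refl , refl)))) (∨-zeroʳ _)
  edge⁺ vy = trans (cong (T (ι′ v) (ι′ y) ∨_) (sameEdge⁺ {u = y} {v} (inj₂ (refl , refl)))) (∨-zeroʳ _)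

  rooted′ : Rooted T′
  rooted′ with find {root} (<⇒≢root z<y ∘ sym)
  ... | r , ιr = record
    { symmetric = symmetric′ ; root = r ; top = proj₁ top′ ; root-top = proj₁ (proj₂ top′)
    ; top-only = proj₂ (proj₂ top′)
    ; isRanked = record
      { rank = rank ∘ ι′ ; levels = levels′ ∘ edge⁻
      ; parent-unique = λ ab lt ac lt′ → parent-unique′ (edge⁻ ab) lt (edge⁻ ac) lt′
      ; parent = parent′ ; rank≤root = λ a → subst (λ x → rank (ι′ a) ≤ rank x) (sym ιr) (rank≤root (ι′ a)) } }
    where
    symmetric′ : ∀ {a b} → Adj T′ a b → Adj T′ b a
    symmetric′ ab with edge⁻ ab
    ... | old e = edge⁺ (old (symmetric e))
    ... | yv = edge⁺ vy
    ... | vy = edge⁺ yv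
    levels′ : ∀ {a b} → Edge a b → rank (ι′ a) ≢ rank (ι′ b)
    levels′ (old e) = levels e
    levels′ yv = ℕ.<⇒≢ v<y ∘ sym
    levels′ vy = ℕ.<⇒≢ v<y
    parent-unique′ : ∀ {a b c} → Edge a b → rank (ι′ a) < rank (ι′ b) →
      Edge a c → rank (ι′ a) < rank (ι′ c) → b ≡ c
    parent-unique′ (old e) lt (old e′) lt′ = ι-injective C (parent-unique e lt e′ lt′)
    parent-unique′ yv lt _ _ = contradiction lt (ℕ.<⇒≯ v<y)
    parent-unique′ _ _ yv lt = contradiction lt (ℕ.<⇒≯ v<y)
    parent-unique′ vy _ vy _ = refl
    parent-unique′ vy _ (old e) lt = contradiction (parent-unique e lt (symmetric zv) v<z) z∉
    parent-unique′ (old e) lt vy _ = contradiction (parent-unique e lt (symmetric zv) v<z) z∉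
    parent′ : ∀ {a} → a ≢ r → ∃ λ b → Adj T′ a b × rank (ι′ a) < rank (ι′ b)
    parent′ {a} a≢r with parent {ι′ a} (λ eq → a≢r (ι-injective C (trans eq (sym ιr))))
    ... | b , ab , lt with b ≟ z
    ... | no b≢z with find b≢z
    ... | b′ , refl = b′ , edge⁺ (old ab) , lt
    parent′ {a} a≢r | b , ab , lt | yes refl with z-nbrs (symmetric ab)
    ... | here eq = contradiction (subst (λ x → rank x < rank z) eq lt) (ℕ.<⇒≯ z<y)
    ... | there (here eq) with ι-injective C eq
    ... | refl = y , edge⁺ vy , v<y
    r≢v : r ≢ v
    r≢v refl = <⇒≢root v<z ιr
    top′ : ∃ λ t → Adj T′ r t × (∀ {b} → Adj T′ r b → b ≡ t)
    top′ with top ≟ z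
    ... | no top≢z with find top≢z
    ... | t , ιt = t , edge⁺ (old (subst₂ (Adj T) (sym ιr) (sym ιt) root-top)) , only ∘ edge⁻
      where
      r≢y : r ≢ y
      r≢y refl = top≢z (sym (top-only (subst (λ x → Adj T x z) ιr (symmetric zy))))
      only : ∀ {b} → Edge r b → b ≡ t
      only {b} (old e) = ι-injective C (trans (top-only (subst (λ x → Adj T x (ι′ b)) ιr e)) (sym ιt))
      only yv = contradiction refl r≢y
      only vy = contradiction refl r≢v
    -- If the suppressed vertex was `top`, then `y` is the root and `v` becomes its only neighbor.
    top′ | yes top≡z = v , subst (λ x → Adj T′ x v) (sym r≡y) (edge⁺ yv) , only ∘ edge⁻
      where
      z-root : Adj T z (ι′ r)
      z-root = subst₂ (Adj T) top≡z (sym ιr) (symmetric root-top)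
      r≡y : r ≡ y
      r≡y with z-nbrs z-root
      ... | here eq = ι-injective C eq
      ... | there (here eq) = contradiction (ι-injective C eq) r≢v
      only : ∀ {b} → Edge r b → b ≡ v
      only {b} (old e) = contradiction (trans (top-only (subst (λ x → Adj T x (ι′ b)) ιr e)) top≡z) z∉
      only yv = refl
      only vy = contradiction refl r≢v

  infix 4 _⇝′_
  -- Two consecutive forces through `z` merge into one. Since `z` has two neighbors it ends no
  -- chain; if it begins one, the vertex it forced becomes the start.
  _⇝′_ : Fin (m C) → Fin (m C) → Set
  a ⇝′ b = ι′ a ⇝ ι′ b ⊎ (ι′ a ⇝ z × z ⇝ ι′ b)

  around-z : ∀ {a b} → Adj T z (ι′ a) → Adj T z (ι′ b) → a ≢ b → Edge a b
  around-z za zb a≢b with z-nbrs za | z-nbrs zb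
  ... | here p | here q = contradiction (ι-injective C (trans p (sym q))) a≢b
  ... | there (here p) | there (here q) = contradiction (ι-injective C (trans p (sym q))) a≢b
  ... | here p | there (here q) with ι-injective C p | ι-injective C q
  ... | refl | refl = yv
  around-z za zb a≢b | there (here p) | here q with ι-injective C p | ι-injective C q
  ... | refl | refl = vy

  no-triangle : ∀ {a b} → Adj T z (ι′ a) → Adj T z (ι′ b) → ¬ Adj T (ι′ a) (ι′ b)
  no-triangle za zb ab with z-nbrs za | z-nbrs zb
  ... | here p | here q = irrefl (subst₂ (Adj T) p q ab)
  ... | there (here p) | there (here q) = irrefl (subst₂ (Adj T) p q ab)
  ... | here p | there (here q) = apart (subst₂ (Adj T) p q ab)
  ... | there (here p) | here q = apart (symmetric (subst₂ (Adj T) p q ab))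

  z-forces : ∃ (z ⇝_)
  z-forces = continue zy zv (y≢v ∘ ι-injective C)

  start⁺ : ∀ {b} → Start (ι′ b) → ¬ z ⇝ ι′ b → ∀ {a} → ¬ a ⇝′ b
  start⁺ s _ (inj₁ r) = s r
  start⁺ _ ¬zb (inj₂ (_ , zb)) = ¬zb zb

  start⁺′ : ∀ {b} → Start (ι′ b) → ∀ {a} → ¬ a ⇝′ b
  start⁺′ s = start⁺ s s

  cover′ : ChainCover T′
  cover′ = record
    { _⇝_ = _⇝′_ ; edge = edge⁺ ∘ edge′ ; functional = functional′ ; injective = injective′
    ; asym = asym′ ; forced? = forced?′ ; continue = λ ab ac → continue′ (edge⁻ ab) (edge⁻ ac)
    ; accompanied = accompanied′ }
    where
    edge′ : ∀ {a b} → a ⇝′ b → Edge a b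
    edge′ (inj₁ r) = old (edge r)
    edge′ (inj₂ (r , r′)) = around-z (symmetric (edge r)) (edge r′) (λ { refl → asym r r′ })
    functional′ : ∀ {a b c} → a ⇝′ b → a ⇝′ c → b ≡ c
    functional′ (inj₁ r) (inj₁ r′) = ι-injective C (functional r r′)
    functional′ (inj₁ r) (inj₂ (r′ , _)) = contradiction (functional r r′) z∉
    functional′ (inj₂ (r , _)) (inj₁ r′) = contradiction (functional r′ r) z∉
    functional′ (inj₂ (_ , r)) (inj₂ (_ , r′)) = ι-injective C (functional r r′)
    injective′ : ∀ {a b c} → a ⇝′ c → b ⇝′ c → a ≡ b
    injective′ (inj₁ r) (inj₁ r′) = ι-injective C (injective r r′)
    injective′ (inj₁ r) (inj₂ (_ , r′)) = contradiction (injective r r′) z∉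
    injective′ (inj₂ (_ , r)) (inj₁ r′) = contradiction (injective r′ r) z∉
    injective′ (inj₂ (r , _)) (inj₂ (r′ , _)) = ι-injective C (injective r r′)
    asym′ : ∀ {a b} → a ⇝′ b → ¬ b ⇝′ a
    asym′ (inj₁ r) (inj₁ r′) = asym r r′
    asym′ (inj₁ r) (inj₂ (r₁ , r₂)) = no-triangle (edge r₂) (symmetric (edge r₁)) (edge r)
    asym′ (inj₂ (r₁ , r₂)) (inj₁ r) = no-triangle (edge r₂) (symmetric (edge r₁)) (edge r)
    asym′ (inj₂ (r , _)) (inj₂ (_ , r′)) = asym r r′
    forced?′ : ∀ b → (∃ λ a → a ⇝′ b) ⊎ (∀ {a} → ¬ a ⇝′ b)
    forced?′ b with forced? (ι′ b)
    ... | inj₂ s = inj₂ (start⁺′ s)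
    ... | inj₁ (u , r) with u ≟ z
    ... | no u≢z with find u≢z
    ... | a , refl = inj₁ (a , inj₁ r)
    forced?′ b | inj₁ (u , r) | yes refl with forced? z
    ... | inj₂ s = inj₂ λ { (inj₁ r′) → z∉ (injective r′ r) ; (inj₂ (r′ , _)) → s r′ }
    ... | inj₁ (w , r′) with find {w} (λ { refl → irrefl (edge r′) })
    ... | a , refl = inj₁ (a , inj₂ (r′ , r))
    twoWays : ∀ {a b c} → Edge a b → Edge a c → b ≢ c →
      ∃ λ s → ∃ λ t → s ≢ t × Adj T (ι′ a) s × Adj T (ι′ a) t
    twoWays (old e) (old e′) b≢c = _ , _ , b≢c ∘ ι-injective C , e , e′
    twoWays (old e) yv _ = _ , z , z∉ , e , symmetric zy
    twoWays (old e) vy _ = _ , z , z∉ , e , symmetric zv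
    twoWays yv (old e) _ = _ , z , z∉ , e , symmetric zy
    twoWays vy (old e) _ = _ , z , z∉ , e , symmetric zv
    twoWays yv yv b≢c = contradiction refl b≢c
    twoWays vy vy b≢c = contradiction refl b≢c
    twoWays yv vy _ = contradiction refl y≢v
    twoWays vy yv _ = contradiction refl y≢v
    continue′ : ∀ {a b c} → Edge a b → Edge a c → b ≢ c → ∃ λ w → a ⇝′ w
    continue′ ab ac b≢c with twoWays ab ac b≢c
    ... | s , t , s≢t , as , at with continue as at s≢t
    ... | w , r with w ≟ z
    ... | no w≢z with find w≢z
    ... | w′ , refl = w′ , inj₁ r
    continue′ ab ac b≢c | s , t , s≢t , as , at | w , r | yes refl with z-forces
    ... | w′ , r′ with find {w′} (λ { refl → irrefl (edge r′) })
    ... | w″ , refl = w″ , inj₂ (r , r′)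
    accompanied′ : ∀ {b} → (∀ {a} → ¬ a ⇝′ b) → ∃ λ c → Adj T′ b c × (∀ {a} → ¬ a ⇝′ c)
    accompanied′ {b} s with forced? (ι′ b)
    ... | inj₂ sb with accompanied sb
    ... | c , bc , sc with c ≟ z
    ... | no c≢z with find c≢z
    ... | c′ , refl = c′ , edge⁺ (old bc) , start⁺′ sc
    accompanied′ {b} s | inj₂ sb | c , bc , sc | yes refl with z-forces
    ... | w , r with find {w} (λ { refl → irrefl (edge r) })
    -- The lost companion was the start `z`; the vertex it forced inherits the role and is joined to
    -- `b` by the new edge.
    ... | w′ , refl = w′ , edge⁺ (around-z (symmetric bc) (edge r) (λ { refl → sb r }))
      , λ { (inj₁ r′) → z∉ (injective r′ r) ; (inj₂ (r′ , _)) → sc r′ }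
    accompanied′ {b} s | inj₁ (u , r) with u ≟ z
    ... | no u≢z with find u≢z
    ... | a , refl = contradiction (inj₁ r) s
    accompanied′ {b} s | inj₁ (u , r) | yes refl with forced? z
    ... | inj₁ (w , r′) with find {w} (λ { refl → irrefl (edge r′) })
    ... | a , refl = contradiction (inj₂ (r′ , r)) s
    accompanied′ {b} s | inj₁ (u , r) | yes refl | inj₂ sz with accompanied sz
    ... | c , zc , sc with find {c} (λ { refl → irrefl zc })
    -- `b` has become a start in place of `z`; the companion of `z` is its other neighbor, now
    -- adjacent to `b`.
    ... | c′ , refl = c′ , edge⁺ (around-z (edge r) zc (λ { refl → sc r })) , start⁺′ sc

  small-deg : ∀ {s w} t → (∀ {q} → Edge s q → q ≡ t ⊎ Adj T (ι′ s) (ι′ q)) → w ≢ z →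
    (∀ {q} → Adj T (ι′ s) q → q ∈ₗ (z ∷ w ∷ [])) → deg T′ s ≤ 2
  small-deg {s} t split w≢z nbrs with find w≢z
  ... | w′ , refl = deg≤length {G = T′} (t ∷ w′ ∷ []) (λ sq → within (split (edge⁻ sq)))
    where
    within : ∀ {q} → q ≡ t ⊎ Adj T (ι′ s) (ι′ q) → q ∈ₗ (t ∷ w′ ∷ [])
    within (inj₁ eq) = here eq
    within (inj₂ sq) with nbrs sq
    ... | here eq = contradiction eq z∉
    ... | there (here eq) = there (here (ι-injective C eq))

  -- The degree bound of O1 as a list of neighbors: the new edge takes the place of the one to `z`.
  -- `w` need not be adjacent to `x`, so a leaf next to `z` qualifies too.
  BoundedBy : Fin n → Set
  BoundedBy x = ∃ λ w → w ≢ z × (∀ {q} → Adj T x q → q ∈ₗ (z ∷ w ∷ []))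

  small : BoundedBy (ι′ y) ⊎ BoundedBy (ι′ v) → deg T′ y ≤ 2 ⊎ deg T′ v ≤ 2
  small (inj₁ (w , w≢z , nbrs)) = inj₁ (small-deg v split w≢z nbrs)
    where
    split : ∀ {q} → Edge y q → q ≡ v ⊎ Adj T (ι′ y) (ι′ q)
    split (old e) = inj₂ e
    split yv = inj₁ refl
    split vy = contradiction refl y≢v
  small (inj₂ (w , w≢z , nbrs)) = inj₂ (small-deg y split w≢z nbrs)
    where
    split : ∀ {q} → Edge v q → q ≡ y ⊎ Adj T (ι′ v) (ι′ q)
    split (old e) = inj₂ e
    split yv = contradiction refl y≢v
    split vy = inj₁ refl

  undeleted : ∀ a b → T (ι′ a) (ι′ b) ≡ T′ a b ∧ not (sameEdge y v a b)
  undeleted a b with sameEdge y v a b in eq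
  ... | false = sym (trans (∧-identityʳ _) (∨-identityʳ _))
  ... | true = trans (¬-not no-edge) (sym (∧-zeroʳ _))
    where
    no-edge : ¬ Adj T (ι′ a) (ι′ b)
    no-edge ab with sameEdge⁻ {u = y} {v} {a} {b} eq
    ... | inj₁ (refl , refl) = apart ab
    ... | inj₂ (refl , refl) = apart (symmetric ab)

  ends⁺ : ∀ a → ι′ a ∈ₗ (ι′ y ∷ ι′ v ∷ []) → (a == y ∨ a == v) ≡ true
  ends⁺ a (here eq) with ι-injective C eq
  ... | refl rewrite ≡⇒== y = refl
  ends⁺ a (there (here eq)) with ι-injective C eq
  ... | refl rewrite ≡⇒== v = ∨-zeroʳ _

  ends⁻ : ∀ a → (a == y ∨ a == v) ≡ true → Adj T z (ι′ a)
  ends⁻ a e with ∨⁻ e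
  ... | inj₁ p = subst (λ a → Adj T z (ι′ a)) (sym (==⇒≡ p)) zy
  ... | inj₂ p = subst (λ a → Adj T z (ι′ a)) (sym (==⇒≡ p)) zv

  undo-O1 : BoundedBy (ι′ y) ⊎ BoundedBy (ι′ v) → InF T
  undo-O1 bounded = iso (o1 (smaller (complement-< C) rooted′ cover′) (edge⁺ yv) (small bounded))
    (ExtendIso.extend-iso symmetric ([] ∷ []) C undeleted
      (λ { zero a → ends⁻ a })
      (λ { zero a za → ends⁺ a (z-nbrs za) })
      (λ { zero zero () })
      (λ { zero zero zz → contradiction zz irrefl }))

-- Irreducible branches

searchNeighbor : ∀ {n} (T : Graph n) x (avoid : List (Fin n)) {P Q : Fin n → Set} →
  (∀ {c} → Adj T x c → c ∉ₗ avoid → P c ⊎ Q c) →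
  (∃ λ c → Adj T x c × c ∉ₗ avoid × P c) ⊎ (∀ {c} → Adj T x c → c ∉ₗ avoid → Q c)
searchNeighbor T x avoid {P} {Q} f with search {P = λ c → Adj T x c × c ∉ₗ avoid × P c}
  {λ c → Adj T x c → c ∉ₗ avoid → Q c} g
  where
  g : ∀ c → (Adj T x c × c ∉ₗ avoid × P c) ⊎ (Adj T x c → c ∉ₗ avoid → Q c)
  g c with T x c ≟ᵇ true | c ∈ₗ? avoid
  ... | no ¬xc | _ = inj₂ λ xc → contradiction xc ¬xc
  ... | yes _ | yes c∈ = inj₂ λ _ c∉ → contradiction c∈ c∉
  ... | yes xc | no c∉ with f xc c∉
  ... | inj₁ p = inj₁ (xc , c∉ , p)
  ... | inj₂ q = inj₂ λ _ _ → q
... | inj₁ found = inj₁ found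
... | inj₂ all = inj₂ (all _)

anotherNeighbor : ∀ {n} (T : Graph n) x (avoid : List (Fin n)) →
  (∃ λ c → Adj T x c × c ∉ₗ avoid) ⊎ (∀ {c} → Adj T x c → c ∈ₗ avoid)
anotherNeighbor T x avoid with searchNeighbor T x avoid {λ _ → Unit} {λ _ → ⊥} (λ _ _ → inj₁ tt)
... | inj₁ (c , xc , c∉ , _) = inj₁ (c , xc , c∉)
... | inj₂ none = inj₂ within
  where
  within : ∀ {c} → Adj T x c → c ∈ₗ avoid
  within {c} xc with c ∈ₗ? avoid
  ... | yes c∈ = c∈
  ... | no c∉ = ⊥-elim (none xc c∉)

module Branches {n} {T : Graph n} (R : Rooted T) where
  open Rooted R
  open RootedFacts R

  record Leaf (x y : Fin n) : Set where
    constructor leaf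
    field
      only : Only T x y
      up   : rank x < rank y

  record Cherry (x y : Fin n) : Set where
    constructor cherry
    field
      edge    : Adj T x y
      up      : rank x < rank y
      {a b}   : Fin n
      a≢b     : a ≢ b
      leaf-a  : Leaf a x
      leaf-b  : Leaf b x
      nbrs    : ∀ {z} → Adj T x z → z ∈ₗ (y ∷ a ∷ b ∷ [])

  record Stem (x y : Fin n) : Set where
    constructor stem
    field
      edge   : Adj T x y
      up     : rank x < rank y
      {p}    : Fin n
      on-top : Cherry p x
      nbrs   : ∀ {z} → Adj T x z → z ∈ₗ (y ∷ p ∷ [])

  data Branch (x y : Fin n) : Set where
    is-leaf   : Leaf x y → Branch x y
    is-cherry : Cherry x y → Branch x y
    is-stem   : Stem x y → Branch x y

  branch-edge : ∀ {x y} → Branch x y → Adj T x y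
  branch-edge (is-leaf l) = proj₁ (Leaf.only l)
  branch-edge (is-cherry k) = Cherry.edge k
  branch-edge (is-stem k) = Stem.edge k

  module WithCover (cover : ChainCover T) where
    open ChainCover cover
    open CoverFacts R cover

    cherry-start : ∀ {x y} → Cherry x y → Start x
    cherry-start (cherry _ _ a≢b (leaf oa _) (leaf ob _) _) = support-start a≢b oa ob

    -- `x` has two neighbors and must force one of them; its child is a start, being a cherry.
    stem-forces : ∀ {x y} → Stem x y → x ⇝ y
    stem-forces (stem xy x<y ch nbrs) with continue xy (symmetric (Cherry.edge ch)) (<⇒≢ (ℕ.<-trans (Cherry.up ch) x<y) ∘ sym)
    ... | w , r with nbrs (edge r)
    ... | here refl = r
    ... | there (here refl) = contradiction r (cherry-start ch)

    leaf-forced : ∀ {x y} → Leaf x y → ¬ Start y → y ⇝ x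
    leaf-forced {x} (leaf ox _) ¬sy with forced? x
    ... | inj₁ (u , r) = subst (_⇝ x) (forced-by-only ox r) r
    ... | inj₂ s = contradiction (λ {u} → only-start ox s {u}) (λ sy → ¬sy λ {u} → sy {u})

-- A cherry vertex that forces its parent may force one of its leaves instead; the parent becomes a start.
module Redirect {n} {T : Graph n} (R : Rooted T) (cover : ChainCover T)
  {p x a b : Fin n} (a≢b : a ≢ b) (oa : Only T a p) (ob : Only T b p)
  (p⇝x : ChainCover._⇝_ cover p x) (x≢a : x ≢ a) where
  open ChainCover cover
  open Rooted R
  open RootedFacts R
  open CoverFacts R cover

  start-p : Start p
  start-p = support-start a≢b oa ob

  start-a : Start a
  start-a r with forced-by-only oa r
  ... | refl = x≢a (functional p⇝x r)

  _⇝′_ : Fin n → Fin n → Set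
  u ⇝′ w = (u ⇝ w × u ≢ p) ⊎ (u ≡ p × w ≡ a)

  start′ : ∀ {v} → v ≢ a → Start v → ∀ {u} → ¬ u ⇝′ v
  start′ v≢a s (inj₁ (r , _)) = s r
  start′ v≢a s (inj₂ (_ , eq)) = v≢a eq

  p≢a : p ≢ a
  p≢a refl = irrefl (proj₁ oa)

  start-x′ : ∀ {u} → ¬ u ⇝′ x
  start-x′ (inj₁ (r , u≢p)) = u≢p (injective r p⇝x)
  start-x′ (inj₂ (_ , eq)) = x≢a eq

  redirected : ChainCover T
  redirected = record
    { _⇝_ = _⇝′_
    ; edge = λ where
        (inj₁ (r , _)) → edge r
        (inj₂ (refl , refl)) → symmetric (proj₁ oa)
    ; functional = λ where
        (inj₁ (r , _)) (inj₁ (r′ , _)) → functional r r′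
        (inj₁ (_ , u≢p)) (inj₂ (u≡p , _)) → contradiction u≡p u≢p
        (inj₂ (u≡p , _)) (inj₁ (_ , u≢p)) → contradiction u≡p u≢p
        (inj₂ (_ , refl)) (inj₂ (_ , refl)) → refl
    ; injective = λ where
        (inj₁ (r , _)) (inj₁ (r′ , _)) → injective r r′
        (inj₁ (r , _)) (inj₂ (_ , refl)) → contradiction r start-a
        (inj₂ (_ , refl)) (inj₁ (r , _)) → contradiction r start-a
        (inj₂ (refl , _)) (inj₂ (refl , _)) → refl
    ; asym = λ where
        (inj₁ (r , _)) (inj₁ (r′ , _)) → asym r r′
        (inj₁ (r , _)) (inj₂ (refl , refl)) → start-p r
        (inj₂ (refl , refl)) (inj₁ (r , _)) → start-p r
        (inj₂ (refl , refl)) (inj₂ (eq , _)) → p≢a (sym eq)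
    ; forced? = forced?′
    ; continue = continue′
    ; accompanied = accompanied′ }
    where
    forced?′ : ∀ v → (∃ λ u → u ⇝′ v) ⊎ (∀ {u} → ¬ u ⇝′ v)
    forced?′ v with v ≟ a | forced? v
    ... | yes v≡a | _ = inj₁ (p , inj₂ (refl , v≡a))
    ... | no v≢a | inj₂ s = inj₂ (start′ v≢a s)
    ... | no v≢a | inj₁ (u , r) with u ≟ p
    ... | no u≢p = inj₁ (u , inj₁ (r , u≢p))
    ... | yes refl with functional p⇝x r
    ... | refl = inj₂ start-x′
    continue′ : ∀ {u c d} → Adj T u c → Adj T u d → c ≢ d → ∃ λ w → u ⇝′ w
    continue′ {u} uc ud c≢d with u ≟ p | continue uc ud c≢d
    ... | yes u≡p | _ = a , inj₂ (u≡p , refl)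
    ... | no u≢p | w , r = w , inj₁ (r , u≢p)
    accompanied′ : ∀ {v} → (∀ {u} → ¬ u ⇝′ v) → ∃ λ u → Adj T v u × (∀ {w} → ¬ w ⇝′ u)
    accompanied′ {v} s with v ≟ x
    ... | yes refl = p , symmetric (edge p⇝x) , start′ p≢a start-p
    ... | no v≢x with accompanied {v} start-v
      where
      start-v : Start v
      start-v {u} r with u ≟ p
      ... | yes refl = v≢x (functional r p⇝x)
      ... | no u≢p = s (inj₁ (r , u≢p))
    ... | u , vu , su with u ≟ a
    ... | no u≢a = u , vu , start′ u≢a su
    ... | yes refl with proj₂ oa (symmetric vu)
    -- `a` was the companion of `p` and is now forced; the new start `x` replaces it.
    ... | refl = x , edge p⇝x , start-x′

module CherryCase {n} {T : Graph n} (R : Rooted T) (cover : ChainCover T) (smaller : Smaller n) where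
  open Rooted R
  open RootedFacts R
  open Branches R
  open WithCover cover
  open ChainCover cover
  open CoverFacts R cover
  open Reduce R cover smaller

  -- O4 can be undone at `p` unless `p` is the only companion of a start `x`; in that case O3 can be
  -- undone.
  remove-cherry : ∀ {x y p c} → Adj T x y → rank x < rank y → (ch : Cherry p x) → ¬ p ⇝ x →
    Branch c x → c ≢ y → c ≢ p → InF T
  remove-cherry {x} {y} {p} {c} xy x<y (cherry px p<x a≢b (leaf oa a<p) (leaf ob b<p) nbrs) ¬p⇝x br c≢y c≢p =
    by-cases (forced? x) (searchNeighbor T x (p ∷ []) (λ {c} _ _ → swap (forced? c)))
    where
    drop : (Start x → ∃ λ s → s ≢ p × Adj T x s × Start s) → InF T
    drop company = undo-O4 (<⇒≢root x<y) px p<x a≢b oa ob a<p b<p nbrs ¬p⇝x company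
      xy (symmetric (branch-edge br)) (c≢y ∘ sym) (<⇒≢ (ℕ.<-trans p<x x<y) ∘ sym) c≢p
    by-cases : (∃ λ u → u ⇝ x) ⊎ Start x →
      (∃ λ s → Adj T x s × s ∉ₗ (p ∷ []) × Start s) ⊎ (∀ {s} → Adj T x s → s ∉ₗ (p ∷ []) → ∃ λ u → u ⇝ s) → InF T
    by-cases (inj₁ (u , r)) _ = drop λ sx → contradiction r sx
    by-cases (inj₂ sx) (inj₁ (s , xs , s∉ , ss)) = drop λ _ → s , s∉ ∘ here , xs , ss
    by-cases (inj₂ sx) (inj₂ none) = lean br
      where
      -- Without p the start x would be isolated among the starts. Every other child is then a leaf
      -- forced by x, so x is still a strong support vertex once the leaves of p are removed.
      lean : Branch c x → InF T
      lean (is-leaf (leaf oc _)) = undo-O3 px p<x a≢b oa ob a<p b<p nbrs sx oc c≢p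
      lean (is-cherry k) = contradiction (proj₂ (none (symmetric (Cherry.edge k)) (∉-[] c≢p))) (cherry-start k)
      lean (is-stem k) = contradiction (stem-forces k) sx

module Classify {n} {T : Graph n} (R : Rooted T) (cover : ChainCover T) (smaller : Smaller n) where
  open Rooted R
  open RootedFacts R
  open Branches R
  open WithCover cover
  open ChainCover cover
  open CoverFacts R cover

  contract : ∀ {z y v} → Adj T z y → rank z < rank y → Adj T z v → rank v < rank z →
    (∀ {q} → Adj T z q → q ∈ₗ (y ∷ v ∷ [])) →
    (∃ λ s → s ∈ₗ (y ∷ v ∷ []) × ∃ λ w → w ≢ z × (∀ {q} → Adj T s q → q ∈ₗ (z ∷ w ∷ []))) → InF T
  contract {z} zy z<y zv v<z nbrs bounded
    with locate (∉-[] (<⇒≢ z<y ∘ sym)) | locate (∉-[] (<⇒≢ v<z))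
    where open Complement (complement {xs = z ∷ []} ([] ∷ []))
  ... | y′ , refl | v′ , refl = undo-O1 (which bounded)
    where
    open UndoO1 R cover smaller (complement {xs = z ∷ []} ([] ∷ [])) zy z<y zv v<z nbrs
    which : (∃ λ s → s ∈ₗ (ι′ y′ ∷ ι′ v′ ∷ []) × BoundedBy s) → BoundedBy (ι′ y′) ⊎ BoundedBy (ι′ v′)
    which (_ , here refl , b) = inj₁ b
    which (_ , there (here refl) , b) = inj₂ b

  -- One of `a` and `b` is a start and can be removed. Of `c` only adjacency is assumed, with no
  -- position below `x`: it may be the root.
  three-leaves : ∀ {x a b c} → x ≢ root → Leaf a x → Leaf b x → Only T c x →
    a ≢ b → a ≢ c → b ≢ c → InF T
  three-leaves x≢root (leaf oa a<x) (leaf ob b<x) oc a≢b a≢c b≢c with spare a≢b oa ob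
  ... | inj₁ sa = undo-O2 oa a<x x≢root ob oc b≢c (a≢b ∘ sym) (a≢c ∘ sym) sa
    where open Reduce R cover smaller
  ... | inj₂ sb = undo-O2 ob b<x x≢root oa oc a≢c a≢b (b≢c ∘ sym) sb
    where open Reduce R cover smaller

  -- Only a force from `p` to `x` stands in the way of `remove-cherry`; it is redirected into a leaf
  -- of `p`, which makes `x` a start.
  with-cherry : ∀ {x y p c} → Adj T x y → rank x < rank y → Cherry p x → Branch c x → c ≢ y → c ≢ p → InF T
  with-cherry {x} {p = p} xy x<y ch@(cherry px p<x a≢b (leaf oa a<p) (leaf ob b<p) nbrs) br c≢y c≢p with forced? x
  ... | inj₂ sx = CherryCase.remove-cherry R cover smaller xy x<y ch sx br c≢y c≢p
  ... | inj₁ (u , r) with u ≟ p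
  ... | no u≢p = CherryCase.remove-cherry R cover smaller xy x<y ch (λ r′ → u≢p (injective r r′)) br c≢y c≢p
  ... | yes refl = CherryCase.remove-cherry R redirected smaller xy x<y ch start-x′ br c≢y c≢p
    where open Redirect R cover a≢b oa ob r (<⇒≢ (ℕ.<-trans a<p p<x) ∘ sym)

  avoid-head : ∀ {x y : Fin n} {ys} → x ∉ₗ (y ∷ ys) → x ≢ y
  avoid-head x∉ eq = x∉ (here eq)

  -- The stem g forces x, so no other child does, and x forces at most one leaf child.
  with-stem : ∀ {x y g} → Adj T x y → rank x < rank y → Stem g x →
    (∀ {c} → Adj T x c → c ≢ y → Leaf c x ⊎ Stem c x) → InF T
  with-stem {x} {y} {g} xy x<y st@(stem gx g<x (cherry pg p<g a≢b (leaf oa a<p) (leaf ob b<p) p-nbrs) g-nbrs) kids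
    with anotherNeighbor T x (y ∷ g ∷ [])
  -- With `g` as its only child, `x` can be suppressed: `g` has just two neighbors, which gives the
  -- degree bound.
  ... | inj₂ nbrs = contract xy x<y (symmetric gx) g<x nbrs
    (g , there (here refl) , _ , <⇒≢ (ℕ.<-trans p<g g<x) , g-nbrs)
  ... | inj₁ (c , xc , c∉) with kids xc (avoid-head c∉)
  ... | inj₂ st′ = contradiction (here (injective (stem-forces st′) (stem-forces st))) (c∉ ∘ there)
  ... | inj₁ lc with anotherNeighbor T x (y ∷ c ∷ g ∷ [])
  ... | inj₂ nbrs = UndoO5.undo-O5 R cover smaller xy x<y (Leaf.only lc) (Leaf.up lc)
    (λ eq → c∉ (there (here eq))) gx g<x pg p<g a≢b oa ob a<p b<p nbrs g-nbrs p-nbrs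
  ... | inj₁ (d , xd , d∉) with kids xd (avoid-head d∉)
  ... | inj₂ st′ = contradiction (there (here (injective (stem-forces st′) (stem-forces st)))) (d∉ ∘ there)
  ... | inj₁ ld = contradiction (here (functional (forced-leaf ld) (forced-leaf lc))) (d∉ ∘ there)
    where
    forced-leaf : ∀ {d} → Leaf d x → x ⇝ d
    forced-leaf l = leaf-forced l λ sx → sx (stem-forces st)

  -- By the number of children: none gives a leaf and two a cherry; one leaf child allows O1 to be
  -- undone, three allow O2.
  leaves-only : ∀ {x y} → Adj T x y → rank x < rank y → (∀ {c} → Adj T x c → c ≢ y → Leaf c x) → InF T ⊎ Branch x y
  leaves-only {x} {y} xy x<y kids with anotherNeighbor T x (y ∷ [])
  ... | inj₂ nbrs = inj₂ (is-leaf (leaf (xy , only) x<y))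
    where
    only : ∀ {z} → Adj T x z → z ≡ y
    only xz with nbrs xz
    ... | here eq = eq
  ... | inj₁ (a , xa , a∉) with kids xa (avoid-head a∉) | anotherNeighbor T x (y ∷ a ∷ [])
  ... | leaf oa a<x | inj₂ nbrs = inj₁ (contract xy x<y xa a<x nbrs
    -- The leaf `a` is adjacent to `x` alone; `y` merely fills the second place in its list.
    (a , there (here refl) , y , <⇒≢ x<y ∘ sym , λ aq → here (proj₂ oa aq)))
  ... | la | inj₁ (b , xb , b∉) with kids xb (avoid-head b∉) | anotherNeighbor T x (y ∷ a ∷ b ∷ [])
  ... | lb | inj₂ nbrs = inj₂ (is-cherry (cherry xy x<y (λ eq → b∉ (there (here (sym eq)))) la lb nbrs))
  ... | lb | inj₁ (c , xc , c∉) = inj₁ (three-leaves (<⇒≢root x<y) la lb (Leaf.only (kids xc (avoid-head c∉)))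
    (λ eq → b∉ (there (here (sym eq)))) (λ eq → c∉ (there (here (sym eq)))) (λ eq → c∉ (there (there (here (sym eq))))))

  -- Cherries come first, since one can be dealt with beside any sibling branch. A stem is treated
  -- once its siblings are known to be leaves or stems.
  branch-or-member : ∀ {x y} → Adj T x y → rank x < rank y → (∀ {c} → Adj T x c → c ≢ y → Branch c x) → InF T ⊎ Branch x y
  branch-or-member {x} {y} xy x<y kids with searchNeighbor T x (y ∷ []) {λ c → Cherry c x} {λ c → Leaf c x ⊎ Stem c x} split
    where
    split : ∀ {c} → Adj T x c → c ∉ₗ (y ∷ []) → Cherry c x ⊎ (Leaf c x ⊎ Stem c x)
    split xc c∉ with kids xc (avoid-head c∉)
    ... | is-leaf l = inj₂ (inj₁ l)
    ... | is-cherry k = inj₁ k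
    ... | is-stem s = inj₂ (inj₂ s)
  ... | inj₁ (p , xp , p∉ , ch) with anotherNeighbor T x (y ∷ p ∷ [])
  ... | inj₂ nbrs = inj₂ (is-stem (stem xy x<y ch nbrs))
  ... | inj₁ (c , xc , c∉) = inj₁ (with-cherry xy x<y ch (kids xc (avoid-head c∉)) (avoid-head c∉) (avoid-head (c∉ ∘ there)))
  branch-or-member {x} {y} xy x<y kids | inj₂ rest with searchNeighbor T x (y ∷ []) {λ c → Stem c x} {λ c → Leaf c x} (λ xc c∉ → swap (rest xc c∉))
  ... | inj₁ (g , xg , g∉ , st) = inj₁ (with-stem xy x<y st (λ xc c≢y → rest xc (∉-[] c≢y)))
  ... | inj₂ leaves = leaves-only xy x<y (λ xc c≢y → leaves xc (∉-[] c≢y))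

  -- Descends by rank. A reduction found anywhere below `x` settles the membership of the whole
  -- tree, so the first alternative is passed up unchanged.
  classify : ∀ b {x y} → rank x < b → Adj T x y → rank x < rank y → InF T ⊎ Branch x y
  classify (suc b) {x} {y} (s≤s x≤b) xy x<y
    with searchNeighbor T x (y ∷ []) {λ _ → InF T} {λ c → Branch c x} recurse
    where
    recurse : ∀ {c} → Adj T x c → c ∉ₗ (y ∷ []) → InF T ⊎ Branch c x
    recurse {c} xc c∉ = classify b (ℕ.<-≤-trans c<x x≤b) (symmetric xc) c<x
      where c<x = child-< xy x<y xc (avoid-head c∉)
  ... | inj₁ (_ , _ , _ , f) = inj₁ f
  ... | inj₂ kids = branch-or-member xy x<y (λ xc c≢y → kids xc (∉-[] c≢y))

  top<root : rank top < rank root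
  top<root = ℕ.≤∧≢⇒< (rank≤root top) (levels (symmetric root-top))

  two-vertices : Only T top root → InF T
  two-vertices ot = iso base (mk↔ₛ′ to from to-from from-to , same)
    where
    root≢top : root ≢ top
    root≢top eq = <⇒≢ top<root (sym eq)
    -- Climbs through parents: a vertex whose parent is the root is `top`, and `top` has no neighbor
    -- but the root.
    all : ∀ b x → rank root ∸ rank x < b → x ≡ root ⊎ x ≡ top
    all (suc b) x (s≤s bound) with x ≟ root
    ... | yes eq = inj₁ eq
    ... | no x≢root with parent x≢root
    ... | w , xw , lt with all b w (ℕ.<-≤-trans (ℕ.∸-monoʳ-< lt (rank≤root w)) bound)
    ... | inj₁ refl = inj₂ (top-only (symmetric xw))
    ... | inj₂ refl = inj₁ (proj₂ ot (symmetric xw))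
    to : Fin 2 → Fin n
    to zero = root
    to (suc zero) = top
    from : Fin n → Fin 2
    from x with x ≟ root
    ... | yes _ = zero
    ... | no _ = suc zero
    to-from : ∀ x → to (from x) ≡ x
    to-from x with x ≟ root
    ... | yes eq = sym eq
    ... | no x≢root with all _ x ℕ.≤-refl
    ... | inj₁ eq = contradiction eq x≢root
    ... | inj₂ eq = sym eq
    from-to : ∀ i → from (to i) ≡ i
    from-to zero with root ≟ root
    ... | yes _ = refl
    ... | no ne = contradiction refl ne
    from-to (suc zero) with top ≟ root
    ... | yes eq = contradiction (sym eq) root≢top
    ... | no _ = refl
    same : ∀ i j → T (to i) (to j) ≡ P₂ i j
    same zero zero = ¬-not irrefl
    same zero (suc zero) = root-top
    same (suc zero) zero = proj₁ ot
    same (suc zero) (suc zero) = ¬-not irrefl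

  root-only : Only T root top
  root-only = root-top , top-only

  -- At `top` the parent is itself a leaf, so a cherry there has a third leaf and a stem is a
  -- degree-two vertex next to a leaf. Only the tree with two vertices remains irreducible.
  member : InF T
  member with classify _ ℕ.≤-refl (symmetric root-top) top<root
  ... | inj₁ f = f
  ... | inj₂ (is-leaf l) = two-vertices (Leaf.only l)
  ... | inj₂ (is-cherry (cherry _ _ a≢b la lb _)) = three-leaves (<⇒≢root top<root) la lb root-only
    a≢b (<⇒≢root (Leaf.up la)) (<⇒≢root (Leaf.up lb))
  ... | inj₂ (is-stem (stem _ _ ch nbrs)) = contract (symmetric root-top) top<root (symmetric (Cherry.edge ch)) (Cherry.up ch)
    -- The root has degree 1, so any vertex other than `top` can fill the second place of its list.
    nbrs (root , here refl , _ , <⇒≢ (Cherry.up ch) , λ rq → here (top-only rq))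

-- Induction on the number of vertices, and the characterization of equality

cover⇒InF : ∀ b {n} {T : Graph n} → n < b → Rooted T → ChainCover T → InF T
cover⇒InF (suc b) {n} (s≤s n≤b) R cover =
  Classify.member R cover (λ m<n → cover⇒InF b (ℕ.<-≤-trans m<n n≤b))

theorem4 : ∀ {n} (T : Graph n) → IsTree T → 2 ≤ n →
    ∀ (k : ℕ) → IsFt T k → leaves T ≤ k × (k ≡ leaves T ⇔ InF T)
theorem4 T tree 2≤n k ((S , tf , refl) , least) = leaves≤ , mk⇔ equality⇒InF InF⇒equality
  where
  open FromTFSet (proj₁ tree) tf
  equality⇒InF : ∣ S ∣ ≡ leaves T → InF T
  equality⇒InF eq = cover⇒InF _ ℕ.≤-refl (rooted tree 2≤n) (cover (ℕ.≤-reflexive eq))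
  InF⇒equality : InF T → ∣ S ∣ ≡ leaves T
  -- The minimum is compared with the set of starts of the cover that membership provides.
  InF⇒equality f = ℕ.≤-antisym (ℕ.≤-trans (least _ (ToTFSet.tf (proj₁ tree) cover′)) (ToTFSet.∣S∣≤leaves (proj₁ tree) cover′)) leaves≤
    where cover′ = InF⇒cover f
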